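{- Let $m$ be a positive integer and let $(K,\partial_0,\dots,\partial_{m-1})$ be a field with $m$ commuting derivations. Let $n$ and $r$ be positive integers, and suppose $K$ has a field extension $K(a_h^{\xi}\colon|\xi|\le 2r\land h<n)$ that meets the differential condition. Suppose further that for each $k<n$, either $|\sigma|\le r$ whenever $a_k^{\sigma}$ is a minimal separable leader, or else there is some $\tau\in\mathbb{N}^m$ with $|\tau|=2r$ such that $\sigma\le\tau$ whenever $a_k^{\sigma}$ is a minimal separable leader. Then $(K,\partial_0,\dots,\partial_{m-1})$ has an extension $(M,D_0,\dots,D_{m-1})$ (a field $M\supseteq K$ with $m$ commuting derivations extending the $\partial_i$) compatible with $K(a_h^{\xi}\colon|\xi|<2r\land h<n)$, i.e. $K(a_h^{\xi}\colon|\xi|<2r\land h<n)\subseteq M$ and $D_ia_k^{\sigma}=a_k^{\sigma+\varepsilon_i}$ whenever $i<m$, $k<n$ and $|\sigma|+1<2r$.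
   Context: $n$ denotes also $\{0,\dots,n-1\}$. For $\sigma\in\mathbb{N}^m$, $|\sigma|=\sum_{i<m}\sigma(i)$; $\le$ is the componentwise order on $\mathbb{N}^m$; $\varepsilon_i$ is the characteristic function of $\{i\}$ in $\mathbb{N}^m$. The total order $\unlhd$ on $\mathbb{N}^m\times n$: $(\xi,k)\unlhd(\eta,g)$ iff $(|\xi|,k,\xi(0),\dots,\xi(m-2))$ is lexicographically $\le(|\eta|,g,\eta(0),\dots,\eta(m-2))$; $\lhd$ is the strict version. The extension meets the differential condition if: whenever $i<m$, $k<n$, $|\sigma|+1\le 2r$, and $f$ is a polynomial over $K$ in variables $(x_h^{\xi}\colon(\xi,h)\unlhd(\sigma,k))$ vanishing at $a=(a_h^{\xi}\colon(\xi,h)\unlhd(\sigma,k))$, then $\sum_{(\eta,g)\unlhd(\sigma,k)}\frac{\partial f}{\partial x_g^{\eta}}(a)\,a_g^{\eta+\varepsilon_i}+f^{\partial_i}(a)=0$, with $f^{\partial_i}$ being $f$ with $\partial_i$ applied to its coefficients. A generator $a_k^{\sigma}$ is a separable leader if it is separably algebraic over $K(a_h^{\xi}\colon(\xi,h)\lhd(\sigma,k))$, and a minimal separable leader if in addition no $a_k^{\rho}$ with $\rho\le\sigma$, $\rho\ne\sigma$, is a separable leader. -}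

module Defs where

open import Algebra.Bundles using (CommutativeRing; RawRing; Semiring)
import Algebra.Definitions as Definitions
import Algebra.Definitions.RawSemiring as RawSemiringOps
open import Algebra.Morphism.Structures using (IsRingMonomorphism)
import Algebra.Morphism.RingMonomorphism as RingMonomorphism
open import Data.Bool.Base using (if_then_else_)
open import Data.Fin.Base using (Fin; toℕ)
open import Data.List.Base as List using (List; []; _∷_; _++_)
open import Data.List.Membership.Propositional using (_∈_)
open import Data.List.Membership.Propositional.Properties
  using (∈-allFin; ∈-cartesianProduct⁺; ∈-cartesianProductWith⁺; ∈-filter⁺; ∈-filter⁻; ∈-upTo⁺)
open import Data.List.Relation.Unary.Any using (here)
open import Data.Nat.Base as ℕ using (ℕ; zero; suc; pred; s≤s; _≤_; _<_)
open import Data.Nat.Properties as ℕ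
  using (≤-trans; <⇒≤; ≤-reflexive; m≤m+n; m≤n+m)
open import Data.Product.Base using (Σ; ∃; ∃-syntax; ∃₂; _×_; _,_; proj₁; proj₂)
open import Data.Sum.Base using (_⊎_)
open import Data.Vec.Base as Vec using (Vec; []; _∷_)
import Data.Vec.Properties as Vec
open import Data.Vec.Relation.Binary.Lex.Strict as Lex using (Lex-≤; Lex-<; this; next)
open import Data.Vec.Relation.Binary.Pointwise.Inductive using (Pointwise)
open import Level using (Level; _⊔_) renaming (suc to lsuc)
open import Relation.Binary.Definitions using (Decidable)
open import Relation.Binary.PropositionalEquality.Core using (_≡_; _≢_; refl)
open import Relation.Nullary.Decidable.Core using (does)
open import Relation.Nullary.Negation.Core using (¬_)

private
  variable
    c ℓ c₁ ℓ₁ c₂ ℓ₂ : Level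

-- Fields in the classical sense: being nonzero is the negation of
-- x ≈ 0#, with no apartness relation as extra data (unlike HeytingField).

record Field c ℓ : Set (lsuc (c ⊔ ℓ)) where
  field
    commutativeRing : CommutativeRing c ℓ
  open CommutativeRing commutativeRing public
  open Definitions _≈_ using (Invertible)
  field
    1≉0     : ¬ (1# ≈ 0#)
    inverse : ∀ x → ¬ (x ≈ 0#) → Invertible 1# _*_ x

-- L as an extension of K; K ⊆ L is expressed by an embedding ι.

record FieldExtension (K : Field c₁ ℓ₁) (L : Field c₂ ℓ₂) : Set (c₁ ⊔ ℓ₁ ⊔ c₂ ⊔ ℓ₂) where
  private
    module K = Field K
    module L = Field L
  field
    ι                  : K.Carrier → L.Carrier
    isRingMonomorphism : IsRingMonomorphism K.rawRing L.rawRing ι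
  open IsRingMonomorphism isRingMonomorphism public

-- The subfield K(g i : i ∈ I) of L.

module Adjoin {K : Field c₁ ℓ₁} {L : Field c₂ ℓ₂} (E : FieldExtension K L)
              {I : Set} (g : I → Field.Carrier L) where

  private
    module K = Field K
    module L = Field L
    module E = FieldExtension E
  open L using (_≈_; _+_; _*_; -_; 0#; 1#)

  data Generated : L.Carrier → Set (c₁ ⊔ c₂ ⊔ ℓ₂) where
    base : ∀ x → Generated (E.ι x)
    gen  : ∀ i → Generated (g i)
    add  : ∀ {x y} → Generated x → Generated y → Generated (x + y)
    mul  : ∀ {x y} → Generated x → Generated y → Generated (x * y)
    neg  : ∀ {x} → Generated x → Generated (- x)
    inv  : ∀ {x y} → x * y ≈ 1# → Generated x → Generated y
    resp : ∀ {x y} → x ≈ y → Generated x → Generated y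

  private
    rawRing : RawRing (c₁ ⊔ c₂ ⊔ ℓ₂) ℓ₂
    rawRing = record
      { Carrier = Σ L.Carrier Generated
      ; _≈_     = λ x y → proj₁ x ≈ proj₁ y
      ; _+_     = λ (x , p) (y , q) → x + y , add p q
      ; _*_     = λ (x , p) (y , q) → x * y , mul p q
      ; -_      = λ (x , p) → - x , neg p
      ; 0#      = 0# , resp E.0#-homo (base K.0#)
      ; 1#      = 1# , resp E.1#-homo (base K.1#)
      }

    proj₁-isRingMonomorphism : IsRingMonomorphism rawRing L.rawRing proj₁
    proj₁-isRingMonomorphism = record
      { isRingHomomorphism = record
        { isSemiringHomomorphism = record
          { isNearSemiringHomomorphism = record
            { +-isMonoidHomomorphism = record
              { isMagmaHomomorphism = record
                { isRelHomomorphism = record { cong = λ x≈y → x≈y }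
                ; homo              = λ _ _ → L.refl
                }
              ; ε-homo = L.refl
              }
            ; *-homo = λ _ _ → L.refl
            }
          ; 1#-homo = L.refl
          }
        ; -‿homo = λ _ → L.refl
        }
      ; injective = λ x≈y → x≈y
      }

  subfield : Field (c₁ ⊔ c₂ ⊔ ℓ₂) ℓ₂
  subfield = record
    { commutativeRing = record
      { isCommutativeRing =
          RingMonomorphism.isCommutativeRing proj₁-isRingMonomorphism L.isCommutativeRing }
    ; 1≉0     = L.1≉0
    ; inverse = λ (x , p) x≉0 → let (y , yx≈1 , xy≈1) = L.inverse x x≉0 in
                  (y , inv xy≈1 p) , yx≈1 , xy≈1
    }

  subfield⊆L : FieldExtension subfield L
  subfield⊆L = record { ι = proj₁ ; isRingMonomorphism = proj₁-isRingMonomorphism }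

  fromBase : K.Carrier → Field.Carrier subfield
  fromBase x = E.ι x , base x

  generator : I → Field.Carrier subfield
  generator i = g i , gen i

-- A polynomial is a formal finite sum of terms c x₀^e₀ ⋯ x_{N-1}^e_{N-1}.
-- An exponent vector may occur in several terms, so polynomials are
-- compared through their coefficients.

module Polynomial (R : CommutativeRing c ℓ) where

  open CommutativeRing R
  open RawSemiringOps (Semiring.rawSemiring semiring) using () renaming (_×_ to _·_)

  Poly : ℕ → Set c
  Poly N = List (Carrier × Vec ℕ N)

  private
    variable
      N : ℕ

  coeff : Vec ℕ N → Poly N → Carrier
  coeff e []             = 0#
  coeff e ((b , d) ∷ ts) = if does (Vec.≡-dec ℕ._≟_ d e) then b + coeff e ts else coeff e ts

  infix 4 _≈ₚ_
  _≈ₚ_ : Poly N → Poly N → Set ℓ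
  p ≈ₚ q = ∀ e → coeff e p ≈ coeff e q

  1ₚ : Poly N
  1ₚ = (1# , Vec.replicate _ 0) ∷ []

  infixl 6 _+ₚ_
  _+ₚ_ : Poly N → Poly N → Poly N
  _+ₚ_ = _++_

  infixl 7 _*ₚ_
  _*ₚ_ : Poly N → Poly N → Poly N
  _*ₚ_ = List.cartesianProductWith λ (b , d) (c , e) → b * c , Vec.zipWith ℕ._+_ d e

  -- When the j-th exponent is 0, the coefficient becomes 0#, so the
  -- truncated predecessor is harmless.

  ∂/∂x : Fin N → Poly N → Poly N
  ∂/∂x j = List.map λ (b , e) → Vec.lookup e j · b , Vec.updateAt e j pred

  mapCoeff : (Carrier → Carrier) → Poly N → Poly N
  mapCoeff δ = List.map λ (b , e) → δ b , e

module _ {K : Field c₁ ℓ₁} {L : Field c₂ ℓ₂} (E : FieldExtension K L) where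

  private
    module K = Field K
    module L = Field L
  open L using (_+_; _*_; 0#)
  open FieldExtension E using (ι)
  open Polynomial K.commutativeRing
  open RawSemiringOps (Semiring.rawSemiring L.semiring) using (product; _^_)

  eval : ∀ {N} → (Fin N → L.Carrier) → Poly N → L.Carrier
  eval x []             = 0#
  eval x ((b , e) ∷ ts) = ι b * product (λ j → x j ^ Vec.lookup e j) + eval x ts

  Vanishes : L.Carrier → Poly 1 → Set ℓ₂
  Vanishes x p = eval (λ _ → x) p L.≈ 0#

  MonicOfDegree : ℕ → Poly 1 → Set ℓ₁
  MonicOfDegree d p =
    coeff (d ∷ []) p K.≈ K.1# × (∀ e → d < e → coeff (e ∷ []) p K.≈ K.0#)

  IsMinimalPolynomial : L.Carrier → Poly 1 → Set (c₁ ⊔ ℓ₁ ⊔ ℓ₂)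
  IsMinimalPolynomial x p = ∃[ d ]
    MonicOfDegree d p × Vanishes x p ×
    (∀ q e → MonicOfDegree e q → Vanishes x q → d ≤ e)

  -- Coprime to its derivative, i.e. without multiple roots in any extension.

  Separable : Poly 1 → Set (c₁ ⊔ ℓ₁)
  Separable p = ∃₂ λ u v → u *ₚ p +ₚ v *ₚ ∂/∂x Fin.zero p ≈ₚ 1ₚ

  SeparablyAlgebraic : L.Carrier → Set (c₁ ⊔ ℓ₁ ⊔ ℓ₂)
  SeparablyAlgebraic x = ∃[ p ] IsMinimalPolynomial x p × Separable p

record IsDerivation (K : Field c ℓ) (δ : Field.Carrier K → Field.Carrier K) : Set (c ⊔ ℓ) where
  open Field K
  field
    cong    : ∀ {x y} → x ≈ y → δ x ≈ δ y
    +-homo  : ∀ x y → δ (x + y) ≈ δ x + δ y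
    leibniz : ∀ x y → δ (x * y) ≈ δ x * y + x * δ y

record DifferentialField (m : ℕ) c ℓ : Set (lsuc (c ⊔ ℓ)) where
  field
    underlying : Field c ℓ
  open Field underlying public
  field
    ∂            : Fin m → Carrier → Carrier
    isDerivation : ∀ i → IsDerivation underlying (∂ i)
    commute      : ∀ i j x → ∂ i (∂ j x) ≈ ∂ j (∂ i x)

record DifferentialExtension {m} (K : DifferentialField m c₁ ℓ₁) (M : DifferentialField m c₂ ℓ₂)
    : Set (c₁ ⊔ ℓ₁ ⊔ c₂ ⊔ ℓ₂) where
  private
    module K = DifferentialField K
    module M = DifferentialField M
  field
    extension : FieldExtension K.underlying M.underlying
  open FieldExtension extension public
  field
    ∂-homo : ∀ i x → ι (K.∂ i x) M.≈ M.∂ i (ι x)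

ℕ^ : ℕ → Set
ℕ^ = Vec ℕ

∣_∣ : ∀ {m} → ℕ^ m → ℕ
∣_∣ = Vec.sum

infix 4 _≤ᵐ_
_≤ᵐ_ : ∀ {m} → ℕ^ m → ℕ^ m → Set
_≤ᵐ_ = Pointwise _≤_

infixl 6 _+ᵐ_
_+ᵐ_ : ∀ {m} → ℕ^ m → ℕ^ m → ℕ^ m
_+ᵐ_ = Vec.zipWith ℕ._+_

ε : ∀ {m} → Fin m → ℕ^ m
ε i = Vec.replicate _ 0 Vec.[ i ]≔ 1

-- The number of derivations is suc m throughout, and (ξ , k) stands for
-- the variable or generator written with upper index ξ and lower index k.

Index : ℕ → ℕ → Set
Index m n = ℕ^ (suc m) × Fin n

module _ {m n : ℕ} where

  key : Index m n → Vec ℕ (suc (suc m))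
  key (ξ , k) = ∣ ξ ∣ ∷ toℕ k ∷ Vec.init ξ

  infix 4 _⊴_ _⊲_ _⊴?_
  _⊴_ _⊲_ : Index m n → Index m n → Set
  v ⊴ w = Lex-≤ _≡_ _<_ (key v) (key w)
  v ⊲ w = Lex-< _≡_ _<_ (key v) (key w)

  _⊴?_ : Decidable _⊴_
  v ⊴? w = Lex.≤-dec ℕ._≟_ ℕ._<?_ (key v) (key w)

  ⊴⇒≤ : ∀ {v w} → v ⊴ w → ∣ proj₁ v ∣ ≤ ∣ proj₁ w ∣
  ⊴⇒≤ (this p _) = <⇒≤ p
  ⊴⇒≤ (next p _) = ≤-reflexive p

  -- All ξ whose entries are at most d, and thence all v ⊴ w.

  box : ∀ l → ℕ → List (ℕ^ l)
  box zero    d = [] ∷ []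
  box (suc l) d = List.cartesianProductWith _∷_ (List.upTo (suc d)) (box l d)

  variables : Index m n → List (Index m n)
  variables w =
    List.filter (_⊴? w) (List.cartesianProduct (box (suc m) ∣ proj₁ w ∣) (List.allFin n))

  ∈-box : ∀ {l d} (ξ : ℕ^ l) → ∣ ξ ∣ ≤ d → ξ ∈ box l d
  ∈-box []      _ = here refl
  ∈-box (x ∷ ξ) p = ∈-cartesianProductWith⁺ _∷_
    (∈-upTo⁺ (s≤s (≤-trans (m≤m+n x ∣ ξ ∣) p)))
    (∈-box ξ (≤-trans (m≤n+m ∣ ξ ∣ x) p))

  ∈-variables⁺ : ∀ {v w} → v ⊴ w → v ∈ variables w
  ∈-variables⁺ {v} {w} v⊴w = ∈-filter⁺ (_⊴? w)
    (∈-cartesianProduct⁺ (∈-box (proj₁ v) (⊴⇒≤ {v} {w} v⊴w)) (∈-allFin (proj₂ v))) v⊴w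

  ∈-variables⁻ : ∀ {v w} → v ∈ variables w → v ⊴ w
  ∈-variables⁻ {v} {w} v∈ = proj₂ (∈-filter⁻ (_⊴? w)
    {xs = List.cartesianProduct (box (suc m) ∣ proj₁ w ∣) (List.allFin n)} v∈)

-- L is to be K(a_h^ξ : |ξ| ≤ 2r, h < n), see IsGenerated.
-- The family a is total for convenience; its values at indices with
-- |ξ| > 2r are never used.

module _ {m n : ℕ} (r : ℕ) (K : DifferentialField (suc m) c₁ ℓ₁) {L : Field c₂ ℓ₂}
         (E : FieldExtension (DifferentialField.underlying K) L)
         (a : Index m n → Field.Carrier L) where

  private
    module K = DifferentialField K
    module L = Field L
  open L using (_≈_; _+_; _*_; 0#)
  open Polynomial K.commutativeRing using (Poly; ∂/∂x; mapCoeff)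
  open RawSemiringOps (Semiring.rawSemiring L.semiring) using (sum)

  module Adjoined (P : Index m n → Set) = Adjoin E {I = Σ (Index m n) P} (λ v → a (proj₁ v))

  IsGenerated : Set (c₁ ⊔ c₂ ⊔ ℓ₂)
  IsGenerated = ∀ x → Adjoined.Generated (λ (ξ , h) → ∣ ξ ∣ ≤ 2 ℕ.* r) x

  DifferentialCondition : Set (c₁ ⊔ ℓ₂)
  DifferentialCondition =
    ∀ i k σ → ∣ σ ∣ ℕ.+ 1 ≤ 2 ℕ.* r →
    let N = List.length (variables (σ , k))
        x : Fin N → Index m n
        x = List.lookup (variables (σ , k))
        evalₐ : Poly N → L.Carrier
        evalₐ = eval E (λ j → a (x j))
    in (f : Poly N) → evalₐ f ≈ 0# →
       sum (λ j → let (η , g) = x j in evalₐ (∂/∂x j f) * a (η +ᵐ ε i , g))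
         + evalₐ (mapCoeff (K.∂ i) f) ≈ 0#

  SeparableLeader : Index m n → Set (c₁ ⊔ c₂ ⊔ ℓ₂)
  SeparableLeader (σ , k) =
    ∣ σ ∣ ≤ 2 ℕ.* r × SeparablyAlgebraic (Adjoined.subfield⊆L (_⊲ (σ , k))) (a (σ , k))

  MinimalSeparableLeader : Index m n → Set (c₁ ⊔ c₂ ⊔ ℓ₂)
  MinimalSeparableLeader (σ , k) =
    SeparableLeader (σ , k) × (∀ ρ → ρ ≤ᵐ σ → ρ ≢ σ → ¬ SeparableLeader (ρ , k))

  LeaderBound : Fin n → Set (c₁ ⊔ c₂ ⊔ ℓ₂)
  LeaderBound k =
    (∀ σ → MinimalSeparableLeader (σ , k) → ∣ σ ∣ ≤ r) ⊎
    (∃[ τ ] ∣ τ ∣ ≡ 2 ℕ.* r × (∀ σ → MinimalSeparableLeader (σ , k) → σ ≤ᵐ τ))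

  -- M ⊇ K(a_h^ξ : |ξ| < 2r) is expressed by an embedding φ over K.

  record CompatibleExtension {c₃ ℓ₃} (M : DifferentialField (suc m) c₃ ℓ₃)
      : Set (c₁ ⊔ ℓ₁ ⊔ c₂ ⊔ ℓ₂ ⊔ c₃ ⊔ ℓ₃) where
    private
      module M = DifferentialField M
      module K⟨a⟩ = Adjoined (λ (ξ , h) → ∣ ξ ∣ < 2 ℕ.* r)
    field
      K⊆M    : DifferentialExtension K M
      K⟨a⟩⊆M : FieldExtension K⟨a⟩.subfield M.underlying
    open DifferentialExtension K⊆M using (ι)
    open FieldExtension K⟨a⟩⊆M using () renaming (ι to φ)
    -- Below, p and q both follow from the last hypothesis, and membership
    -- proofs do not affect equality in the subfield.
    field
      over-K     : ∀ x → φ (K⟨a⟩.fromBase x) M.≈ ι x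
      compatible : ∀ i k σ (p : ∣ σ ∣ < 2 ℕ.* r) (q : ∣ σ +ᵐ ε i ∣ < 2 ℕ.* r) →
        ∣ σ ∣ ℕ.+ 1 < 2 ℕ.* r →
        M.∂ i (φ (K⟨a⟩.generator ((σ , k) , p))) M.≈ φ (K⟨a⟩.generator ((σ +ᵐ ε i , k) , q))

{-# OPTIONS --safe #-}

-- Let F = K(a_h^ξ : |ξ| < 2r).  By the differential condition, a_h^ξ ↦ a_h^(ξ+ε_i)
-- extends ∂_i to a derivation F → L, whose values lie in the F-span of 1 and the
-- generators of order 2r.  Call (σ , k) free if |σ| ≥ 2r and σ is above no leader,
-- where at order 2r only a generator in the F-span of 1 and its predecessors counts
-- as a leader.  The field M is the fraction field of a polynomial ring A over F with a
-- variable for each free index.  Elements b_k^σ of A are found by recursion along ⊲: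
-- b_k^σ is a_k^σ if |σ| < 2r, a linear form if |σ| = 2r, a variable if (σ , k) is free,
-- and otherwise D_j b_k^(σ-ε_j) for some j with σ-ε_j above a leader.
--
-- The choice of j is immaterial.  If σ-ε_i-ε_l is above a leader, then [D_i , D_l]
-- kills all that precedes b_k^(σ-ε_i-ε_l), which is separable over it, so
-- D_i b_k^(σ-ε_i) = D_l b_k^(σ-ε_l).  In general let ρ ≤ σ-ε_i and ρ′ ≤ σ-ε_j be minimal
-- leaders.  By hypothesis the join of ρ and ρ′ has order at most 2r < |σ|, so there is l
-- with ρ(l), ρ′(l) < σ(l), and both derivatives agree with D_l b_k^(σ-ε_l).  Hence
-- D_i b_k^σ = b_k^(σ+ε_i) always, and the D_i commute.
--
-- Excluded middle for all types also supplies the choices made here.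

module Submission where

open import Defs
open import Algebra.Bundles using (CommutativeRing; Semiring)
import Algebra.Definitions.RawSemiring as RawSemiringOps
import Algebra.Morphism.Construct.Composition as Composition
import Algebra.Morphism.Construct.Identity as Identity
open import Algebra.Morphism.Structures using (IsRingHomomorphism; IsRingMonomorphism)
open import Algebra.Properties.CommutativeSemigroup using (interchange)
import Algebra.Properties.Ring as RingProperties
import Algebra.Properties.Semiring.Exp as Exp
import Algebra.Properties.Semiring.Mult as SemiringMult
import Algebra.Properties.Semiring.Mult.TCOptimised as OptimisedMult
import Algebra.Properties.Semiring.Sum as SemiringSum
import Algebra.Solver.Ring as RingSolver
open import Algebra.Solver.Ring.AlmostCommutativeRing using (fromCommutativeRing; _-Raw-AlmostCommutative⟶_)
open import Axiom.ExcludedMiddle using (ExcludedMiddle)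
open import Data.Bool.Base using (if_then_else_; true; false)
open import Data.Empty using (⊥)
open import Data.Fin.Base using (Fin; zero; suc; toℕ; fromℕ<)
import Data.Fin.Properties as Fin
open import Data.Integer.Base as ℤ using (ℤ; +_; -[1+_])
import Data.Integer.Properties as ℤ
open import Data.List.Base as List using (List; []; _∷_; _++_)
open import Data.List.Membership.Propositional using (_∈_)
open import Data.List.Membership.Propositional.Properties using (∈-++⁺ˡ; ∈-++⁺ʳ; ∈-++⁻)
open import Data.List.Relation.Unary.Any as Any using (here; there)
import Data.List.Relation.Unary.Any.Properties as Any
open import Data.Maybe.Base using (Maybe; just; nothing)
open import Data.Nat.Base as ℕ using (ℕ; zero; suc; pred; z≤n; s≤s; _≤_; _<_; NonZero)
import Data.Nat.Induction as ℕ
import Data.Nat.Properties as ℕ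
open import Data.Product.Base using (Σ; ∃; ∃-syntax; ∃₂; _×_; _,_; proj₁; proj₂)
open import Data.Product.Properties using () renaming (≡-dec to ×-≡-dec)
open import Data.Sum.Base using (_⊎_; inj₁; inj₂; [_,_])
import Data.Unit.Base as Unit
open import Data.Unit.Polymorphic.Base using (⊤; tt)
open import Data.Vec.Base as Vec using (Vec; []; _∷_)
import Data.Vec.Properties as Vec
open import Data.Vec.Relation.Binary.Lex.Strict as Lex using (Lex-≤; Lex-<)
open import Data.Vec.Relation.Binary.Pointwise.Inductive as Pointwise using (Pointwise; []; _∷_)
open import Function.Base using (_∘_)
open import Induction.WellFounded using (WellFounded; Acc; acc; module All; module FixPoint)
open import Level using (Level; _⊔_)
import Relation.Binary.Construct.On as On
open import Relation.Binary.Definitions using (DecidableEquality; tri<; tri≈; tri>)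
open import Relation.Binary.PropositionalEquality as ≡ using (_≡_; _≢_)
open import Relation.Nullary.Decidable.Core using (Dec; yes; no; does)
open import Relation.Nullary.Negation.Core using (¬_; contradiction)

-- The field L itself is not embedded in M, only F is. Free generators of order 2r may well be
-- algebraically dependent in L, but the hypotheses give them no derivatives, so A trades them for
-- independent variables. This is consistent because only linear relations matter: the derivatives
-- of elements of F are affine in the generators of order 2r, and 1 together with the free
-- generators of order 2r is linearly independent over F. Each derivation F → L therefore lifts
-- uniquely to a derivation F → A.
--
-- The other obstacle is a circle: D_j is determined by the values b_(w+ε_j) at free w, while beyond
-- order 2r the b are themselves made with D_j. The order breaks it. If θ is above a leader, then
-- only free w strictly before θ occur in b_θ, and w ⊲ θ gives w+ε_j ⊲ θ+ε_j. So D_j b_θ consults b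
-- only before the index θ+ε_j under definition.

private
  variable
    l N : ℕ

-- Solving ring equations with integer coefficients

module IntegerSolver {c ℓ} (R : CommutativeRing c ℓ) where

  open CommutativeRing R
  open RingProperties ring using (-‿distribˡ-*; -‿distribʳ-*; -‿involutive; -‿+-comm; -0#≈0#)
  open OptimisedMult semiring using (1+×; ×-homo-+; ×1-homo-*) renaming (_×_ to _·_)
  open import Relation.Binary.Reasoning.Setoid setoid

  private
    ⟦_⟧ℤ : ℤ → Carrier
    ⟦ + n ⟧ℤ      = n · 1#
    ⟦ -[1+ n ] ⟧ℤ = - (suc n · 1#)

    ⟦⟧-⊖ : ∀ m n → ⟦ m ℤ.⊖ n ⟧ℤ ≈ m · 1# - n · 1#
    ⟦⟧-⊖ m       zero    = sym (trans (+-congˡ -0#≈0#) (+-identityʳ _))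
    ⟦⟧-⊖ zero    (suc n) = sym (+-identityˡ _)
    ⟦⟧-⊖ (suc m) (suc n) = begin
      ⟦ suc m ℤ.⊖ suc n ⟧ℤ                          ≡⟨ ≡.cong ⟦_⟧ℤ (ℤ.[1+m]⊖[1+n]≡m⊖n m n) ⟩
      ⟦ m ℤ.⊖ n ⟧ℤ                                  ≈⟨ ⟦⟧-⊖ m n ⟩
      m · 1# - n · 1#                               ≈⟨ +-congʳ (+-identityʳ _) ⟨
      m · 1# + 0# - n · 1#                          ≈⟨ +-congʳ (+-congˡ (-‿inverseʳ 1#)) ⟨
      m · 1# + (1# - 1#) - n · 1#                   ≈⟨ +-congʳ (+-assoc _ _ _) ⟨
      m · 1# + 1# - 1# - n · 1#                     ≈⟨ +-assoc _ _ _ ⟩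
      m · 1# + 1# + (- 1# - n · 1#)                 ≈⟨ +-cong (+-comm _ _) (-‿+-comm _ _) ⟩
      1# + m · 1# - (1# + n · 1#)                   ≈⟨ +-cong (1+× m 1#) (-‿cong (1+× n 1#)) ⟨
      suc m · 1# - suc n · 1#                       ∎

    +-homo : ∀ i j → ⟦ i ℤ.+ j ⟧ℤ ≈ ⟦ i ⟧ℤ + ⟦ j ⟧ℤ
    +-homo (+ m)    (+ n)    = ×-homo-+ 1# m n
    +-homo (+ m)    -[1+ n ] = ⟦⟧-⊖ m (suc n)
    +-homo -[1+ m ] (+ n)    = trans (⟦⟧-⊖ n (suc m)) (+-comm _ _)
    +-homo -[1+ m ] -[1+ n ] = begin
      - (suc (suc (m ℕ.+ n)) · 1#)        ≡⟨ ≡.cong (λ k → - (suc k · 1#)) (ℕ.+-suc m n) ⟨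
      - ((suc m ℕ.+ suc n) · 1#)          ≈⟨ -‿cong (×-homo-+ 1# (suc m) (suc n)) ⟩
      - (suc m · 1# + suc n · 1#)         ≈⟨ -‿+-comm _ _ ⟨
      - (suc m · 1#) - suc n · 1#         ∎

    -‿homo : ∀ i → ⟦ ℤ.- i ⟧ℤ ≈ - ⟦ i ⟧ℤ
    -‿homo (+ zero)  = sym -0#≈0#
    -‿homo (+ suc n) = refl
    -‿homo -[1+ n ]  = sym (-‿involutive _)

    *-homo-+ : ∀ m j → ⟦ + m ℤ.* j ⟧ℤ ≈ ⟦ + m ⟧ℤ * ⟦ j ⟧ℤ
    *-homo-+ m (+ n)    = trans (reflexive (≡.cong ⟦_⟧ℤ (≡.sym (ℤ.pos-* m n)))) (×1-homo-* m n)
    *-homo-+ m -[1+ n ] = begin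
      ⟦ + m ℤ.* -[1+ n ] ⟧ℤ         ≡⟨ ≡.cong ⟦_⟧ℤ (ℤ.neg-distribʳ-* (+ m) (+ suc n)) ⟨
      ⟦ ℤ.- (+ m ℤ.* + suc n) ⟧ℤ    ≈⟨ -‿homo (+ m ℤ.* + suc n) ⟩
      - ⟦ + m ℤ.* + suc n ⟧ℤ        ≈⟨ -‿cong (*-homo-+ m (+ suc n)) ⟩
      - (m · 1# * (suc n · 1#))     ≈⟨ -‿distribʳ-* _ _ ⟩
      m · 1# * - (suc n · 1#)       ∎

    *-homo : ∀ i j → ⟦ i ℤ.* j ⟧ℤ ≈ ⟦ i ⟧ℤ * ⟦ j ⟧ℤ
    *-homo (+ m)    j = *-homo-+ m j
    *-homo -[1+ m ] j = begin
      ⟦ -[1+ m ] ℤ.* j ⟧ℤ           ≡⟨ ≡.cong ⟦_⟧ℤ (ℤ.neg-distribˡ-* (+ suc m) j) ⟨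
      ⟦ ℤ.- (+ suc m ℤ.* j) ⟧ℤ      ≈⟨ -‿homo (+ suc m ℤ.* j) ⟩
      - ⟦ + suc m ℤ.* j ⟧ℤ          ≈⟨ -‿cong (*-homo-+ (suc m) j) ⟩
      - (suc m · 1# * ⟦ j ⟧ℤ)       ≈⟨ -‿distribˡ-* _ _ ⟩
      - (suc m · 1#) * ⟦ j ⟧ℤ       ∎

    morphism : ℤ.+-*-rawRing -Raw-AlmostCommutative⟶ fromCommutativeRing R
    morphism = record
      { ⟦_⟧    = ⟦_⟧ℤ
      ; +-homo = +-homo
      ; *-homo = *-homo
      ; -‿homo = -‿homo
      ; 0-homo = refl
      ; 1-homo = refl
      }

    decide : ∀ i j → Maybe (⟦ i ⟧ℤ ≈ ⟦ j ⟧ℤ)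
    decide i j with i ℤ.≟ j
    ... | yes ≡.refl = just (refl)
    ... | no  _    = nothing

  open RingSolver ℤ.+-*-rawRing (fromCommutativeRing R) morphism decide public
    using (solve; _:+_; _:*_; :-_; _:-_; _:=_) renaming (con to κ)

-- Free commutative algebras

-- The level p only serves to place the algebra in a larger universe.

module FreeAlgebra {c ℓ} (F : CommutativeRing c ℓ) (X : Set) (p : Level) where

  private module F = CommutativeRing F

  infix  4 _~_
  infixl 6 _⊕_
  infixl 7 _⊗_
  infix  8 ⊖_

  data Expr : Set (c ⊔ p) where
    con     : F.Carrier → Expr
    var     : X → Expr
    _⊕_ _⊗_ : Expr → Expr → Expr
    ⊖_      : Expr → Expr

  -- The least congruence under which terms form a commutative ring and `con` is a homomorphism.
  -- Functions out of `algebra` are recursions on terms checked against these rules; degrees and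
  -- coefficients become visible only through such functions.
  data _~_ : Expr → Expr → Set (c ⊔ ℓ ⊔ p) where
    ~-refl      : ∀ {u} → u ~ u
    ~-sym       : ∀ {u v} → u ~ v → v ~ u
    ~-trans     : ∀ {u v w} → u ~ v → v ~ w → u ~ w
    ⊕-cong      : ∀ {u u′ v v′} → u ~ u′ → v ~ v′ → u ⊕ v ~ u′ ⊕ v′
    ⊗-cong      : ∀ {u u′ v v′} → u ~ u′ → v ~ v′ → u ⊗ v ~ u′ ⊗ v′
    ⊖-cong      : ∀ {u u′} → u ~ u′ → ⊖ u ~ ⊖ u′
    con-cong    : ∀ {a b} → a F.≈ b → con a ~ con b
    con-⊕       : ∀ a b → con (a F.+ b) ~ con a ⊕ con b
    con-⊗       : ∀ a b → con (a F.* b) ~ con a ⊗ con b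
    ⊕-assoc     : ∀ u v w → u ⊕ v ⊕ w ~ u ⊕ (v ⊕ w)
    ⊕-comm      : ∀ u v → u ⊕ v ~ v ⊕ u
    ⊕-identityˡ : ∀ u → con F.0# ⊕ u ~ u
    ⊖-inverseˡ  : ∀ u → ⊖ u ⊕ u ~ con F.0#
    ⊗-assoc     : ∀ u v w → u ⊗ v ⊗ w ~ u ⊗ (v ⊗ w)
    ⊗-comm      : ∀ u v → u ⊗ v ~ v ⊗ u
    ⊗-identityˡ : ∀ u → con F.1# ⊗ u ~ u
    ⊗-distribˡ  : ∀ u v w → u ⊗ (v ⊕ w) ~ u ⊗ v ⊕ u ⊗ w

  algebra : CommutativeRing (c ⊔ p) (c ⊔ ℓ ⊔ p)
  algebra = record
    { Carrier = Expr
    ; _≈_ = _~_ ; _+_ = _⊕_ ; _*_ = _⊗_ ; -_ = ⊖_ ; 0# = con F.0# ; 1# = con F.1#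
    ; isCommutativeRing = record
      { isRing = record
        { +-isAbelianGroup = record
          { isGroup = record
            { isMonoid = record
              { isSemigroup = record
                { isMagma = record
                  { isEquivalence = record { refl = ~-refl ; sym = ~-sym ; trans = ~-trans }
                  ; ∙-cong        = ⊕-cong
                  }
                ; assoc   = ⊕-assoc
                }
              ; identity = ⊕-identityˡ , λ u → ~-trans (⊕-comm _ _) (⊕-identityˡ u)
              }
            ; inverse = ⊖-inverseˡ , λ u → ~-trans (⊕-comm _ _) (⊖-inverseˡ u)
            ; ⁻¹-cong = ⊖-cong
            }
          ; comm = ⊕-comm
          }
        ; *-cong     = ⊗-cong
        ; *-assoc    = ⊗-assoc
        ; *-identity = ⊗-identityˡ , λ u → ~-trans (⊗-comm _ _) (⊗-identityˡ u)
        ; distrib    = ⊗-distribˡ , λ u v w → ~-trans (⊗-comm _ _)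
                         (~-trans (⊗-distribˡ _ _ _) (⊕-cong (⊗-comm _ _) (⊗-comm _ _)))
        }
      ; *-comm = ⊗-comm
      }
    }

  private module A = CommutativeRing algebra
  open IntegerSolver algebra
  open import Relation.Binary.Reasoning.Setoid A.setoid

  con-⊖ : ∀ a → con (F.- a) ~ ⊖ con a
  con-⊖ a = -‿unique′ (~-trans (~-sym (con-⊕ _ _)) (con-cong (F.-‿inverseˡ a)))
    where
    -‿unique′ : ∀ {u v} → u ⊕ v ~ con F.0# → u ~ ⊖ v
    -‿unique′ {u} {v} e = begin
      u             ≈⟨ solve 2 (λ u v → u := (u :+ v) :+ :- v) ~-refl u v ⟩
      u ⊕ v ⊕ ⊖ v   ≈⟨ ⊕-cong e ~-refl ⟩
      con F.0# ⊕ ⊖ v ≈⟨ ⊕-identityˡ _ ⟩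
      ⊖ v           ∎

  con-isRingHomomorphism : IsRingHomomorphism F.rawRing A.rawRing con
  con-isRingHomomorphism = record
    { isSemiringHomomorphism = record
      { isNearSemiringHomomorphism = record
        { +-isMonoidHomomorphism = record
          { isMagmaHomomorphism = record
            { isRelHomomorphism = record { cong = con-cong }
            ; homo              = con-⊕
            }
          ; ε-homo = ~-refl
          }
        ; *-homo = con-⊗
        }
      ; 1#-homo = ~-refl
      }
    ; -‿homo = con-⊖
    }

  module Evaluation {b ℓᵇ} (B : CommutativeRing b ℓᵇ)
    {h : CommutativeRing.Carrier F → CommutativeRing.Carrier B}
    (hom : IsRingHomomorphism (CommutativeRing.rawRing F) (CommutativeRing.rawRing B) h)
    (g : X → CommutativeRing.Carrier B) where

    private
      module B = CommutativeRing B
      module H = IsRingHomomorphism hom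

    ⟦_⟧ : Expr → B.Carrier
    ⟦ con a ⟧ = h a
    ⟦ var x ⟧ = g x
    ⟦ u ⊕ v ⟧ = ⟦ u ⟧ B.+ ⟦ v ⟧
    ⟦ u ⊗ v ⟧ = ⟦ u ⟧ B.* ⟦ v ⟧
    ⟦ ⊖ u ⟧   = B.- ⟦ u ⟧

    ⟦⟧-cong : ∀ {u v} → u ~ v → ⟦ u ⟧ B.≈ ⟦ v ⟧
    ⟦⟧-cong ~-refl             = B.refl
    ⟦⟧-cong (~-sym e)          = B.sym (⟦⟧-cong e)
    ⟦⟧-cong (~-trans e f)      = B.trans (⟦⟧-cong e) (⟦⟧-cong f)
    ⟦⟧-cong (⊕-cong e f)       = B.+-cong (⟦⟧-cong e) (⟦⟧-cong f)
    ⟦⟧-cong (⊗-cong e f)       = B.*-cong (⟦⟧-cong e) (⟦⟧-cong f)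
    ⟦⟧-cong (⊖-cong e)         = B.-‿cong (⟦⟧-cong e)
    ⟦⟧-cong (con-cong e)       = H.⟦⟧-cong e
    ⟦⟧-cong (con-⊕ a b)        = H.+-homo a b
    ⟦⟧-cong (con-⊗ a b)        = H.*-homo a b
    ⟦⟧-cong (⊕-assoc u v w)    = B.+-assoc _ _ _
    ⟦⟧-cong (⊕-comm u v)       = B.+-comm _ _
    ⟦⟧-cong (⊕-identityˡ u)    = B.trans (B.+-congʳ H.0#-homo) (B.+-identityˡ _)
    ⟦⟧-cong (⊖-inverseˡ u)     = B.trans (B.-‿inverseˡ _) (B.sym H.0#-homo)
    ⟦⟧-cong (⊗-assoc u v w)    = B.*-assoc _ _ _
    ⟦⟧-cong (⊗-comm u v)       = B.*-comm _ _
    ⟦⟧-cong (⊗-identityˡ u)    = B.trans (B.*-congʳ H.1#-homo) (B.*-identityˡ _)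
    ⟦⟧-cong (⊗-distribˡ u v w) = B.distribˡ _ _ _

  -- Setting every variable to 0 is a left inverse of `con`.
  con-injective : ∀ {a b} → con a ~ con b → a F.≈ b
  con-injective = Evaluation.⟦⟧-cong F (Identity.isRingHomomorphism F.rawRing F.refl) (λ _ → F.0#)

  -- For t = 0 and s = var this is a derivation; for t = var x, s the
  -- substitution of 0 for x, and δ = 0 it is the divided difference
  -- (u − s u) / x.

  module TwistedDerivation (t : Expr) (s : X → Expr)
    (δ : CommutativeRing.Carrier F → Expr) (β : X → Expr) where

    open Evaluation algebra con-isRingHomomorphism s public
      using () renaming (⟦_⟧ to subst; ⟦⟧-cong to subst-cong)

    Δ : Expr → Expr
    Δ (con a) = δ a
    Δ (var x) = β x
    Δ (u ⊕ v) = Δ u ⊕ Δ v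
    Δ (u ⊗ v) = Δ u ⊗ v ⊕ subst u ⊗ Δ v
    Δ (⊖ u)   = ⊖ Δ u

    module Properties
      (δ-cong : ∀ {a b} → a F.≈ b → δ a ~ δ b)
      (δ-+    : ∀ a b → δ (a F.+ b) ~ δ a ⊕ δ b)
      (δ-*    : ∀ a b → δ (a F.* b) ~ δ a ⊗ con b ⊕ con a ⊗ δ b)
      (tδ~0   : ∀ a → t ⊗ δ a ~ con F.0#)
      (s+tβ   : ∀ x → var x ~ s x ⊕ t ⊗ β x) where

      -- Taylor's formula of order one. For t = 0 it says that `subst` is the identity up to `~`;
      -- for t = `var x` it is division by x with remainder.
      decompose : ∀ u → u ~ subst u ⊕ t ⊗ Δ u
      decompose (con a) = ~-sym (~-trans (⊕-cong ~-refl (tδ~0 a)) (A.+-identityʳ _))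
      decompose (var x) = s+tβ x
      decompose (u ⊕ v) = ~-trans (⊕-cong (decompose u) (decompose v))
        (solve 5 (λ t a b c d → (a :+ t :* b) :+ (c :+ t :* d) := (a :+ c) :+ t :* (b :+ d))
           ~-refl t (subst u) (Δ u) (subst v) (Δ v))
      decompose (u ⊗ v) = begin
        u ⊗ v                                               ≈⟨ ⊗-cong (decompose u) ~-refl ⟩
        (subst u ⊕ t ⊗ Δ u) ⊗ v                             ≈⟨ solve 4 (λ a t b v → (a :+ t :* b) :* v := a :* v :+ t :* b :* v)
                                                                  ~-refl (subst u) t (Δ u) v ⟩
        subst u ⊗ v ⊕ t ⊗ Δ u ⊗ v                           ≈⟨ ⊕-cong (⊗-cong ~-refl (decompose v)) ~-refl ⟩
        subst u ⊗ (subst v ⊕ t ⊗ Δ v) ⊕ t ⊗ Δ u ⊗ v         ≈⟨ solve 6 (λ a c t d b v → a :* (c :+ t :* d) :+ t :* b :* v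
                                                                    := a :* c :+ t :* (b :* v :+ a :* d))
                                                                  ~-refl (subst u) (subst v) t (Δ v) (Δ u) v ⟩
        subst u ⊗ subst v ⊕ t ⊗ (Δ u ⊗ v ⊕ subst u ⊗ Δ v)   ∎
      decompose (⊖ u)   = ~-trans (⊖-cong (decompose u))
        (solve 3 (λ a t b → :- (a :+ t :* b) := :- a :+ t :* :- b) ~-refl (subst u) t (Δ u))

      δ0~0 : δ F.0# ~ con F.0#
      δ0~0 = begin
        δ F.0#                        ≈⟨ solve 1 (λ d → d := d :+ d :+ :- d) ~-refl (δ F.0#) ⟩
        δ F.0# ⊕ δ F.0# ⊕ ⊖ δ F.0#    ≈⟨ ⊕-cong (~-trans (~-sym (δ-+ _ _)) (δ-cong (F.+-identityˡ _))) ~-refl ⟩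
        δ F.0# ⊕ ⊖ δ F.0#             ≈⟨ A.-‿inverseʳ _ ⟩
        con F.0#                      ∎

      δ1~0 : δ F.1# ~ con F.0#
      δ1~0 = begin
        δ F.1#
          ≈⟨ solve 1 (λ d → d := d :* con₁ :+ con₁ :* d :+ :- d) ~-refl (δ F.1#) ⟩
        δ F.1# ⊗ con F.1# ⊕ con F.1# ⊗ δ F.1# ⊕ ⊖ δ F.1#
          ≈⟨ ⊕-cong (~-trans (~-sym (δ-* _ _)) (δ-cong (F.*-identityˡ _))) ~-refl ⟩
        δ F.1# ⊕ ⊖ δ F.1#
          ≈⟨ A.-‿inverseʳ _ ⟩
        con F.0#                      ∎
        where con₁ = κ (+ 1)

      -- The twisted product rule treats its factors asymmetrically. Expanding the untouched factor
      -- by `decompose` on both sides leaves the same extra term t Δu Δv.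
      Δ-comm : ∀ u v → Δ (u ⊗ v) ~ Δ (v ⊗ u)
      Δ-comm u v = begin
        Δ u ⊗ v ⊕ subst u ⊗ Δ v                       ≈⟨ ⊕-cong (⊗-cong ~-refl (decompose v)) ~-refl ⟩
        Δ u ⊗ (subst v ⊕ t ⊗ Δ v) ⊕ subst u ⊗ Δ v     ≈⟨ solve 5 (λ a b c d t → b :* (c :+ t :* d) :+ a :* d := d :* (a :+ t :* b) :+ c :* b)
                                                            ~-refl (subst u) (Δ u) (subst v) (Δ v) t ⟩
        Δ v ⊗ (subst u ⊕ t ⊗ Δ u) ⊕ subst v ⊗ Δ u     ≈⟨ ⊕-cong (⊗-cong ~-refl (decompose u)) ~-refl ⟨
        Δ v ⊗ u ⊕ subst v ⊗ Δ u                       ∎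

      Δ-cong : ∀ {u v} → u ~ v → Δ u ~ Δ v
      Δ-cong ~-refl          = ~-refl
      Δ-cong (~-sym e)       = ~-sym (Δ-cong e)
      Δ-cong (~-trans e f)   = ~-trans (Δ-cong e) (Δ-cong f)
      Δ-cong (⊕-cong e f)    = ⊕-cong (Δ-cong e) (Δ-cong f)
      Δ-cong (⊗-cong e f)    = ⊕-cong (⊗-cong (Δ-cong e) f) (⊗-cong (subst-cong e) (Δ-cong f))
      Δ-cong (⊖-cong e)      = ⊖-cong (Δ-cong e)
      Δ-cong (con-cong e)    = δ-cong e
      Δ-cong (con-⊕ a b)     = δ-+ a b
      Δ-cong (con-⊗ a b)     = δ-* a b
      Δ-cong (⊕-assoc u v w) = ⊕-assoc _ _ _
      Δ-cong (⊕-comm u v)    = ⊕-comm _ _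
      Δ-cong (⊕-identityˡ u) = ~-trans (⊕-cong δ0~0 ~-refl) (⊕-identityˡ _)
      Δ-cong (⊖-inverseˡ u)  = ~-trans (⊖-inverseˡ _) (~-sym δ0~0)
      Δ-cong (⊗-assoc u v w) =
        solve 7 (λ u′ su v v′ sv w w′ → (u′ :* v :+ su :* v′) :* w :+ su :* sv :* w′
                                     := u′ :* (v :* w) :+ su :* (v′ :* w :+ sv :* w′))
          ~-refl (Δ u) (subst u) v (Δ v) (subst v) w (Δ w)
      Δ-cong (⊗-comm u v)    = Δ-comm u v
      Δ-cong (⊗-identityˡ u) = ~-trans (⊕-cong (⊗-cong δ1~0 ~-refl) ~-refl)
        (solve 2 (λ u u′ → con₀ :* u :+ con₁ :* u′ := u′) ~-refl u (Δ u))
        where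
        con₀ = κ (+ 0)
        con₁ = κ (+ 1)
      Δ-cong (⊗-distribˡ u v w) =
        solve 6 (λ u′ su v v′ w w′ → u′ :* (v :+ w) :+ su :* (v′ :+ w′)
                                  := (u′ :* v :+ su :* v′) :+ (u′ :* w :+ su :* w′))
          ~-refl (Δ u) (subst u) v (Δ v) w (Δ w)

-- Variables occurring in terms, and derivations of free algebras

module Support {c ℓ} (F : CommutativeRing c ℓ) (X : Set) (p : Level) where

  open FreeAlgebra F X p
  private module F = CommutativeRing F

  -- A property of the term and not of its class under `~`. For this reason supports travel along
  -- `≡`, and results about specific elements keep track of the chosen term.
  Supp : ∀ {q} → (X → Set q) → Expr → Set q
  Supp P (con a) = ⊤
  Supp P (var x) = P x
  Supp P (u ⊕ v) = Supp P u × Supp P v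
  Supp P (u ⊗ v) = Supp P u × Supp P v
  Supp P (⊖ u)   = Supp P u

  Supp-map : ∀ {q q′} {P : X → Set q} {Q : X → Set q′} →
             (∀ {x} → P x → Q x) → ∀ u → Supp P u → Supp Q u
  Supp-map f (con a) _       = tt
  Supp-map f (var x) s       = f s
  Supp-map f (u ⊕ v) (s , t) = Supp-map f u s , Supp-map f v t
  Supp-map f (u ⊗ v) (s , t) = Supp-map f u s , Supp-map f v t
  Supp-map f (⊖ u)   s       = Supp-map f u s

  Supp-× : ∀ {q q′} {P : X → Set q} {Q : X → Set q′} u → Supp P u → Supp Q u → Supp (λ x → P x × Q x) u
  Supp-× (con a) _       _         = tt
  Supp-× (var x) s       t         = s , t
  Supp-× (u ⊕ v) (s , t) (s′ , t′) = Supp-× u s s′ , Supp-× v t t′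
  Supp-× (u ⊗ v) (s , t) (s′ , t′) = Supp-× u s s′ , Supp-× v t t′
  Supp-× (⊖ u)   s       t         = Supp-× u s t

  vars : Expr → List X
  vars (con a) = []
  vars (var x) = x ∷ []
  vars (u ⊕ v) = vars u ++ vars v
  vars (u ⊗ v) = vars u ++ vars v
  vars (⊖ u)   = vars u

  vars-∈ : ∀ {q} {P : X → Set q} {x} u → Supp P u → x ∈ vars u → P x
  vars-∈ (var x) s       (here ≡.refl) = s
  vars-∈ (u ⊕ v) (s , t) x∈ = [ vars-∈ u s , vars-∈ v t ] (∈-++⁻ (vars u) x∈)
  vars-∈ (u ⊗ v) (s , t) x∈ = [ vars-∈ u s , vars-∈ v t ] (∈-++⁻ (vars u) x∈)
  vars-∈ (⊖ u)   s       x∈ = vars-∈ u s x∈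

  Supp-vars : ∀ u → Supp (_∈ vars u) u
  Supp-vars (con a) = tt
  Supp-vars (var x) = here ≡.refl
  Supp-vars (u ⊕ v) = Supp-map ∈-++⁺ˡ u (Supp-vars u) , Supp-map (∈-++⁺ʳ (vars u)) v (Supp-vars v)
  Supp-vars (u ⊗ v) = Supp-map ∈-++⁺ˡ u (Supp-vars u) , Supp-map (∈-++⁺ʳ (vars u)) v (Supp-vars v)
  Supp-vars (⊖ u)   = Supp-vars u

  Supp-⊥⇒con : ∀ u → Supp (λ _ → ⊥) u → ∃[ a ] u ~ con a
  Supp-⊥⇒con (con a) _ = a , ~-refl
  Supp-⊥⇒con (u ⊕ v) (s , t) with Supp-⊥⇒con u s | Supp-⊥⇒con v t
  ... | a , e | b , f = a F.+ b , ~-trans (⊕-cong e f) (~-sym (con-⊕ a b))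
  Supp-⊥⇒con (u ⊗ v) (s , t) with Supp-⊥⇒con u s | Supp-⊥⇒con v t
  ... | a , e | b , f = a F.* b , ~-trans (⊗-cong e f) (~-sym (con-⊗ a b))
  Supp-⊥⇒con (⊖ u) s with Supp-⊥⇒con u s
  ... | a , e = F.- a , ~-trans (⊖-cong e) (~-sym (con-⊖ a))

  module _ (t : Expr) (s : X → Expr) (δ : CommutativeRing.Carrier F → Expr) {β β′ : X → Expr} where

    private
      open module T  = TwistedDerivation t s δ β  using (Δ)
      open module T′ = TwistedDerivation t s δ β′ using () renaming (Δ to Δ′)

    -- Identity of terms, stronger than `~`, is what unfolding a well-founded recursion with values
    -- in `Expr` requires.
    Δ-local : ∀ u → Supp (λ x → β x ≡ β′ x) u → Δ u ≡ Δ′ u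
    Δ-local (con a) _       = ≡.refl
    Δ-local (var x) e       = e
    Δ-local (u ⊕ v) (e , f) = ≡.cong₂ _⊕_ (Δ-local u e) (Δ-local v f)
    Δ-local (u ⊗ v) (e , f) = ≡.cong₂ (λ u′ v′ → u′ ⊗ v ⊕ T.subst u ⊗ v′) (Δ-local u e) (Δ-local v f)
    Δ-local (⊖ u)   e       = ≡.cong ⊖_ (Δ-local u e)

  module _ {q q′} {P : X → Set q} {Q : X → Set q′} (δ : CommutativeRing.Carrier F → Expr) (β : X → Expr) where

    private open module T = TwistedDerivation (con (CommutativeRing.0# F)) var δ β using (Δ; subst)

    Supp-derivation : (∀ a → Supp Q (δ a)) → (∀ {x} → P x → Q x) → (∀ {x} → P x → Supp Q (β x)) →
                      ∀ u → Supp P u → Supp Q (Δ u)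
    Supp-derivation onF P⊆Q onX = go
      where
      unsubst : ∀ u → Supp P u → Supp Q (subst u)
      unsubst (con a) _       = tt
      unsubst (var x) s       = P⊆Q s
      unsubst (u ⊕ v) (s , t) = unsubst u s , unsubst v t
      unsubst (u ⊗ v) (s , t) = unsubst u s , unsubst v t
      unsubst (⊖ u)   s       = unsubst u s

      go : ∀ u → Supp P u → Supp Q (Δ u)
      go (con a) _       = onF a
      go (var x) s       = onX s
      go (u ⊕ v) (s , t) = go u s , go v t
      go (u ⊗ v) (s , t) = (go u s , Supp-map P⊆Q v t) , unsubst u s , go v t
      go (⊖ u)   s       = go u s

  module Derivation (δ : CommutativeRing.Carrier F → Expr) (β : X → Expr)
    (δ-cong : ∀ {a b} → CommutativeRing._≈_ F a b → δ a ~ δ b)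
    (δ-+    : ∀ a b → δ (CommutativeRing._+_ F a b) ~ δ a ⊕ δ b)
    (δ-*    : ∀ a b → δ (CommutativeRing._*_ F a b) ~ δ a ⊗ con b ⊕ con a ⊗ δ b) where

    private
      module A = CommutativeRing algebra
      module T = TwistedDerivation (con F.0#) var δ β
      module P = T.Properties δ-cong δ-+ δ-* (λ a → A.zeroˡ _)
        (λ x → ~-sym (~-trans (⊕-cong ~-refl (A.zeroˡ _)) (A.+-identityʳ _)))

    D : Expr → Expr
    D = T.Δ

    D-cong : ∀ {u v} → u ~ v → D u ~ D v
    D-cong = P.Δ-cong

    -- The recursion puts `subst u` where u should stand; by `decompose` with t = 0 the two agree.
    D-leibniz : ∀ u v → D (u ⊗ v) ~ D u ⊗ v ⊕ u ⊗ D v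
    D-leibniz u v = ⊕-cong ~-refl (⊗-cong (~-sym (~-trans (P.decompose u)
      (~-trans (⊕-cong ~-refl (A.zeroˡ _)) (A.+-identityʳ _)))) ~-refl)

-- Division by a variable in a free algebra

module DividedDifference {c ℓ} (F : CommutativeRing c ℓ) {X : Set} (_≟_ : DecidableEquality X)
  (p : Level) (x : X) where

  open FreeAlgebra F X p
  open Support F X p
  private module F = CommutativeRing F
  private module A = CommutativeRing algebra
  open import Relation.Binary.Reasoning.Setoid A.setoid
  open IntegerSolver algebra

  erased : X → Expr
  erased y with y ≟ x
  ... | yes _ = con F.0#
  ... | no  _ = var y

  kronecker : X → Expr
  kronecker y with y ≟ x
  ... | yes _ = con F.1#
  ... | no  _ = con F.0#

  open TwistedDerivation (var x) erased (λ _ → con F.0#) kronecker public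
    renaming (subst to erase; subst-cong to erase-cong; Δ to quotient)

  private
    erased+x*kronecker : ∀ y → var y ~ erased y ⊕ var x ⊗ kronecker y
    erased+x*kronecker y with y ≟ x
    ... | yes ≡.refl = ~-sym (~-trans (⊕-identityˡ _) (A.*-identityʳ _))
    ... | no  _    = ~-sym (~-trans (⊕-cong ~-refl (A.zeroʳ _)) (A.+-identityʳ _))

  open Properties (λ _ → ~-refl) (λ a b → ~-sym (⊕-identityˡ _))
    (λ a b → ~-sym (~-trans (⊕-cong (A.zeroˡ _) (A.zeroʳ _)) (⊕-identityˡ _)))
    (λ a → A.zeroʳ _) erased+x*kronecker public
    using (decompose) renaming (Δ-cong to quotient-cong)

  quotient-var : quotient (var x) ~ con F.1#
  quotient-var with x ≟ x
  ... | yes _   = ~-refl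
  ... | no  x≢x = contradiction ≡.refl x≢x

  erase-var : erase (var x) ~ con F.0#
  erase-var with x ≟ x
  ... | yes _   = ~-refl
  ... | no  x≢x = contradiction ≡.refl x≢x

  quotient-x* : ∀ u → quotient (var x ⊗ u) ~ u
  quotient-x* u = begin
    quotient (var x) ⊗ u ⊕ erase (var x) ⊗ quotient u  ≈⟨ ⊕-cong (⊗-cong quotient-var ~-refl) (⊗-cong erase-var ~-refl) ⟩
    con F.1# ⊗ u ⊕ con F.0# ⊗ quotient u               ≈⟨ ⊕-cong (⊗-identityˡ _) (A.zeroˡ _) ⟩
    u ⊕ con F.0#                                       ≈⟨ A.+-identityʳ _ ⟩
    u                                                  ∎

  -- `quotient` undoes multiplication by x and respects `~`.
  x-regular : ∀ {u} → var x ⊗ u ~ con F.0# → u ~ con F.0#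
  x-regular {u} e = ~-trans (~-sym (quotient-x* u)) (quotient-cong e)

  quotient-erase : ∀ u → quotient (erase u) ~ con F.0#
  quotient-erase (con a) = ~-refl
  quotient-erase (var y) with y ≟ x
  ... | yes _   = ~-refl
  ... | no  y≢x with y ≟ x
  ...   | yes y≡x = contradiction y≡x y≢x
  ...   | no  _   = ~-refl
  quotient-erase (u ⊕ v) = ~-trans (⊕-cong (quotient-erase u) (quotient-erase v)) (⊕-identityˡ _)
  quotient-erase (u ⊗ v) = ~-trans
    (⊕-cong (~-trans (⊗-cong (quotient-erase u) ~-refl) (A.zeroˡ _))
            (~-trans (⊗-cong ~-refl (quotient-erase v)) (A.zeroʳ _)))
    (⊕-identityˡ _)
  quotient-erase (⊖ u) = ~-trans (⊖-cong (quotient-erase u))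
    (solve 0 (:- κ (+ 0) := κ (+ 0)) ~-refl)

  erase-idem : ∀ u → erase (erase u) ~ erase u
  erase-idem u = ~-sym (begin
    erase u                                       ≈⟨ decompose (erase u) ⟩
    erase (erase u) ⊕ var x ⊗ quotient (erase u)  ≈⟨ ⊕-cong ~-refl (⊗-cong ~-refl (quotient-erase u)) ⟩
    erase (erase u) ⊕ var x ⊗ con F.0#            ≈⟨ ⊕-cong ~-refl (A.zeroʳ _) ⟩
    erase (erase u) ⊕ con F.0#                    ≈⟨ A.+-identityʳ _ ⟩
    erase (erase u)                               ∎)

  Supp-quotient : ∀ {q} {P : X → Set q} u → Supp P u → Supp P (quotient u)
  Supp-erase    : ∀ {q} {P : X → Set q} u → Supp P u → Supp (λ y → P y × y ≢ x) (erase u)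

  Supp-erase (con a) _ = tt
  Supp-erase (var y) s with y ≟ x
  ... | yes _   = tt
  ... | no  y≢x = s , y≢x
  Supp-erase (u ⊕ v) (s , t) = Supp-erase u s , Supp-erase v t
  Supp-erase (u ⊗ v) (s , t) = Supp-erase u s , Supp-erase v t
  Supp-erase (⊖ u)   s       = Supp-erase u s

  Supp-quotient (con a) _ = tt
  Supp-quotient (var y) s with y ≟ x
  ... | yes _ = tt
  ... | no  _ = tt
  Supp-quotient (u ⊕ v) (s , t) = Supp-quotient u s , Supp-quotient v t
  Supp-quotient (u ⊗ v) (s , t) =
    (Supp-quotient u s , t) , Supp-map proj₁ (erase u) (Supp-erase u s) , Supp-quotient v t
  Supp-quotient (⊖ u)   s       = Supp-quotient u s

  quotient^ : ℕ → Expr → Expr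
  quotient^ zero    u = u
  quotient^ (suc n) u = quotient^ n (quotient u)

  quotient^-cong : ∀ n {u v} → u ~ v → quotient^ n u ~ quotient^ n v
  quotient^-cong zero    e = e
  quotient^-cong (suc n) e = quotient^-cong n (quotient-cong e)

  quotient^-0 : ∀ n → quotient^ n (con F.0#) ~ con F.0#
  quotient^-0 zero    = ~-refl
  quotient^-0 (suc n) = quotient^-0 n

  quotient^-⊕ : ∀ n u v → quotient^ n (u ⊕ v) ~ quotient^ n u ⊕ quotient^ n v
  quotient^-⊕ zero    u v = ~-refl
  quotient^-⊕ (suc n) u v = quotient^-⊕ n _ _

  quotient^-⊖ : ∀ n u → quotient^ n (⊖ u) ~ ⊖ quotient^ n u
  quotient^-⊖ zero    u = ~-refl
  quotient^-⊖ (suc n) u = quotient^-⊖ n _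

  quotient^-+ : ∀ m n u → quotient^ (m ℕ.+ n) u ~ quotient^ n (quotient^ m u)
  quotient^-+ zero    n u = ~-refl
  quotient^-+ (suc m) n u = quotient^-+ m n (quotient u)

  quotient^-erase⊗ : ∀ n u v → quotient^ n (erase u ⊗ v) ~ erase u ⊗ quotient^ n v
  quotient^-erase⊗ zero    u v = ~-refl
  quotient^-erase⊗ (suc n) u v = ~-trans (quotient^-cong n (begin
    quotient (erase u) ⊗ v ⊕ erase (erase u) ⊗ quotient v ≈⟨ ⊕-cong (⊗-cong (quotient-erase u) ~-refl) (⊗-cong (erase-idem u) ~-refl) ⟩
    con F.0# ⊗ v ⊕ erase u ⊗ quotient v                   ≈⟨ ⊕-cong (A.zeroˡ _) ~-refl ⟩
    con F.0# ⊕ erase u ⊗ quotient v                       ≈⟨ ⊕-identityˡ _ ⟩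
    erase u ⊗ quotient v                                  ∎))
    (quotient^-erase⊗ n u (quotient v))

  vanish-more : ∀ m n {u} → quotient^ m u ~ con F.0# → quotient^ (m ℕ.+ n) u ~ con F.0#
  vanish-more m n {u} e = ~-trans (quotient^-+ m n u) (~-trans (quotient^-cong n e) (quotient^-0 n))

  vanish-more′ : ∀ m n {u} → quotient^ n u ~ con F.0# → quotient^ (m ℕ.+ n) u ~ con F.0#
  vanish-more′ m n {u} e = ≡.subst (λ k → quotient^ k u ~ con F.0#) (ℕ.+-comm n m) (vanish-more n m e)

  -- By the twisted product rule, one quotient of u v has two summands. The first has a smaller m;
  -- in the second `erase u` passes through `quotient` as a scalar, and v is divided more than n
  -- times.
  vanish-⊗ : ∀ m n u v → quotient^ m u ~ con F.0# → quotient^ n v ~ con F.0# →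
             quotient^ (m ℕ.+ n) (u ⊗ v) ~ con F.0#
  vanish-⊗ zero    n u v e f =
    ~-trans (quotient^-cong n (~-trans (⊗-cong e ~-refl) (A.zeroˡ _))) (quotient^-0 n)
  vanish-⊗ (suc m) n u v e f = begin
    quotient^ (m ℕ.+ n) (quotient u ⊗ v ⊕ erase u ⊗ quotient v)
      ≈⟨ quotient^-⊕ (m ℕ.+ n) _ _ ⟩
    quotient^ (m ℕ.+ n) (quotient u ⊗ v) ⊕ quotient^ (m ℕ.+ n) (erase u ⊗ quotient v)
      ≈⟨ ⊕-cong (vanish-⊗ m n (quotient u) v e f) (quotient^-erase⊗ (m ℕ.+ n) u (quotient v)) ⟩
    con F.0# ⊕ erase u ⊗ quotient^ (suc m ℕ.+ n) v
      ≈⟨ ⊕-cong ~-refl (⊗-cong ~-refl (vanish-more′ (suc m) n f)) ⟩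
    con F.0# ⊕ erase u ⊗ con F.0#
      ≈⟨ ~-trans (⊕-identityˡ _) (A.zeroʳ _) ⟩
    con F.0# ∎

  quotient-kronecker : ∀ y → quotient (kronecker y) ~ con F.0#
  quotient-kronecker y with y ≟ x
  ... | yes _ = ~-refl
  ... | no  _ = ~-refl

  -- A bound on the degree in x, obtained without normal forms: every division lowers that degree by
  -- one.
  quotient-nilpotent : ∀ u → ∃[ n ] quotient^ n u ~ con F.0#
  quotient-nilpotent (con a) = 1 , ~-refl
  quotient-nilpotent (var y) = 2 , quotient-kronecker y
  quotient-nilpotent (u ⊕ v) with quotient-nilpotent u | quotient-nilpotent v
  ... | m , e | n , f = m ℕ.+ n ,
    ~-trans (quotient^-⊕ (m ℕ.+ n) u v)
      (~-trans (⊕-cong (vanish-more m n e) (vanish-more′ m n f)) (⊕-identityˡ _))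
  quotient-nilpotent (u ⊗ v) with quotient-nilpotent u | quotient-nilpotent v
  ... | m , e | n , f = m ℕ.+ n , vanish-⊗ m n u v e f
  quotient-nilpotent (⊖ u) with quotient-nilpotent u
  ... | n , e = n , ~-trans (quotient^-⊖ n u)
    (~-trans (⊖-cong e) (solve 0 (:- κ (+ 0) := κ (+ 0)) ~-refl))

  x^_*_ : ℕ → Expr → Expr
  x^ zero  * u = u
  x^ suc k * u = var x ⊗ (x^ k * u)

  x^-regular : ∀ k {u} → x^ k * u ~ con F.0# → u ~ con F.0#
  x^-regular zero    e = e
  x^-regular (suc k) e = x^-regular k (x-regular e)

  x^-⊗ : ∀ k l u v → (x^ k * u) ⊗ (x^ l * v) ~ x^ k * (x^ l * (u ⊗ v))
  x^-⊗ zero    zero    u v = ~-refl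
  x^-⊗ zero    (suc l) u v = ~-trans
    (solve 3 (λ x u v → u :* (x :* v) := x :* (u :* v)) ~-refl (var x) u (x^ l * v))
    (⊗-cong ~-refl (x^-⊗ zero l u v))
  x^-⊗ (suc k) l u v = ~-trans (⊗-assoc _ _ _) (⊗-cong ~-refl (x^-⊗ k l u v))

  -- If u vanishes at x = 0, then u is x times its quotient, for which n drops by one. The number n
  -- is the degree bound that makes this stop.
  factor : (∀ a → ExcludedMiddle a) → ∀ {q} {P : X → Set q} n u → quotient^ n u ~ con F.0# → Supp P u →
           ¬ (u ~ con F.0#) → ∃₂ λ k v → u ~ x^ k * v × Supp P v × ¬ (erase v ~ con F.0#)
  factor em zero    u e s u≁0 = contradiction e u≁0
  factor em (suc n) u e s u≁0 with em _ {erase u ~ con F.0#}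
  ... | no  erase≁0 = 0 , u , ~-refl , s , erase≁0
  ... | yes erase~0 =
    let u~xq : u ~ var x ⊗ quotient u
        u~xq = ~-trans (decompose u) (~-trans (⊕-cong erase~0 ~-refl) (⊕-identityˡ _))
        k , v , q~ , s′ , v≁0 = factor em n (quotient u) e (Supp-quotient u s)
          λ q~0 → u≁0 (~-trans u~xq (~-trans (⊗-cong ~-refl q~0) (A.zeroʳ _)))
    in suc k , v , ~-trans u~xq (⊗-cong ~-refl q~) , s′ , v≁0

-- Free algebras over domains are domains

module FreeAlgebraDomain {c ℓ} (F : CommutativeRing c ℓ) {X : Set} (_≟_ : DecidableEquality X)
  (p : Level) (em : ∀ a → ExcludedMiddle a) where

  open FreeAlgebra F X p
  open Support F X p
  private module F = CommutativeRing F
  private module A = CommutativeRing algebra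

  module _ (F-domain : ∀ {a b} → a F.* b F.≈ F.0# → a F.≈ F.0# ⊎ b F.≈ F.0#) where

    -- Divide out the powers of x, then put x = 0.

    domain-on : ∀ xs u v → Supp (_∈ xs) u → Supp (_∈ xs) v → u ⊗ v ~ con F.0# →
                u ~ con F.0# ⊎ v ~ con F.0#
    domain-on [] u v s t uv~0
      with Supp-⊥⇒con u (Supp-map (λ ()) u s) | Supp-⊥⇒con v (Supp-map (λ ()) v t)
    ... | a , u~a | b , v~b
      with F-domain (con-injective (~-trans (con-⊗ a b)
                      (~-trans (⊗-cong (~-sym u~a) (~-sym v~b)) uv~0)))
    ...   | inj₁ a≈0 = inj₁ (~-trans u~a (con-cong a≈0))
    ...   | inj₂ b≈0 = inj₂ (~-trans v~b (con-cong b≈0))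
    domain-on (x ∷ xs) u v s t uv~0 with em _ {u ~ con F.0#} | em _ {v ~ con F.0#}
    ... | yes u~0 | _       = inj₁ u~0
    ... | no  _   | yes v~0 = inj₂ v~0
    ... | no  u≁0 | no  v≁0
      with factor em (proj₁ (quotient-nilpotent u)) u (proj₂ (quotient-nilpotent u)) s u≁0
         | factor em (proj₁ (quotient-nilpotent v)) v (proj₂ (quotient-nilpotent v)) t v≁0
      where open DividedDifference F _≟_ p x
    ... | k , u′ , u~ , s′ , u′≁0 | l , v′ , v~ , t′ , v′≁0
      with domain-on xs (erase u′) (erase v′)
             (Supp-map strengthen (erase u′) (Supp-erase u′ s′))
             (Supp-map strengthen (erase v′) (Supp-erase v′ t′))
             (erase-cong (x^-regular l (x^-regular k
               (~-trans (~-sym (x^-⊗ k l u′ v′)) (~-trans (⊗-cong (~-sym u~) (~-sym v~)) uv~0)))))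
      where
      open DividedDifference F _≟_ p x
      strengthen : ∀ {y} → y ∈ x ∷ xs × y ≢ x → y ∈ xs
      strengthen (here y≡x , y≢x) = contradiction y≡x y≢x
      strengthen (there y∈ , _)   = y∈
    ...   | inj₁ u′~0 = contradiction u′~0 u′≁0
    ...   | inj₂ v′~0 = contradiction v′~0 v′≁0

    domain : ∀ {u v} → u ⊗ v ~ con F.0# → u ~ con F.0# ⊎ v ~ con F.0#
    domain {u} {v} = domain-on (vars u ++ vars v) u v
      (Supp-map ∈-++⁺ˡ u (Supp-vars u)) (Supp-map (∈-++⁺ʳ (vars u)) v (Supp-vars v))

-- Fraction fields

module FractionField {c ℓ} (R : CommutativeRing c ℓ)
  (1≉0    : ¬ CommutativeRing._≈_ R (CommutativeRing.1# R) (CommutativeRing.0# R))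
  (domain : ∀ {x y} → CommutativeRing._≈_ R (CommutativeRing._*_ R x y) (CommutativeRing.0# R) →
            CommutativeRing._≈_ R x (CommutativeRing.0# R) ⊎ CommutativeRing._≈_ R y (CommutativeRing.0# R)) where

  open CommutativeRing R
  open IntegerSolver R
  open RingProperties ring using (x∙y⁻¹≈ε⇒x≈y)
  open import Relation.Binary.Reasoning.Setoid setoid

  record Fraction : Set (c ⊔ ℓ) where
    constructor frac
    field
      num   : Carrier
      den   : Carrier
      den≉0 : ¬ (den ≈ 0#)
  open Fraction

  *-nonzero : ∀ {x y} → ¬ (x ≈ 0#) → ¬ (y ≈ 0#) → ¬ (x * y ≈ 0#)
  *-nonzero x≉0 y≉0 xy≈0 = [ x≉0 , y≉0 ] (domain xy≈0)

  *-cancelʳ : ∀ {x y z} → ¬ (z ≈ 0#) → x * z ≈ y * z → x ≈ y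
  *-cancelʳ {x} {y} {z} z≉0 e with domain (begin
      (x - y) * z     ≈⟨ solve 3 (λ x y z → (x :- y) :* z := x :* z :- y :* z) refl x y z ⟩
      x * z - y * z   ≈⟨ +-congʳ e ⟩
      y * z - y * z   ≈⟨ -‿inverseʳ _ ⟩
      0#              ∎)
  ... | inj₁ x-y≈0 = x∙y⁻¹≈ε⇒x≈y _ _ x-y≈0
  ... | inj₂ z≈0   = contradiction z≈0 z≉0

  infix 4 _≈ᶠ_
  _≈ᶠ_ : Fraction → Fraction → Set ℓ
  x ≈ᶠ y = num x * den y ≈ num y * den x

  ≈ᶠ-trans : ∀ {x y z} → x ≈ᶠ y → y ≈ᶠ z → x ≈ᶠ z
  ≈ᶠ-trans {frac a b _} {frac a′ b′ b′≉0} {frac a″ b″ _} e f = *-cancelʳ b′≉0 (begin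
    a * b″ * b′    ≈⟨ solve 3 (λ a b b′ → a :* b :* b′ := a :* b′ :* b) refl a b″ b′ ⟩
    a * b′ * b″    ≈⟨ *-congʳ e ⟩
    a′ * b * b″    ≈⟨ solve 3 (λ a b b′ → a :* b :* b′ := a :* b′ :* b) refl a′ b b″ ⟩
    a′ * b″ * b    ≈⟨ *-congʳ f ⟩
    a″ * b′ * b    ≈⟨ solve 3 (λ a b b′ → a :* b :* b′ := a :* b′ :* b) refl a″ b′ b ⟩
    a″ * b * b′    ∎)

  _+ᶠ_ _*ᶠ_ : Fraction → Fraction → Fraction
  frac a b b≉0 +ᶠ frac c d d≉0 = frac (a * d + c * b) (b * d) (*-nonzero b≉0 d≉0)
  frac a b b≉0 *ᶠ frac c d d≉0 = frac (a * c) (b * d) (*-nonzero b≉0 d≉0)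

  -ᶠ_ : Fraction → Fraction
  -ᶠ frac a b b≉0 = frac (- a) b b≉0

  embed : Carrier → Fraction
  embed a = frac a 1# 1≉0

  fractionRing : CommutativeRing (c ⊔ ℓ) ℓ
  fractionRing = record
    { Carrier = Fraction
    ; _≈_ = _≈ᶠ_ ; _+_ = _+ᶠ_ ; _*_ = _*ᶠ_ ; -_ = -ᶠ_ ; 0# = embed 0# ; 1# = embed 1#
    ; isCommutativeRing = record
      { isRing = record
        { +-isAbelianGroup = record
          { isGroup = record
            { isMonoid = record
              { isSemigroup = record
                { isMagma = record
                  { isEquivalence = record
                    { refl  = refl
                    ; sym   = sym
                    ; trans = λ {x} {y} {z} → ≈ᶠ-trans {x} {y} {z}
                    }
                  ; ∙-cong = λ {x} {y} {u} {v} → +-congᶠ {x} {y} {u} {v}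
                  }
                ; assoc = λ (frac a b _) (frac c d _) (frac e f _) →
                    solve 6 (λ a b c d e f → ((a :* d :+ c :* b) :* f :+ e :* (b :* d)) :* (b :* (d :* f))
                      := (a :* (d :* f) :+ (c :* f :+ e :* d) :* b) :* (b :* d :* f)) refl a b c d e f
                }
              ; identity =
                  (λ (frac a b _) → solve 2 (λ a b → (κ (+ 0) :* b :+ a :* κ (+ 1)) :* b := a :* (κ (+ 1) :* b)) refl a b)
                , (λ (frac a b _) → solve 2 (λ a b → (a :* κ (+ 1) :+ κ (+ 0) :* b) :* b := a :* (b :* κ (+ 1))) refl a b)
              }
            ; inverse =
                (λ (frac a b _) → solve 2 (λ a b → (:- a :* b :+ a :* b) :* κ (+ 1) := κ (+ 0) :* (b :* b)) refl a b)
              , (λ (frac a b _) → solve 2 (λ a b → (a :* b :+ :- a :* b) :* κ (+ 1) := κ (+ 0) :* (b :* b)) refl a b)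
            ; ⁻¹-cong = λ {x} {y} e → trans (sym (-‿distribˡ-* _ _)) (trans (-‿cong e) (-‿distribˡ-* _ _))
            }
          ; comm = λ (frac a b _) (frac c d _) →
              solve 4 (λ a b c d → (a :* d :+ c :* b) :* (d :* b) := (c :* b :+ a :* d) :* (b :* d)) refl a b c d
          }
        ; *-cong = λ {x} {y} {u} {v} → *-congᶠ {x} {y} {u} {v}
        ; *-assoc = λ (frac a b _) (frac c d _) (frac e f _) →
            solve 6 (λ a b c d e f → a :* c :* e :* (b :* (d :* f)) := a :* (c :* e) :* (b :* d :* f)) refl a b c d e f
        ; *-identity =
            (λ (frac a b _) → solve 2 (λ a b → κ (+ 1) :* a :* b := a :* (κ (+ 1) :* b)) refl a b)
          , (λ (frac a b _) → solve 2 (λ a b → a :* κ (+ 1) :* b := a :* (b :* κ (+ 1))) refl a b)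
        ; distrib =
            (λ (frac a b _) (frac c d _) (frac e f _) →
              solve 6 (λ a b c d e f → a :* (c :* f :+ e :* d) :* (b :* d :* (b :* f))
                := (a :* c :* (b :* f) :+ a :* e :* (b :* d)) :* (b :* (d :* f))) refl a b c d e f)
          , (λ (frac a b _) (frac c d _) (frac e f _) →
              solve 6 (λ a b c d e f → (c :* f :+ e :* d) :* a :* (d :* b :* (f :* b))
                := (c :* a :* (f :* b) :+ e :* a :* (d :* b)) :* (d :* f :* b)) refl a b c d e f)
        }
      ; *-comm = λ (frac a b _) (frac c d _) →
          solve 4 (λ a b c d → a :* c :* (d :* b) := c :* a :* (b :* d)) refl a b c d
      }
    }
    where
    open RingProperties ring using (-‿distribˡ-*)

    +-congᶠ : ∀ {x y u v} → x ≈ᶠ y → u ≈ᶠ v → x +ᶠ u ≈ᶠ y +ᶠ v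
    +-congᶠ {frac a b _} {frac a′ b′ _} {frac c d _} {frac c′ d′ _} e f = begin
      (a * d + c * b) * (b′ * d′)            ≈⟨ solve 6 (λ a b c d b′ d′ → (a :* d :+ c :* b) :* (b′ :* d′)
                                                  := a :* b′ :* (d :* d′) :+ c :* d′ :* (b :* b′)) refl a b c d b′ d′ ⟩
      a * b′ * (d * d′) + c * d′ * (b * b′)  ≈⟨ +-cong (*-congʳ e) (*-congʳ f) ⟩
      a′ * b * (d * d′) + c′ * d * (b * b′)  ≈⟨ solve 6 (λ a b c d b′ d′ → a :* b :* (d :* d′) :+ c :* d :* (b :* b′)
                                                  := (a :* d′ :+ c :* b′) :* (b :* d)) refl a′ b c′ d b′ d′ ⟩
      (a′ * d′ + c′ * b′) * (b * d)          ∎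

    *-congᶠ : ∀ {x y u v} → x ≈ᶠ y → u ≈ᶠ v → x *ᶠ u ≈ᶠ y *ᶠ v
    *-congᶠ {frac a b _} {frac a′ b′ _} {frac c d _} {frac c′ d′ _} e f = begin
      a * c * (b′ * d′)      ≈⟨ solve 4 (λ a c b d → a :* c :* (b :* d) := a :* b :* (c :* d)) refl a c b′ d′ ⟩
      a * b′ * (c * d′)      ≈⟨ *-cong e f ⟩
      a′ * b * (c′ * d)      ≈⟨ solve 4 (λ a c b d → a :* b :* (c :* d) := a :* c :* (b :* d)) refl a′ c′ b d ⟩
      a′ * c′ * (b * d)      ∎

  fractionField : Field (c ⊔ ℓ) ℓ
  fractionField = record
    { commutativeRing = fractionRing
    ; 1≉0             = λ e → 1≉0 (trans (sym (*-identityʳ _)) (trans e (zeroˡ _)))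
    ; inverse         = inverse
    }
    where
    inverse : ∀ x → ¬ (x ≈ᶠ embed 0#) → _
    inverse (frac a b b≉0) x≉0 =
      frac b a (λ a≈0 → x≉0 (trans (*-congʳ a≈0) (trans (zeroˡ _) (sym (zeroˡ _)))))
      , solve 2 (λ a b → b :* a :* κ (+ 1) := κ (+ 1) :* (a :* b)) refl a b
      , solve 2 (λ a b → a :* b :* κ (+ 1) := κ (+ 1) :* (b :* a)) refl a b

  embed-isRingMonomorphism : IsRingMonomorphism rawRing (Field.rawRing fractionField) embed
  embed-isRingMonomorphism = record
    { isRingHomomorphism = record
      { isSemiringHomomorphism = record
        { isNearSemiringHomomorphism = record
          { +-isMonoidHomomorphism = record
            { isMagmaHomomorphism = record
              { isRelHomomorphism = record { cong = *-congʳ }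
              ; homo = λ a b → solve 2 (λ a b → (a :+ b) :* (κ (+ 1) :* κ (+ 1))
                         := (a :* κ (+ 1) :+ b :* κ (+ 1)) :* κ (+ 1)) refl a b
              }
            ; ε-homo = refl
            }
          ; *-homo = λ a b → solve 2 (λ a b → a :* b :* (κ (+ 1) :* κ (+ 1)) := a :* b :* κ (+ 1)) refl a b
          }
        ; 1#-homo = refl
        }
      ; -‿homo = λ a → refl
      }
    ; injective = λ e → trans (sym (*-identityʳ _)) (trans e (*-identityʳ _))
    }

  module Extension (d : CommutativeRing.Carrier R → CommutativeRing.Carrier R)
    (d-cong : ∀ {x y} → CommutativeRing._≈_ R x y → CommutativeRing._≈_ R (d x) (d y))
    (d-+    : ∀ x y → CommutativeRing._≈_ R (d (CommutativeRing._+_ R x y)) (CommutativeRing._+_ R (d x) (d y)))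
    (d-*    : ∀ x y → CommutativeRing._≈_ R (d (CommutativeRing._*_ R x y))
                (CommutativeRing._+_ R (CommutativeRing._*_ R (d x) y) (CommutativeRing._*_ R x (d y)))) where

    dᶠ : Fraction → Fraction
    dᶠ (frac a b b≉0) = frac (d a * b - a * d b) (b * b) (*-nonzero b≉0 b≉0)

    -- Up to denominators, the quotient rule for a/b can be rewritten so that a enters only through
    -- a b₁ and d (a b₁). Both may then be replaced by means of a b₁ ≈ a₁ b and its derivative.
    dᶠ-cong : ∀ {x y} → x ≈ᶠ y → dᶠ x ≈ᶠ dᶠ y
    dᶠ-cong {frac a b _} {frac a₁ b₁ _} e = begin
      (d a * b - a * d b) * (b₁ * b₁)
        ≈⟨ solve 6 (λ a b b₁ a′ b′ b₁′ → (a′ :* b :- a :* b′) :* (b₁ :* b₁)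
             := (a′ :* b₁ :+ a :* b₁′) :* (b :* b₁) :- a :* b₁ :* (b₁′ :* b :+ b′ :* b₁))
             refl a b b₁ (d a) (d b) (d b₁) ⟩
      (d a * b₁ + a * d b₁) * (b * b₁) - a * b₁ * (d b₁ * b + d b * b₁)
        ≈⟨ +-cong (*-congʳ (trans (sym (d-* a b₁)) (trans (d-cong e) (d-* a₁ b)))) (-‿cong (*-congʳ e)) ⟩
      (d a₁ * b + a₁ * d b) * (b * b₁) - a₁ * b * (d b₁ * b + d b * b₁)
        ≈⟨ solve 6 (λ a₁ b b₁ a₁′ b′ b₁′ → (a₁′ :* b :+ a₁ :* b′) :* (b :* b₁) :- a₁ :* b :* (b₁′ :* b :+ b′ :* b₁)
             := (a₁′ :* b₁ :- a₁ :* b₁′) :* (b :* b)) refl a₁ b b₁ (d a₁) (d b) (d b₁) ⟩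
      (d a₁ * b₁ - a₁ * d b₁) * (b * b) ∎

    dᶠ-+ : ∀ x y → dᶠ (x +ᶠ y) ≈ᶠ dᶠ x +ᶠ dᶠ y
    dᶠ-+ (frac a b _) (frac a₁ b₁ _) = *-cong (begin
      d (a * b₁ + a₁ * b) * (b * b₁) - (a * b₁ + a₁ * b) * d (b * b₁)
        ≈⟨ +-cong (*-congʳ (trans (d-+ _ _) (+-cong (d-* a b₁) (d-* a₁ b)))) (-‿cong (*-congˡ (d-* b b₁))) ⟩
      (d a * b₁ + a * d b₁ + (d a₁ * b + a₁ * d b)) * (b * b₁) - (a * b₁ + a₁ * b) * (d b * b₁ + b * d b₁)
        ≈⟨ solve 8 (λ a a′ b b′ a₁ a₁′ b₁ b₁′ →
             (a′ :* b₁ :+ a :* b₁′ :+ (a₁′ :* b :+ a₁ :* b′)) :* (b :* b₁) :- (a :* b₁ :+ a₁ :* b) :* (b′ :* b₁ :+ b :* b₁′)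
             := (a′ :* b :- a :* b′) :* (b₁ :* b₁) :+ (a₁′ :* b₁ :- a₁ :* b₁′) :* (b :* b))
             refl a (d a) b (d b) a₁ (d a₁) b₁ (d b₁) ⟩
      (d a * b - a * d b) * (b₁ * b₁) + (d a₁ * b₁ - a₁ * d b₁) * (b * b) ∎)
      (solve 2 (λ b b₁ → b :* b :* (b₁ :* b₁) := b :* b₁ :* (b :* b₁)) refl b b₁)

    dᶠ-* : ∀ x y → dᶠ (x *ᶠ y) ≈ᶠ (dᶠ x *ᶠ y) +ᶠ (x *ᶠ dᶠ y)
    dᶠ-* (frac a b _) (frac a₁ b₁ _) = begin
      t * (b * b * b₁ * (b * (b₁ * b₁)))
        ≈⟨ solve 3 (λ t b b₁ → t :* (b :* b :* b₁ :* (b :* (b₁ :* b₁))) := t :* (b :* b₁) :* (b :* b₁ :* (b :* b₁))) refl t b b₁ ⟩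
      t * (b * b₁) * (b * b₁ * (b * b₁))
        ≈⟨ *-congʳ (*-congʳ (+-cong (*-congʳ (d-* a a₁)) (-‿cong (*-congˡ (d-* b b₁))))) ⟩
      ((d a * a₁ + a * d a₁) * (b * b₁) - a * a₁ * (d b * b₁ + b * d b₁)) * (b * b₁) * (b * b₁ * (b * b₁))
        ≈⟨ *-congʳ (solve 8 (λ a a′ b b′ a₁ a₁′ b₁ b₁′ →
             ((a′ :* a₁ :+ a :* a₁′) :* (b :* b₁) :- a :* a₁ :* (b′ :* b₁ :+ b :* b₁′)) :* (b :* b₁)
             := (a′ :* b :- a :* b′) :* a₁ :* (b :* (b₁ :* b₁)) :+ a :* (a₁′ :* b₁ :- a₁ :* b₁′) :* (b :* b :* b₁))
             refl a (d a) b (d b) a₁ (d a₁) b₁ (d b₁)) ⟩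
      ((d a * b - a * d b) * a₁ * (b * (b₁ * b₁)) + a * (d a₁ * b₁ - a₁ * d b₁) * (b * b * b₁)) * (b * b₁ * (b * b₁)) ∎
      where t = d (a * a₁) * (b * b₁) - a * a₁ * d (b * b₁)

    dᶠ-embed : ∀ a → dᶠ (embed a) ≈ᶠ embed (d a)
    dᶠ-embed a = begin
      (d a * 1# - a * d 1#) * 1#   ≈⟨ *-congʳ (+-congˡ (-‿cong (*-congˡ d1≈0))) ⟩
      (d a * 1# - a * 0#) * 1#     ≈⟨ solve 2 (λ a′ a → (a′ :* κ (+ 1) :- a :* κ (+ 0)) :* κ (+ 1)
                                        := a′ :* (κ (+ 1) :* κ (+ 1))) refl (d a) a ⟩
      d a * (1# * 1#)              ∎
      where
      d1≈0 : d 1# ≈ 0#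
      d1≈0 = begin
        d 1#                              ≈⟨ solve 1 (λ x → x := x :* κ (+ 1) :+ κ (+ 1) :* x :- x) refl (d 1#) ⟩
        d 1# * 1# + 1# * d 1# - d 1#      ≈⟨ +-congʳ (trans (sym (d-* _ _)) (d-cong (*-identityˡ _))) ⟩
        d 1# - d 1#                       ≈⟨ -‿inverseʳ _ ⟩
        0#                                ∎

    dᶠ-isDerivation : IsDerivation fractionField dᶠ
    dᶠ-isDerivation = record { cong = λ {x} {y} → dᶠ-cong {x} {y} ; +-homo = dᶠ-+ ; leibniz = dᶠ-* }

module _ {c ℓ} (M : Field c ℓ) where

  open Field M
  open IntegerSolver commutativeRing
  open RingProperties ring using (+-cancelʳ)
  open import Relation.Binary.Reasoning.Setoid setoid

  -- Expanding d d′ and d′ d on x y = z gives the same mixed terms, so that the commutator of x,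
  -- multiplied by y, vanishes. This reduces commutation on fractions to numerators and
  -- denominators.
  commute-quotient : ∀ {d d′} → IsDerivation M d → IsDerivation M d′ → ∀ {x y z} → ¬ (y ≈ 0#) → x * y ≈ z →
    d (d′ y) ≈ d′ (d y) → d (d′ z) ≈ d′ (d z) → d (d′ x) ≈ d′ (d x)
  commute-quotient {d} {d′} D D′ {x} {y} {z} y≉0 xy≈z ey ez = begin
    d (d′ x)               ≈⟨ *-identityʳ _ ⟨
    d (d′ x) * 1#          ≈⟨ *-congˡ yy⁻¹≈1 ⟨
    d (d′ x) * (y * y⁻¹)   ≈⟨ *-assoc _ _ _ ⟨
    d (d′ x) * y * y⁻¹     ≈⟨ *-congʳ (+-cancelʳ (d x * d′ y + d′ x * d y + x * d′ (d y)) _ _ cancelled) ⟩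
    d′ (d x) * y * y⁻¹     ≈⟨ *-assoc _ _ _ ⟩
    d′ (d x) * (y * y⁻¹)   ≈⟨ *-congˡ yy⁻¹≈1 ⟩
    d′ (d x) * 1#          ≈⟨ *-identityʳ _ ⟩
    d′ (d x)               ∎
    where
    y⁻¹ = proj₁ (inverse y y≉0)

    yy⁻¹≈1 : y * y⁻¹ ≈ 1#
    yy⁻¹≈1 = proj₂ (proj₂ (inverse y y≉0))

    second : ∀ {d d′} → IsDerivation M d → IsDerivation M d′ →
             d (d′ (x * y)) ≈ d (d′ x) * y + (d x * d′ y + d′ x * d y + x * d (d′ y))
    second {d} {d′} D D′ = begin
      d (d′ (x * y))
        ≈⟨ D.cong (D′.leibniz x y) ⟩
      d (d′ x * y + x * d′ y)
        ≈⟨ trans (D.+-homo _ _) (+-cong (D.leibniz _ _) (D.leibniz _ _)) ⟩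
      d (d′ x) * y + d′ x * d y + (d x * d′ y + x * d (d′ y))
        ≈⟨ solve 4 (λ a b c e → a :+ b :+ (c :+ e) := a :+ (c :+ b :+ e)) refl (d (d′ x) * y) (d′ x * d y) (d x * d′ y) (x * d (d′ y)) ⟩
      d (d′ x) * y + (d x * d′ y + d′ x * d y + x * d (d′ y)) ∎
      where
      module D  = IsDerivation D
      module D′ = IsDerivation D′

    cancelled : d (d′ x) * y + (d x * d′ y + d′ x * d y + x * d′ (d y)) ≈
                d′ (d x) * y + (d x * d′ y + d′ x * d y + x * d′ (d y))
    cancelled = begin
      d (d′ x) * y + (d x * d′ y + d′ x * d y + x * d′ (d y))  ≈⟨ +-congˡ (+-congˡ (*-congˡ ey)) ⟨
      d (d′ x) * y + (d x * d′ y + d′ x * d y + x * d (d′ y))  ≈⟨ second D D′ ⟨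
      d (d′ (x * y))                                           ≈⟨ D.cong (D′.cong xy≈z) ⟩
      d (d′ z)                                                 ≈⟨ ez ⟩
      d′ (d z)                                                 ≈⟨ D′.cong (D.cong xy≈z) ⟨
      d′ (d (x * y))                                           ≈⟨ second D′ D ⟩
      d′ (d x) * y + (d′ x * d y + d x * d′ y + x * d′ (d y))  ≈⟨ +-congˡ (+-congʳ (+-comm _ _)) ⟩
      d′ (d x) * y + (d x * d′ y + d′ x * d y + x * d′ (d y))  ∎
      where
      module D  = IsDerivation D
      module D′ = IsDerivation D′

-- Evaluation of polynomials and of their derivatives

module PolynomialEvaluation {c₁ ℓ₁ c₂ ℓ₂} {K : Field c₁ ℓ₁} {L : Field c₂ ℓ₂} (E : FieldExtension K L) where

  private module K = Field K
  open Field L hiding (zero)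
  open FieldExtension E using (ι; +-homo; *-homo; 0#-homo; ⟦⟧-cong)
  open Polynomial K.commutativeRing
  open Exp semiring using (_^_; ^-homo-*)
  open SemiringMult semiring using (×-congʳ; ×-homo-+; ×-assoc-*; ×-comm-*) renaming (_×_ to _·_)
  open SemiringMult K.semiring using () renaming (_×_ to _·ᴷ_)
  open SemiringSum semiring using (sum; sum-cong-≋; *-distribˡ-sum; ∑-distrib-+)
  open RawSemiringOps (Semiring.rawSemiring semiring) using (product)
  open IntegerSolver commutativeRing
  open import Relation.Binary.Reasoning.Setoid setoid

  ι-· : ∀ n a → ι (n ·ᴷ a) ≈ n · ι a
  ι-· zero    a = 0#-homo
  ι-· (suc n) a = trans (+-homo _ _) (+-congˡ (ι-· n a))

  monomial : (Fin N → Carrier) → Vec ℕ N → Carrier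
  monomial x e = product (λ j → x j ^ Vec.lookup e j)

  monomial-+ : ∀ (x : Fin N → Carrier) d e →
               monomial x (Vec.zipWith ℕ._+_ d e) ≈ monomial x d * monomial x e
  monomial-+ x []       []       = sym (*-identityˡ _)
  monomial-+ x (d ∷ ds) (e ∷ es) = begin
    x zero ^ (d ℕ.+ e) * monomial (x ∘ suc) (Vec.zipWith ℕ._+_ ds es)
      ≈⟨ *-cong (^-homo-* (x zero) d e) (monomial-+ (x ∘ suc) ds es) ⟩
    x zero ^ d * x zero ^ e * (monomial (x ∘ suc) ds * monomial (x ∘ suc) es)
      ≈⟨ solve 4 (λ a b c d → a :* b :* (c :* d) := a :* c :* (b :* d)) refl _ _ _ _ ⟩
    x zero ^ d * monomial (x ∘ suc) ds * (x zero ^ e * monomial (x ∘ suc) es) ∎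

  monomial-0 : ∀ (x : Fin N → Carrier) → monomial x (Vec.replicate N 0) ≈ 1#
  monomial-0 {zero}  x = refl
  monomial-0 {suc N} x = trans (*-identityˡ _) (monomial-0 (x ∘ suc))

  monomial-ε : ∀ (x : Fin N → Carrier) j → monomial x (ε j) ≈ x j
  monomial-ε x zero    = trans (*-cong (*-identityʳ _) (monomial-0 (x ∘ suc))) (*-identityʳ _)
  monomial-ε x (suc j) = trans (*-identityˡ _) (monomial-ε (x ∘ suc) j)

  power′ : Carrier → ℕ → Carrier
  power′ x e = e · x ^ pred e

  power′-+ : ∀ x d e → power′ x (d ℕ.+ e) ≈ power′ x d * x ^ e + x ^ d * power′ x e
  power′-+ x zero    e       = sym (trans (+-cong (zeroˡ _) (*-identityˡ _)) (+-identityˡ _))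
  power′-+ x (suc d) e = begin
    (suc d ℕ.+ e) · x ^ (d ℕ.+ e)                                ≈⟨ ×-homo-+ _ (suc d) e ⟩
    suc d · x ^ (d ℕ.+ e) + e · x ^ (d ℕ.+ e)                    ≈⟨ +-cong (×-congʳ (suc d) (^-homo-* x d e)) (second e) ⟩
    suc d · (x ^ d * x ^ e) + x ^ suc d * (e · x ^ pred e)       ≈⟨ +-congʳ (×-assoc-* (suc d) _ _) ⟨
    suc d · x ^ d * x ^ e + x ^ suc d * (e · x ^ pred e)         ∎
    where
    second : ∀ e → e · x ^ (d ℕ.+ e) ≈ x ^ suc d * (e · x ^ pred e)
    second zero    = sym (zeroʳ _)
    second (suc e) = begin
      suc e · x ^ (d ℕ.+ suc e)      ≡⟨ ≡.cong (λ k → suc e · x ^ k) (ℕ.+-suc d e) ⟩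
      suc e · x ^ (suc d ℕ.+ e)      ≈⟨ ×-congʳ (suc e) (^-homo-* x (suc d) e) ⟩
      suc e · (x ^ suc d * x ^ e)    ≈⟨ ×-comm-* (suc e) _ _ ⟨
      x ^ suc d * (suc e · x ^ e)    ∎

  -- The derivative of the monomial at `x` in the direction `y`. Where an exponent is 0 the
  -- truncated `pred` is multiplied by 0.
  monomial′ : (x y : Fin N → Carrier) → Vec ℕ N → Carrier
  monomial′ x y e = sum (λ j → Vec.lookup e j · monomial x (Vec.updateAt e j pred) * y j)

  monomial′-∷ : ∀ (x y : Fin (suc N) → Carrier) e es → monomial′ x y (e ∷ es) ≈
    power′ (x zero) e * y zero * monomial (x ∘ suc) es + x zero ^ e * monomial′ (x ∘ suc) (y ∘ suc) es
  monomial′-∷ x y e es = +-cong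
    (begin
      e · (x zero ^ pred e * monomial (x ∘ suc) es) * y zero   ≈⟨ *-congʳ (×-assoc-* e _ _) ⟨
      power′ (x zero) e * monomial (x ∘ suc) es * y zero       ≈⟨ solve 3 (λ a b c → a :* b :* c := a :* c :* b) refl _ _ _ ⟩
      power′ (x zero) e * y zero * monomial (x ∘ suc) es       ∎)
    (trans
      (sum-cong-≋ λ j → begin
        Vec.lookup es j · (x zero ^ e * monomial (x ∘ suc) (Vec.updateAt es j pred)) * y (suc j)
          ≈⟨ *-congʳ (×-comm-* (Vec.lookup es j) _ _) ⟨
        x zero ^ e * (Vec.lookup es j · monomial (x ∘ suc) (Vec.updateAt es j pred)) * y (suc j)
          ≈⟨ *-assoc _ _ _ ⟩
        x zero ^ e * (Vec.lookup es j · monomial (x ∘ suc) (Vec.updateAt es j pred) * y (suc j)) ∎)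
      (sym (*-distribˡ-sum (x zero ^ e) (λ j → Vec.lookup es j · monomial (x ∘ suc) (Vec.updateAt es j pred) * y (suc j)))))

  monomial′-+ : ∀ (x y : Fin N → Carrier) d e → monomial′ x y (Vec.zipWith ℕ._+_ d e) ≈
                monomial′ x y d * monomial x e + monomial x d * monomial′ x y e
  monomial′-+ x y [] [] = sym (trans (+-cong (zeroˡ _) (zeroʳ _)) (+-identityˡ _))
  monomial′-+ x y (d ∷ ds) (e ∷ es) = begin
    monomial′ x y (d ℕ.+ e ∷ Vec.zipWith ℕ._+_ ds es)
      ≈⟨ monomial′-∷ x y (d ℕ.+ e) (Vec.zipWith ℕ._+_ ds es) ⟩
    power′ x₀ (d ℕ.+ e) * y₀ * monomial xs (Vec.zipWith ℕ._+_ ds es) + x₀ ^ (d ℕ.+ e) * monomial′ xs ys (Vec.zipWith ℕ._+_ ds es)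
      ≈⟨ +-cong (*-cong (*-congʳ (power′-+ x₀ d e)) (monomial-+ xs ds es))
                (*-cong (^-homo-* x₀ d e) (monomial′-+ xs ys ds es)) ⟩
    (power′ x₀ d * x₀ ^ e + x₀ ^ d * power′ x₀ e) * y₀ * (monomial xs ds * monomial xs es)
      + x₀ ^ d * x₀ ^ e * (monomial′ xs ys ds * monomial xs es + monomial xs ds * monomial′ xs ys es)
      ≈⟨ solve 9 (λ p′ p q q′ y m n m′ n′ →
           (p′ :* q :+ p :* q′) :* y :* (m :* n) :+ p :* q :* (m′ :* n :+ m :* n′)
           := (p′ :* y :* m :+ p :* m′) :* (q :* n) :+ p :* m :* (q′ :* y :* n :+ q :* n′)) refl
           (power′ x₀ d) (x₀ ^ d) (x₀ ^ e) (power′ x₀ e) y₀ (monomial xs ds) (monomial xs es) (monomial′ xs ys ds) (monomial′ xs ys es) ⟩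
    (power′ x₀ d * y₀ * monomial xs ds + x₀ ^ d * monomial′ xs ys ds) * monomial x (e ∷ es)
      + monomial x (d ∷ ds) * (power′ x₀ e * y₀ * monomial xs es + x₀ ^ e * monomial′ xs ys es)
      ≈⟨ +-cong (*-congʳ (monomial′-∷ x y d ds)) (*-congˡ (monomial′-∷ x y e es)) ⟨
    monomial′ x y (d ∷ ds) * monomial x (e ∷ es) + monomial x (d ∷ ds) * monomial′ x y (e ∷ es) ∎
    where
    x₀ = x zero
    y₀ = y zero
    xs = x ∘ suc
    ys = y ∘ suc

  monomial′-0 : ∀ (x y : Fin N → Carrier) → monomial′ x y (Vec.replicate N 0) ≈ 0#
  monomial′-0 {zero}  x y = refl
  monomial′-0 {suc N} x y = begin
    monomial′ x y (Vec.replicate _ 0)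
      ≈⟨ monomial′-∷ x y 0 (Vec.replicate N 0) ⟩
    0# * y zero * monomial (x ∘ suc) (Vec.replicate N 0) + 1# * monomial′ (x ∘ suc) (y ∘ suc) (Vec.replicate N 0)
      ≈⟨ +-congˡ (*-congˡ (monomial′-0 (x ∘ suc) (y ∘ suc))) ⟩
    0# * y zero * monomial (x ∘ suc) (Vec.replicate N 0) + 1# * 0#
      ≈⟨ solve 2 (λ y m → κ (+ 0) :* y :* m :+ κ (+ 1) :* κ (+ 0) := κ (+ 0)) refl (y zero) (monomial (x ∘ suc) (Vec.replicate N 0)) ⟩
    0# ∎

  monomial′-ε : ∀ (x y : Fin N → Carrier) j → monomial′ x y (ε j) ≈ y j
  monomial′-ε x y zero = begin
    monomial′ x y (ε zero)
      ≈⟨ monomial′-∷ x y 1 (Vec.replicate _ 0) ⟩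
    (1# + 0#) * y zero * monomial (x ∘ suc) (Vec.replicate _ 0) + x zero ^ 1 * monomial′ (x ∘ suc) (y ∘ suc) (Vec.replicate _ 0)
      ≈⟨ +-cong (*-congˡ (monomial-0 (x ∘ suc))) (*-congˡ (monomial′-0 (x ∘ suc) (y ∘ suc))) ⟩
    (1# + 0#) * y zero * 1# + x zero ^ 1 * 0#
      ≈⟨ solve 2 (λ y x → (κ (+ 1) :+ κ (+ 0)) :* y :* κ (+ 1) :+ x :* κ (+ 0) := y) refl (y zero) (x zero ^ 1) ⟩
    y zero ∎
  monomial′-ε x y (suc j) = begin
    monomial′ x y (ε (suc j))
      ≈⟨ monomial′-∷ x y 0 (ε j) ⟩
    0# * y zero * monomial (x ∘ suc) (ε j) + 1# * monomial′ (x ∘ suc) (y ∘ suc) (ε j)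
      ≈⟨ +-congˡ (*-congˡ (monomial′-ε (x ∘ suc) (y ∘ suc) j)) ⟩
    0# * y zero * monomial (x ∘ suc) (ε j) + 1# * y (suc j)
      ≈⟨ solve 3 (λ y m z → κ (+ 0) :* y :* m :+ κ (+ 1) :* z := z) refl (y zero) (monomial (x ∘ suc) (ε j)) (y (suc j)) ⟩
    y (suc j) ∎

  module _ (x : Fin N → Carrier) where

    eval-+ : ∀ p q → eval E x (p +ₚ q) ≈ eval E x p + eval E x q
    eval-+ []      q = sym (+-identityˡ _)
    eval-+ (t ∷ p) q = trans (+-congˡ (eval-+ p q)) (sym (+-assoc _ _ _))

    eval-* : ∀ p q → eval E x (p *ₚ q) ≈ eval E x p * eval E x q
    eval-* []            q = sym (zeroˡ _)
    eval-* ((b , d) ∷ p) q = begin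
      eval E x (List.map _ q ++ p *ₚ q)                                 ≈⟨ eval-+ (List.map _ q) (p *ₚ q) ⟩
      eval E x (List.map _ q) + eval E x (p *ₚ q)                       ≈⟨ +-cong (scaled q) (eval-* p q) ⟩
      ι b * monomial x d * eval E x q + eval E x p * eval E x q         ≈⟨ distribʳ _ _ _ ⟨
      (ι b * monomial x d + eval E x p) * eval E x q                    ∎
      where
      scaled : ∀ q → eval E x (List.map (λ (c , e) → b K.* c , Vec.zipWith ℕ._+_ d e) q) ≈ ι b * monomial x d * eval E x q
      scaled []            = sym (zeroʳ _)
      scaled ((c , e) ∷ q) = begin
        ι (b K.* c) * monomial x (Vec.zipWith ℕ._+_ d e) + _   ≈⟨ +-cong (*-cong (*-homo b c) (monomial-+ x d e)) (scaled q) ⟩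
        ι b * ι c * (monomial x d * monomial x e) + ι b * monomial x d * eval E x q
          ≈⟨ solve 5 (λ b c m n v → b :* c :* (m :* n) :+ b :* m :* v := b :* m :* (c :* n :+ v)) refl _ _ _ _ _ ⟩
        ι b * monomial x d * (ι c * monomial x e + eval E x q) ∎

    module _ (y : Fin N → Carrier) {δ : K.Carrier → K.Carrier} (isDerivation : IsDerivation K δ) where

      private module δ = IsDerivation isDerivation

      -- The coefficient of ε when the polynomial with coefficients b + ε δ b is evaluated at x + ε
      -- y over the dual numbers. It regroups the expression in the differential condition term by
      -- term, a form in which the product rule goes by induction on the list.
      eval′ : Poly N → Carrier
      eval′ []            = 0#
      eval′ ((b , e) ∷ p) = ι b * monomial′ x y e + ι (δ b) * monomial x e + eval′ p

      eval′-∂ : ∀ p → sum (λ j → eval E x (∂/∂x j p) * y j) + eval E x (mapCoeff δ p) ≈ eval′ p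
      eval′-∂ [] = trans (+-identityʳ _) (sum-0 N)
        where
        sum-0 : ∀ k {f : Fin k → Carrier} → sum (λ j → 0# * f j) ≈ 0#
        sum-0 zero    = refl
        sum-0 (suc k) = trans (+-cong (zeroˡ _) (sum-0 k)) (+-identityˡ _)
      eval′-∂ ((b , e) ∷ p) = begin
        sum (λ j → eval E x (∂/∂x j ((b , e) ∷ p)) * y j) + (ι (δ b) * monomial x e + eval E x (mapCoeff δ p))
          ≈⟨ +-congʳ (trans (sum-cong-≋ head-tail) (trans
               (∑-distrib-+ {N} (λ j → ι b * (Vec.lookup e j · monomial x (Vec.updateAt e j pred) * y j)) (λ j → eval E x (∂/∂x j p) * y j))
               (+-congʳ (sym (*-distribˡ-sum {N} (ι b) (λ j → Vec.lookup e j · monomial x (Vec.updateAt e j pred) * y j)))))) ⟩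
        ι b * monomial′ x y e + sum (λ j → eval E x (∂/∂x j p) * y j) + (ι (δ b) * monomial x e + eval E x (mapCoeff δ p))
          ≈⟨ solve 4 (λ a s c m → a :+ s :+ (c :+ m) := a :+ c :+ (s :+ m)) refl _ _ _ _ ⟩
        ι b * monomial′ x y e + ι (δ b) * monomial x e + (sum (λ j → eval E x (∂/∂x j p) * y j) + eval E x (mapCoeff δ p))
          ≈⟨ +-congˡ (eval′-∂ p) ⟩
        ι b * monomial′ x y e + ι (δ b) * monomial x e + eval′ p ∎
        where
        head-tail : ∀ j → eval E x (∂/∂x j ((b , e) ∷ p)) * y j ≈
          ι b * (Vec.lookup e j · monomial x (Vec.updateAt e j pred) * y j) + eval E x (∂/∂x j p) * y j
        head-tail j = begin
          (ι (Vec.lookup e j ·ᴷ b) * m + eval E x (∂/∂x j p)) * y j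
            ≈⟨ *-congʳ (+-congʳ (*-congʳ (ι-· (Vec.lookup e j) b))) ⟩
          (Vec.lookup e j · ι b * m + eval E x (∂/∂x j p)) * y j
            ≈⟨ *-congʳ (+-congʳ (trans (×-assoc-* (Vec.lookup e j) _ _) (sym (×-comm-* (Vec.lookup e j) _ _)))) ⟩
          (ι b * (Vec.lookup e j · m) + eval E x (∂/∂x j p)) * y j
            ≈⟨ solve 4 (λ b m s y → (b :* m :+ s) :* y := b :* (m :* y) :+ s :* y) refl _ _ _ _ ⟩
          ι b * (Vec.lookup e j · m * y j) + eval E x (∂/∂x j p) * y j ∎
          where m = monomial x (Vec.updateAt e j pred)

      eval′-+ : ∀ p q → eval′ (p +ₚ q) ≈ eval′ p + eval′ q
      eval′-+ []      q = sym (+-identityˡ _)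
      eval′-+ (t ∷ p) q = trans (+-congˡ (eval′-+ p q)) (sym (+-assoc _ _ _))

      eval′-* : ∀ p q → eval′ (p *ₚ q) ≈ eval′ p * eval E x q + eval E x p * eval′ q
      eval′-* []            q = sym (trans (+-cong (zeroˡ _) (zeroˡ _)) (+-identityˡ _))
      eval′-* ((b , d) ∷ p) q = begin
        eval′ (List.map _ q ++ p *ₚ q)
          ≈⟨ eval′-+ (List.map _ q) (p *ₚ q) ⟩
        eval′ (List.map _ q) + eval′ (p *ₚ q)
          ≈⟨ +-cong (scaled q) (eval′-* p q) ⟩
        (ι b * monomial′ x y d + ι (δ b) * monomial x d) * eval E x q + ι b * monomial x d * eval′ q
          + (eval′ p * eval E x q + eval E x p * eval′ q)
          ≈⟨ solve 6 (λ t′ t v v′ s s′ → t′ :* v :+ t :* v′ :+ (s′ :* v :+ s :* v′) := (t′ :+ s′) :* v :+ (t :+ s) :* v′) refl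
               (ι b * monomial′ x y d + ι (δ b) * monomial x d) (ι b * monomial x d) (eval E x q) (eval′ q) (eval E x p) (eval′ p) ⟩
        (ι b * monomial′ x y d + ι (δ b) * monomial x d + eval′ p) * eval E x q + (ι b * monomial x d + eval E x p) * eval′ q ∎
        where
        scaled : ∀ q → eval′ (List.map (λ (c , e) → b K.* c , Vec.zipWith ℕ._+_ d e) q) ≈
          (ι b * monomial′ x y d + ι (δ b) * monomial x d) * eval E x q + ι b * monomial x d * eval′ q
        scaled []            = sym (trans (+-cong (zeroʳ _) (zeroʳ _)) (+-identityˡ _))
        scaled ((c , e) ∷ q) = begin
          ι (b K.* c) * monomial′ x y (Vec.zipWith ℕ._+_ d e) + ι (δ (b K.* c)) * monomial x (Vec.zipWith ℕ._+_ d e) + _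
            ≈⟨ +-cong (+-cong (*-cong (*-homo b c) (monomial′-+ x y d e))
                              (*-cong (trans (⟦⟧-cong (δ.leibniz b c)) (trans (+-homo _ _) (+-cong (*-homo _ _) (*-homo _ _)))) (monomial-+ x d e)))
                      (scaled q) ⟩
          ι b * ι c * (monomial′ x y d * monomial x e + monomial x d * monomial′ x y e)
            + (ι (δ b) * ι c + ι b * ι (δ c)) * (monomial x d * monomial x e)
            + ((ι b * monomial′ x y d + ι (δ b) * monomial x d) * eval E x q + ι b * monomial x d * eval′ q)
            ≈⟨ solve 10 (λ b b′ c c′ m m′ n n′ v v′ →
                 b :* c :* (m′ :* n :+ m :* n′) :+ (b′ :* c :+ b :* c′) :* (m :* n) :+ ((b :* m′ :+ b′ :* m) :* v :+ b :* m :* v′)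
                 := (b :* m′ :+ b′ :* m) :* (c :* n :+ v) :+ b :* m :* (c :* n′ :+ c′ :* n :+ v′)) refl
                 (ι b) (ι (δ b)) (ι c) (ι (δ c)) (monomial x d) (monomial′ x y d) (monomial x e) (monomial′ x y e) (eval E x q) (eval′ q) ⟩
          (ι b * monomial′ x y d + ι (δ b) * monomial x d) * (ι c * monomial x e + eval E x q)
            + ι b * monomial x d * (ι c * monomial′ x y e + ι (δ c) * monomial x e + eval′ q) ∎

    remove : Vec ℕ N → Poly N → Poly N
    remove e []            = []
    remove e ((b , d) ∷ p) = if does (Vec.≡-dec ℕ._≟_ d e) then remove e p else (b , d) ∷ remove e p

    length-remove : ∀ e p → List.length (remove e p) ≤ List.length p
    length-remove e []            = ℕ.z≤n
    length-remove e ((b , d) ∷ p) with does (Vec.≡-dec ℕ._≟_ d e)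
    ... | true  = ℕ.m≤n⇒m≤1+n (length-remove e p)
    ... | false = s≤s (length-remove e p)

    length-remove-head : ∀ e b p → List.length (remove e ((b , e) ∷ p)) ≤ List.length p
    length-remove-head e b p with Vec.≡-dec ℕ._≟_ e e
    ... | yes _   = length-remove e p
    ... | no  e≢e = contradiction ≡.refl e≢e

    coeff-remove-≡ : ∀ e p → coeff e (remove e p) K.≈ K.0#
    coeff-remove-≡ e []            = K.refl
    coeff-remove-≡ e ((b , d) ∷ p) with Vec.≡-dec ℕ._≟_ d e
    ... | yes _   = coeff-remove-≡ e p
    ... | no  d≢e with Vec.≡-dec ℕ._≟_ d e
    ...   | yes d≡e = contradiction d≡e d≢e
    ...   | no  _   = coeff-remove-≡ e p

    coeff-remove-≢ : ∀ {e e′} → e′ ≢ e → ∀ p → coeff e′ (remove e p) K.≈ coeff e′ p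
    coeff-remove-≢ e′≢e [] = K.refl
    coeff-remove-≢ {e} {e′} e′≢e ((b , d) ∷ p) with Vec.≡-dec ℕ._≟_ d e
    ... | yes ≡.refl with Vec.≡-dec ℕ._≟_ d e′
    ...   | yes ≡.refl = contradiction ≡.refl e′≢e
    ...   | no  _      = coeff-remove-≢ e′≢e p
    coeff-remove-≢ {e} {e′} e′≢e ((b , d) ∷ p) | no _ with Vec.≡-dec ℕ._≟_ d e′
    ...   | yes _ = K.+-congˡ (coeff-remove-≢ e′≢e p)
    ...   | no  _ = coeff-remove-≢ e′≢e p

    eval-remove : ∀ e p → eval E x p ≈ ι (coeff e p) * monomial x e + eval E x (remove e p)
    eval-remove e []            = sym (trans (+-identityʳ _) (trans (*-congʳ 0#-homo) (zeroˡ _)))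
    eval-remove e ((b , d) ∷ p) with Vec.≡-dec ℕ._≟_ d e
    ... | yes ≡.refl = begin
      ι b * monomial x d + eval E x p
        ≈⟨ +-congˡ (eval-remove e p) ⟩
      ι b * monomial x d + (ι (coeff e p) * monomial x e + eval E x (remove e p))
        ≈⟨ solve 4 (λ b m c v → b :* m :+ (c :* m :+ v) := (b :+ c) :* m :+ v) refl _ _ _ _ ⟩
      (ι b + ι (coeff e p)) * monomial x e + eval E x (remove e p)
        ≈⟨ +-congʳ (*-congʳ (+-homo _ _)) ⟨
      ι (b K.+ coeff e p) * monomial x e + eval E x (remove e p) ∎
    ... | no  _      = begin
      ι b * monomial x d + eval E x p
        ≈⟨ +-congˡ (eval-remove e p) ⟩
      ι b * monomial x d + (ι (coeff e p) * monomial x e + eval E x (remove e p))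
        ≈⟨ solve 3 (λ b c v → b :+ (c :+ v) := c :+ (b :+ v)) refl _ _ _ ⟩
      ι (coeff e p) * monomial x e + (ι b * monomial x d + eval E x (remove e p)) ∎

    private
      remove-≈ₚ : ∀ e p q → p ≈ₚ q → remove e p ≈ₚ remove e q
      remove-≈ₚ e p q p≈q e′ with Vec.≡-dec ℕ._≟_ e′ e
      ... | yes ≡.refl = K.trans (coeff-remove-≡ e p) (K.sym (coeff-remove-≡ e q))
      ... | no  e′≢e   = K.trans (coeff-remove-≢ e′≢e p) (K.trans (p≈q e′) (K.sym (coeff-remove-≢ e′≢e q)))

      -- Terms are unordered and exponents may repeat, so the two lists cannot be compared in step.
      -- All terms with the exponent of a head are removed from both at once; `k` bounds the joint
      -- length, which decreases.
      eval-cong′ : ∀ k p q → List.length p ℕ.+ List.length q ≤ k → p ≈ₚ q → eval E x p ≈ eval E x q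
      eval-step : ∀ k e p q → List.length (remove e p) ℕ.+ List.length (remove e q) ≤ k → p ≈ₚ q → eval E x p ≈ eval E x q

      eval-step k e p q bound p≈q = begin
        eval E x p                                           ≈⟨ eval-remove e p ⟩
        ι (coeff e p) * monomial x e + eval E x (remove e p) ≈⟨ +-cong (*-congʳ (⟦⟧-cong (p≈q e)))
                                                                  (eval-cong′ k (remove e p) (remove e q) bound (remove-≈ₚ e p q p≈q)) ⟩
        ι (coeff e q) * monomial x e + eval E x (remove e q) ≈⟨ eval-remove e q ⟨
        eval E x q                                           ∎

      eval-cong′ k       []            []            _           p≈q = refl
      eval-cong′ (suc k) ((b , e) ∷ p) q             (s≤s bound) p≈q = eval-step k e ((b , e) ∷ p) q
        (ℕ.≤-trans (ℕ.+-mono-≤ (length-remove-head e b p) (length-remove e q)) bound) p≈q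
      eval-cong′ (suc k) []            ((b , e) ∷ q) (s≤s bound) p≈q = eval-step k e [] ((b , e) ∷ q)
        (ℕ.≤-trans (length-remove-head e b q) bound) p≈q

    eval-cong : ∀ {p q} → p ≈ₚ q → eval E x p ≈ eval E x q
    eval-cong {p} {q} = eval-cong′ _ p q ℕ.≤-refl

-- Exponents and the ordering of the generators

∣+ε∣ : ∀ (σ : ℕ^ l) i → ∣ σ +ᵐ ε i ∣ ≡ suc ∣ σ ∣
∣+ε∣ (x ∷ σ) zero    = ≡.cong₂ ℕ._+_ (ℕ.+-comm x 1) (≡.cong ∣_∣ (Vec.zipWith-identityʳ ℕ.+-identityʳ σ))
∣+ε∣ (x ∷ σ) (suc i) = ≡.trans (≡.cong₂ ℕ._+_ (ℕ.+-identityʳ x) (∣+ε∣ σ i)) (ℕ.+-suc x _)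

+ε-comm : ∀ (σ : ℕ^ l) i j → σ +ᵐ ε i +ᵐ ε j ≡ σ +ᵐ ε j +ᵐ ε i
+ε-comm σ i j = ≡.trans (Vec.zipWith-assoc ℕ.+-assoc σ (ε i) (ε j))
  (≡.trans (≡.cong (σ +ᵐ_) (Vec.zipWith-comm ℕ.+-comm (ε i) (ε j)))
         (≡.sym (Vec.zipWith-assoc ℕ.+-assoc σ (ε j) (ε i))))

+ᵐ-cancelʳ : ∀ (σ τ υ : ℕ^ l) → σ +ᵐ υ ≡ τ +ᵐ υ → σ ≡ τ
+ᵐ-cancelʳ []      []      []      _ = ≡.refl
+ᵐ-cancelʳ (x ∷ σ) (y ∷ τ) (z ∷ υ) e =
  ≡.cong₂ _∷_ (ℕ.+-cancelʳ-≡ z x y (Vec.∷-injectiveˡ e)) (+ᵐ-cancelʳ σ τ υ (Vec.∷-injectiveʳ e))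

lookup-+ε-≢ : ∀ (σ : ℕ^ l) {i j} → i ≢ j → Vec.lookup (σ +ᵐ ε i) j ≡ Vec.lookup σ j
lookup-+ε-≢ {l} σ {i} {j} i≢j = ≡.trans (Vec.lookup-zipWith ℕ._+_ j σ (ε i))
  (≡.trans (≡.cong (Vec.lookup σ j ℕ.+_)
    (≡.trans (Vec.lookup∘update′ (i≢j ∘ ≡.sym) (Vec.replicate l 0) 1) (Vec.lookup-replicate j 0)))
    (ℕ.+-identityʳ _))

≤ᵐ-refl : ∀ {σ : ℕ^ l} → σ ≤ᵐ σ
≤ᵐ-refl = Pointwise.refl ℕ.≤-refl

≤ᵐ-trans : ∀ {ρ σ τ : ℕ^ l} → ρ ≤ᵐ σ → σ ≤ᵐ τ → ρ ≤ᵐ τ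
≤ᵐ-trans = Pointwise.trans ℕ.≤-trans

σ≤ᵐσ+ε : ∀ (σ : ℕ^ l) i → σ ≤ᵐ σ +ᵐ ε i
σ≤ᵐσ+ε (x ∷ σ) zero    = ℕ.m≤m+n x 1 ∷ ≡.subst (σ ≤ᵐ_) (≡.sym (Vec.zipWith-identityʳ ℕ.+-identityʳ σ)) ≤ᵐ-refl
σ≤ᵐσ+ε (x ∷ σ) (suc i) = ℕ.m≤m+n x 0 ∷ σ≤ᵐσ+ε σ i

≤ᵐ⇒∣∣≤ : ∀ {ρ σ : ℕ^ l} → ρ ≤ᵐ σ → ∣ ρ ∣ ≤ ∣ σ ∣
≤ᵐ⇒∣∣≤ []      = z≤n
≤ᵐ⇒∣∣≤ (p ∷ q) = ℕ.+-mono-≤ p (≤ᵐ⇒∣∣≤ q)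

≤ᵐ∧≢⇒< : ∀ {ρ σ : ℕ^ l} → ρ ≤ᵐ σ → ρ ≢ σ → ∃[ i ] Vec.lookup ρ i < Vec.lookup σ i
≤ᵐ∧≢⇒< []                  ρ≢σ = contradiction ≡.refl ρ≢σ
≤ᵐ∧≢⇒< (p ∷ q) ρ≢σ with ℕ.m≤n⇒m<n∨m≡n p
... | inj₁ x<y  = zero , x<y
... | inj₂ ≡.refl with ≤ᵐ∧≢⇒< q (ρ≢σ ∘ ≡.cong (_ ∷_))
...   | i , r = suc i , r

lower : ∀ {ρ σ : ℕ^ l} i → ρ ≤ᵐ σ → Vec.lookup ρ i < Vec.lookup σ i → ∃[ θ ] θ +ᵐ ε i ≡ σ × ρ ≤ᵐ θ
lower {σ = suc y ∷ σ} zero    (_ ∷ q) (s≤s x≤y) =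
  y ∷ σ , ≡.cong₂ _∷_ (ℕ.+-comm y 1) (Vec.zipWith-identityʳ ℕ.+-identityʳ σ) , x≤y ∷ q
lower {σ = y ∷ σ}     (suc i) (p ∷ q) r with lower i q r
... | θ , e , s = y ∷ θ , ≡.cong₂ _∷_ (ℕ.+-identityʳ y) e , p ∷ s

≤ᵐ∧≢⇒∣∣< : ∀ {ρ σ : ℕ^ l} → ρ ≤ᵐ σ → ρ ≢ σ → ∣ ρ ∣ < ∣ σ ∣
≤ᵐ∧≢⇒∣∣< p ρ≢σ with ≤ᵐ∧≢⇒< p ρ≢σ
... | i , r with lower i p r
...   | θ , ≡.refl , q = ≡.subst (_ <_) (≡.sym (∣+ε∣ θ i)) (s≤s (≤ᵐ⇒∣∣≤ q))

∣∣-cover : ∀ {ρ ρ′ σ : ℕ^ l} → (∀ i → Vec.lookup σ i ≤ Vec.lookup ρ i ⊎ Vec.lookup σ i ≤ Vec.lookup ρ′ i) →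
           ∣ σ ∣ ≤ ∣ ρ ∣ ℕ.+ ∣ ρ′ ∣
∣∣-cover {ρ = []}    {[]}     {[]}    _ = z≤n
∣∣-cover {ρ = x ∷ ρ} {y ∷ ρ′} {z ∷ σ} f = begin
  z ℕ.+ ∣ σ ∣                          ≤⟨ ℕ.+-mono-≤ z≤x+y (∣∣-cover {ρ = ρ} {ρ′} {σ} (f ∘ suc)) ⟩
  (x ℕ.+ y) ℕ.+ (∣ ρ ∣ ℕ.+ ∣ ρ′ ∣)     ≡⟨ interchange ℕ.+-commutativeSemigroup x y ∣ ρ ∣ ∣ ρ′ ∣ ⟩
  (x ℕ.+ ∣ ρ ∣) ℕ.+ (y ℕ.+ ∣ ρ′ ∣)     ∎
  where
  open ℕ.≤-Reasoning
  z≤x+y : z ≤ x ℕ.+ y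
  z≤x+y with f zero
  ... | inj₁ z≤x = ℕ.≤-trans z≤x (ℕ.m≤m+n x y)
  ... | inj₂ z≤y = ℕ.≤-trans z≤y (ℕ.m≤n+m y x)

lookup-≤⇒∣∣≤ : ∀ (σ τ : ℕ^ l) → (∀ i → Vec.lookup σ i ≤ Vec.lookup τ i) → ∣ σ ∣ ≤ ∣ τ ∣
lookup-≤⇒∣∣≤ []      []      _ = z≤n
lookup-≤⇒∣∣≤ (x ∷ σ) (y ∷ τ) f = ℕ.+-mono-≤ (f zero) (lookup-≤⇒∣∣≤ σ τ (f ∘ suc))

module _ {m n : ℕ} where

  raise : Fin (suc m) → Index m n → Index m n
  raise i (σ , k) = σ +ᵐ ε i , k

  ∣raise∣ : ∀ i (v : Index m n) → ∣ proj₁ (raise i v) ∣ ≡ suc ∣ proj₁ v ∣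
  ∣raise∣ i v = ∣+ε∣ (proj₁ v) i

  raise-comm : ∀ i j (v : Index m n) → raise i (raise j v) ≡ raise j (raise i v)
  raise-comm i j (σ , k) = ≡.cong (_, k) (+ε-comm σ j i)

  private
    -- A key leaves out the last entry of the exponent, which is recovered from the order in front.
    init-sum-injective : ∀ {l} (σ τ : ℕ^ (suc l)) → Vec.init σ ≡ Vec.init τ → ∣ σ ∣ ≡ ∣ τ ∣ → σ ≡ τ
    init-sum-injective {zero}  (x ∷ []) (y ∷ []) _ e =
      ≡.cong (_∷ []) (≡.trans (≡.sym (ℕ.+-identityʳ x)) (≡.trans e (ℕ.+-identityʳ y)))
    init-sum-injective {suc l} (x ∷ σ)  (y ∷ τ)  i e with Vec.∷-injective i
    ... | ≡.refl , i′ = ≡.cong (x ∷_) (init-sum-injective σ τ i′ (ℕ.+-cancelˡ-≡ x _ _ e))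

  key-injective : ∀ (v w : Index m n) → key v ≡ key w → v ≡ w
  key-injective (σ , k) (τ , h) e with Vec.∷-injective e
  ... | ∣σ∣≡∣τ∣ , e′ with Vec.∷-injective e′
  ...   | k≡h , i = ≡.cong₂ _,_ (init-sum-injective σ τ i ∣σ∣≡∣τ∣) (Fin.toℕ-injective k≡h)

  ⊲-wellFounded : WellFounded (_⊲_ {m} {n})
  ⊲-wellFounded = On.wellFounded key (Lex.<-wellFounded ≡.trans (λ { ≡.refl p → p }) ℕ.<-wellFounded)

  ⊲-trans : ∀ (u v w : Index m n) → u ⊲ v → v ⊲ w → u ⊲ w
  ⊲-trans u v w = Lex.<-trans (record { sym = ≡.sym ; trans = ≡.trans }) ((λ { ≡.refl p → p }) , (λ { ≡.refl p → p })) ℕ.<-trans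

  ⊴-⊲-trans : ∀ (u v w : Index m n) → u ⊴ v → v ⊲ w → u ⊲ w
  ⊴-⊲-trans u v w = Lex.<-transʳ (record { sym = ≡.sym ; trans = ≡.trans }) ((λ { ≡.refl p → p }) , (λ { ≡.refl p → p })) ℕ.<-trans

  ⊲⇒⊴ : ∀ (u v : Index m n) → u ⊲ v → u ⊴ v
  ⊲⇒⊴ u v = Lex.<⇒≤

  ⊴-refl : ∀ (v : Index m n) → v ⊴ v
  ⊴-refl v = Lex.≤-refl (Pointwise.refl ≡.refl)

  ⊲-irrefl : ∀ (v : Index m n) → ¬ (v ⊲ v)
  ⊲-irrefl v = Lex.<-irrefl ℕ.<-irrefl (Pointwise.refl ≡.refl)

  ⊲-cmp : ∀ (v w : Index m n) → v ⊲ w ⊎ v ≡ w ⊎ w ⊲ v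
  ⊲-cmp v w with Lex.<-cmp ≡.sym ℕ.<-cmp (key v) (key w)
  ... | tri< v⊲w _ _ = inj₁ v⊲w
  ... | tri≈ _ v≈w _ = inj₂ (inj₁ (key-injective v w (Pointwise.Pointwise-≡⇒≡ v≈w)))
  ... | tri> _ _ w⊲v = inj₂ (inj₂ w⊲v)

  ⊴⇒⊲∨≡ : ∀ (v w : Index m n) → v ⊴ w → v ⊲ w ⊎ v ≡ w
  ⊴⇒⊲∨≡ v w v⊴w with ⊲-cmp v w
  ... | inj₁ v⊲w         = inj₁ v⊲w
  ... | inj₂ (inj₁ v≡w)  = inj₂ v≡w
  ... | inj₂ (inj₂ w⊲v)  = contradiction (⊴-⊲-trans v w v v⊴w w⊲v) (⊲-irrefl v)

  ⊴∧≢⇒⊲ : ∀ (v w : Index m n) → v ⊴ w → v ≢ w → v ⊲ w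
  ⊴∧≢⇒⊲ v w v⊴w v≢w with ⊴⇒⊲∨≡ v w v⊴w
  ... | inj₁ v⊲w = v⊲w
  ... | inj₂ v≡w = contradiction v≡w v≢w

  ∣∣<⇒⊲ : ∀ (v w : Index m n) → ∣ proj₁ v ∣ < ∣ proj₁ w ∣ → v ⊲ w
  ∣∣<⇒⊲ v w p = Lex.this p ≡.refl

  ⊲⇒∣∣≤ : ∀ (v w : Index m n) → v ⊲ w → ∣ proj₁ v ∣ ≤ ∣ proj₁ w ∣
  ⊲⇒∣∣≤ v w p = ⊴⇒≤ {v = v} {w} (⊲⇒⊴ v w p)

  v⊲raise : ∀ i (v : Index m n) → v ⊲ raise i v
  v⊲raise i v = ∣∣<⇒⊲ v (raise i v) (≡.subst (_ <_) (≡.sym (∣raise∣ i v)) ℕ.≤-refl)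

  private
    lex-+ : ∀ {l} (σ τ υ : ℕ^ l) → Lex-< _≡_ _<_ σ τ → Lex-< _≡_ _<_ (σ +ᵐ υ) (τ +ᵐ υ)
    lex-+ (x ∷ σ) (y ∷ τ) (z ∷ υ) (Lex.this x<y e)  = Lex.this (ℕ.+-monoˡ-< z x<y) e
    lex-+ (x ∷ σ) (y ∷ τ) (z ∷ υ) (Lex.next ≡.refl p) = Lex.next ≡.refl (lex-+ σ τ υ p)
    lex-+ []      []      []      (Lex.base ())

    init-+ : ∀ {l} (σ τ : ℕ^ (suc l)) → Vec.init (σ +ᵐ τ) ≡ Vec.init σ +ᵐ Vec.init τ
    init-+ {zero}  (x ∷ []) (y ∷ []) = ≡.refl
    init-+ {suc l} (x ∷ σ)  (y ∷ τ)  = ≡.cong (x ℕ.+ y ∷_) (init-+ σ τ)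

    key-raise : ∀ i (v : Index m n) → key (raise i v) ≡ key v +ᵐ (1 ∷ 0 ∷ Vec.init (ε i))
    key-raise i (σ , k) = ≡.cong₂ _∷_ (≡.trans (∣+ε∣ σ i) (ℕ.+-comm 1 _))
      (≡.cong₂ _∷_ (≡.sym (ℕ.+-identityʳ _)) (init-+ σ (ε i)))

  -- On keys, raising is translation by a fixed vector, and the lexicographic order is invariant
  -- under translation.
  raise-mono : ∀ i (v w : Index m n) → v ⊲ w → raise i v ⊲ raise i w
  raise-mono i v w v⊲w = ≡.subst₂ (Lex-< _≡_ _<_) (≡.sym (key-raise i v)) (≡.sym (key-raise i w))
    (lex-+ (key v) (key w) (1 ∷ 0 ∷ Vec.init (ε i)) v⊲w)

  module _ .{{_ : NonZero n}} where

    -- Keys compare first the order, then the lower index, then the entries from the first on. So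
    -- the greatest index of order d has the last lower index and all its weight on entry 0.
    top : ℕ → Index m n
    top d = d ∷ Vec.replicate m 0 , fromℕ< {pred n} (ℕ.≤-reflexive (ℕ.suc-pred n))

    ∣top∣ : ∀ d → ∣ proj₁ (top d) ∣ ≡ d
    ∣top∣ d = ≡.trans (≡.cong (d ℕ.+_) (∣0∣ m)) (ℕ.+-identityʳ d)
      where
      ∣0∣ : ∀ l → ∣ Vec.replicate l 0 ∣ ≡ 0
      ∣0∣ zero    = ≡.refl
      ∣0∣ (suc l) = ∣0∣ l

    ⊴-top : ∀ d (v : Index m n) → ∣ proj₁ v ∣ ≤ d → v ⊴ top d
    ⊴-top d (σ , k) ∣σ∣≤d with ℕ.m≤n⇒m<n∨m≡n ∣σ∣≤d
    ... | inj₁ ∣σ∣<d = Lex.this (≡.subst (∣ σ ∣ <_) (≡.sym (∣top∣ d)) ∣σ∣<d) ≡.refl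
    ... | inj₂ ∣σ∣≡d with ℕ.m≤n⇒m<n∨m≡n k≤
      where
      k≤ : toℕ k ≤ toℕ (proj₂ (top d))
      k≤ = ≡.subst (toℕ k ≤_) (≡.sym (Fin.toℕ-fromℕ< _)) (ℕ.<⇒≤pred (Fin.toℕ<n k))
    ...   | inj₁ k< = Lex.next (≡.trans ∣σ∣≡d (≡.sym (∣top∣ d))) (Lex.this k< ≡.refl)
    ...   | inj₂ k≡ = Lex.next (≡.trans ∣σ∣≡d (≡.sym (∣top∣ d))) (Lex.next k≡ (init-≤ σ ∣σ∣≤d))
      where
      ∣∣≤0 : ∀ {l} (σ : ℕ^ l) → ∣ σ ∣ ≤ 0 → σ ≡ Vec.replicate l 0
      ∣∣≤0 []         _ = ≡.refl
      ∣∣≤0 (zero ∷ σ) p = ≡.cong (0 ∷_) (∣∣≤0 σ p)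

      init-≤ : ∀ {l} (σ : ℕ^ (suc l)) → ∣ σ ∣ ≤ d → Lex-≤ _≡_ _<_ (Vec.init σ) (Vec.init (d ∷ Vec.replicate l 0))
      init-≤ {zero}  (x ∷ []) _ = Lex.base Unit.tt
      init-≤ {suc l} (x ∷ σ)  p with ℕ.m≤n⇒m<n∨m≡n (ℕ.≤-trans (ℕ.m≤m+n x ∣ σ ∣) p)
      ... | inj₁ x<d  = Lex.this x<d ≡.refl
      ... | inj₂ ≡.refl = Lex.next ≡.refl (Lex.≤-refl (Pointwise.≡⇒Pointwise-≡ (≡.cong Vec.init (∣∣≤0 σ
        (ℕ.+-cancelˡ-≤ x ∣ σ ∣ 0 (≡.subst (x ℕ.+ ∣ σ ∣ ≤_) (≡.sym (ℕ.+-identityʳ x)) p))))))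

-- The derivations on K(a_h^ξ : |ξ| < 2r)

module FieldProperties {c ℓ} (L : Field c ℓ) where

  open Field L
  open import Relation.Binary.Reasoning.Setoid setoid

  x*y≈0⇒x≈0 : ∀ {x y} → ¬ (y ≈ 0#) → x * y ≈ 0# → x ≈ 0#
  x*y≈0⇒x≈0 {x} {y} y≉0 xy≈0 with inverse y y≉0
  ... | y⁻¹ , _ , yy⁻¹≈1 = begin
    x               ≈⟨ *-identityʳ x ⟨
    x * 1#          ≈⟨ *-congˡ yy⁻¹≈1 ⟨
    x * (y * y⁻¹)   ≈⟨ *-assoc _ _ _ ⟨
    x * y * y⁻¹     ≈⟨ *-congʳ xy≈0 ⟩
    0# * y⁻¹        ≈⟨ zeroˡ _ ⟩
    0#              ∎

  noZeroDivisors : ExcludedMiddle ℓ → ∀ {x y} → x * y ≈ 0# → x ≈ 0# ⊎ y ≈ 0#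
  noZeroDivisors em {x} {y} xy≈0 with em {y ≈ 0#}
  ... | yes y≈0 = inj₂ y≈0
  ... | no  y≉0 = inj₁ (x*y≈0⇒x≈0 y≉0 xy≈0)

module DerivationProperties {c ℓ} (K : Field c ℓ) {δ : Field.Carrier K → Field.Carrier K}
  (isDerivation : IsDerivation K δ) where

  open Field K
  open IsDerivation isDerivation renaming (cong to δ-cong)
  open IntegerSolver commutativeRing
  open import Relation.Binary.Reasoning.Setoid setoid

  δ1≈0 : δ 1# ≈ 0#
  δ1≈0 = begin
    δ 1#                           ≈⟨ solve 1 (λ x → x := x :* κ (+ 1) :+ κ (+ 1) :* x :- x) refl (δ 1#) ⟩
    δ 1# * 1# + 1# * δ 1# - δ 1#   ≈⟨ +-congʳ (trans (sym (leibniz _ _)) (δ-cong (*-identityˡ _))) ⟩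
    δ 1# - δ 1#                    ≈⟨ -‿inverseʳ _ ⟩
    0#                             ∎

  δ0≈0 : δ 0# ≈ 0#
  δ0≈0 = begin
    δ 0#                  ≈⟨ solve 1 (λ x → x := x :+ x :- x) refl (δ 0#) ⟩
    δ 0# + δ 0# - δ 0#    ≈⟨ +-congʳ (trans (sym (+-homo _ _)) (δ-cong (+-identityˡ _))) ⟩
    δ 0# - δ 0#           ≈⟨ -‿inverseʳ _ ⟩
    0#                    ∎

  δ-1≈0 : δ (- 1#) ≈ 0#
  δ-1≈0 = begin
    δ (- 1#)                  ≈⟨ solve 2 (λ x y → x := (x :+ y) :- y) refl (δ (- 1#)) (δ 1#) ⟩
    δ (- 1#) + δ 1# - δ 1#    ≈⟨ +-cong (trans (sym (+-homo _ _)) (trans (δ-cong (-‿inverseˡ _)) δ0≈0)) (-‿cong δ1≈0) ⟩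
    0# - 0#                   ≈⟨ -‿inverseʳ _ ⟩
    0#                        ∎

module FirstDerivatives {c₁ ℓ₁ c₂ ℓ₂} {m n : ℕ} (r : ℕ) .{{_ : NonZero n}} .{{_ : NonZero r}}
  (K : DifferentialField (suc m) c₁ ℓ₁) {L : Field c₂ ℓ₂}
  (E : FieldExtension (DifferentialField.underlying K) L)
  (a : Index m n → Field.Carrier L)
  (differential : DifferentialCondition r K E a)
  (i : Fin (suc m)) where

  private module K = DifferentialField K
  open Field L
  open FieldProperties L
  open FieldExtension E using (ι; 0#-homo; 1#-homo; ⟦⟧-cong; -‿homo)
  open Polynomial K.commutativeRing
  open PolynomialEvaluation E
  open IntegerSolver commutativeRing
  open RingProperties ring using (x∙y⁻¹≈ε⇒x≈y)
  open import Relation.Binary.Reasoning.Setoid setoid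

  Low : Index m n → Set
  Low (ξ , h) = ∣ ξ ∣ < 2 ℕ.* r

  -- The graph of the derivation to be, generated inside the dual numbers over L;
  -- that it is the graph of a function is the content of the differential condition.

  data Derivative : Carrier → Carrier → Set (c₁ ⊔ c₂ ⊔ ℓ₂) where
    base : ∀ b → Derivative (ι b) (ι (K.∂ i b))
    gen  : ∀ v → Low v → Derivative (a v) (a (raise i v))
    add  : ∀ {x x′ y y′} → Derivative x x′ → Derivative y y′ → Derivative (x + y) (x′ + y′)
    mul  : ∀ {x x′ y y′} → Derivative x x′ → Derivative y y′ → Derivative (x * y) (x′ * y + x * y′)
    inv  : ∀ {x x′ y} → x * y ≈ 1# → Derivative x x′ → Derivative y (- (y * y * x′))
    resp : ∀ {x x′ y y′} → x ≈ y → x′ ≈ y′ → Derivative x x′ → Derivative y y′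

  private
    -- All indices of order below 2r are `⊴` this one, so a single instance of the differential
    -- condition covers all polynomials in the low generators.
    last : Index m n
    last = top (pred (2 ℕ.* r))

    2r≢0 : NonZero (2 ℕ.* r)
    2r≢0 = ℕ.m*n≢0 2 r

    size : ℕ
    size = List.length (variables last)

    x : Fin size → Carrier
    x j = a (List.lookup (variables last) j)

    x′ : Fin size → Carrier
    x′ j = a (raise i (List.lookup (variables last) j))

    value derivative : Poly size → Carrier
    value      = eval E x
    derivative = eval′ x x′ (K.isDerivation i)

    value≈0⇒derivative≈0 : ∀ f → value f ≈ 0# → derivative f ≈ 0#
    value≈0⇒derivative≈0 f e = trans (sym (eval′-∂ x x′ (K.isDerivation i) f))
      (differential i (proj₂ last) (proj₁ last) (ℕ.≤-reflexive (≡.trans (ℕ.+-comm _ 1)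
        (≡.trans (≡.cong suc (∣top∣ {m} {n} (pred (2 ℕ.* r)))) (ℕ.suc-pred (2 ℕ.* r) {{2r≢0}})))) f e)

    constant : K.Carrier → Poly size
    constant b = (b , Vec.replicate size 0) ∷ []

    value-constant : ∀ b → value (constant b) ≈ ι b
    value-constant b = trans (+-identityʳ _) (trans (*-congˡ (monomial-0 x)) (*-identityʳ _))

    derivative-constant : ∀ b → derivative (constant b) ≈ ι (K.∂ i b)
    derivative-constant b = begin
      ι b * monomial′ x x′ (Vec.replicate size 0) + ι (K.∂ i b) * monomial x (Vec.replicate size 0) + 0#
        ≈⟨ +-congʳ (+-cong (*-congˡ (monomial′-0 x x′)) (*-congˡ (monomial-0 x))) ⟩
      ι b * 0# + ι (K.∂ i b) * 1# + 0#
        ≈⟨ solve 2 (λ b b′ → b :* κ (+ 0) :+ b′ :* κ (+ 1) :+ κ (+ 0) := b′) refl _ _ ⟩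
      ι (K.∂ i b) ∎

    variable-at : Fin size → Poly size
    variable-at j = (K.1# , ε j) ∷ []

    value-variable : ∀ j → value (variable-at j) ≈ x j
    value-variable j = begin
      ι K.1# * monomial x (ε j) + 0#  ≈⟨ +-identityʳ _ ⟩
      ι K.1# * monomial x (ε j)       ≈⟨ *-cong 1#-homo (monomial-ε x j) ⟩
      1# * x j                        ≈⟨ *-identityˡ _ ⟩
      x j                             ∎

    derivative-variable : ∀ j → derivative (variable-at j) ≈ x′ j
    derivative-variable j = begin
      ι K.1# * monomial′ x x′ (ε j) + ι (K.∂ i K.1#) * monomial x (ε j) + 0#
        ≈⟨ +-congʳ (+-cong (*-cong 1#-homo (monomial′-ε x x′ j))
             (*-congʳ (trans (⟦⟧-cong (DerivationProperties.δ1≈0 K.underlying (K.isDerivation i))) 0#-homo))) ⟩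
      1# * x′ j + 0# * monomial x (ε j) + 0#
        ≈⟨ solve 2 (λ y m → κ (+ 1) :* y :+ κ (+ 0) :* m :+ κ (+ 0) := y) refl _ _ ⟩
      x′ j ∎

    -- y = f / g and y′ = (f′ − y g′) / g.

    record Quotient (y y′ : Carrier) : Set (c₁ ⊔ ℓ₂) where
      constructor quotient
      field
        f g         : Poly size
        g≉0         : ¬ (value g ≈ 0#)
        y*g≈f       : y * value g ≈ value f
        y′*g+y*g′≈f′ : y′ * value g + y * derivative g ≈ derivative f

    polynomial : ∀ {y y′} f → y ≈ value f → y′ ≈ derivative f → Quotient y y′
    polynomial {y} {y′} f e e′ = quotient f (constant K.1#) g≉0
      (begin
        y * value (constant K.1#)   ≈⟨ *-congˡ g≈1 ⟩
        y * 1#                      ≈⟨ *-identityʳ _ ⟩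
        y                           ≈⟨ e ⟩
        value f                     ∎)
      (begin
        y′ * value (constant K.1#) + y * derivative (constant K.1#)
          ≈⟨ +-cong (*-congˡ g≈1) (*-congˡ (trans (derivative-constant K.1#)
               (trans (⟦⟧-cong (DerivationProperties.δ1≈0 K.underlying (K.isDerivation i))) 0#-homo))) ⟩
        y′ * 1# + y * 0#
          ≈⟨ solve 2 (λ y′ y → y′ :* κ (+ 1) :+ y :* κ (+ 0) := y′) refl y′ y ⟩
        y′
          ≈⟨ e′ ⟩
        derivative f ∎)
      where
      g≈1 : value (constant K.1#) ≈ 1#
      g≈1 = trans (value-constant K.1#) 1#-homo
      g≉0 : ¬ (value (constant K.1#) ≈ 0#)
      g≉0 e = 1≉0 (trans (sym g≈1) e)

    quotients : ∀ {y y′} → Derivative y y′ → Quotient y y′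
    quotients (base b) = polynomial (constant b) (sym (value-constant b)) (sym (derivative-constant b))
    quotients (gen v low) = polynomial (variable-at j)
      (trans (reflexive (≡.cong a v≡)) (sym (value-variable j)))
      (trans (reflexive (≡.cong (λ w → a (raise i w)) v≡)) (sym (derivative-variable j)))
      where
      v∈ = ∈-variables⁺ {v = v} {w = last} (⊴-top (pred (2 ℕ.* r)) v (ℕ.<⇒≤pred low))
      j = Any.index v∈
      v≡ : v ≡ List.lookup (variables last) j
      v≡ = Any.lookup-index v∈
    quotients (add {y₁} {y₁′} {y₂} {y₂′} p q) with quotients p | quotients q
    ... | quotient f g g≉0 e e′ | quotient h k k≉0 d d′ = quotient (f *ₚ k +ₚ h *ₚ g) (g *ₚ k)
      (λ gk≈0 → g≉0 (x*y≈0⇒x≈0 k≉0 (trans (sym (eval-* x g k)) gk≈0)))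
      (begin
        (y₁ + y₂) * value (g *ₚ k)
          ≈⟨ *-congˡ (eval-* x g k) ⟩
        (y₁ + y₂) * (value g * value k)
          ≈⟨ solve 4 (λ y z g k → (y :+ z) :* (g :* k) := y :* g :* k :+ z :* k :* g) refl _ _ _ _ ⟩
        y₁ * value g * value k + y₂ * value k * value g
          ≈⟨ +-cong (*-congʳ e) (*-congʳ d) ⟩
        value f * value k + value h * value g
          ≈⟨ trans (eval-+ x (f *ₚ k) (h *ₚ g)) (+-cong (eval-* x f k) (eval-* x h g)) ⟨
        value (f *ₚ k +ₚ h *ₚ g) ∎)
      (begin
        (y₁′ + y₂′) * value (g *ₚ k) + (y₁ + y₂) * derivative (g *ₚ k)
          ≈⟨ +-cong (*-congˡ (eval-* x g k)) (*-congˡ (eval′-* x x′ (K.isDerivation i) g k)) ⟩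
        (y₁′ + y₂′) * (value g * value k) + (y₁ + y₂) * (derivative g * value k + value g * derivative k)
          ≈⟨ solve 8 (λ y y′ z z′ g g′ k k′ → (y′ :+ z′) :* (g :* k) :+ (y :+ z) :* (g′ :* k :+ g :* k′)
               := (y′ :* g :+ y :* g′) :* k :+ y :* g :* k′ :+ ((z′ :* k :+ z :* k′) :* g :+ z :* k :* g′)) refl
               y₁ y₁′ y₂ y₂′ (value g) (derivative g) (value k) (derivative k) ⟩
        (y₁′ * value g + y₁ * derivative g) * value k + y₁ * value g * derivative k
          + ((y₂′ * value k + y₂ * derivative k) * value g + y₂ * value k * derivative g)
          ≈⟨ +-cong (+-cong (*-congʳ e′) (*-congʳ e)) (+-cong (*-congʳ d′) (*-congʳ d)) ⟩
        derivative f * value k + value f * derivative k + (derivative h * value g + value h * derivative g)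
          ≈⟨ trans (eval′-+ x x′ (K.isDerivation i) (f *ₚ k) (h *ₚ g))
               (+-cong (eval′-* x x′ (K.isDerivation i) f k) (eval′-* x x′ (K.isDerivation i) h g)) ⟨
        derivative (f *ₚ k +ₚ h *ₚ g) ∎)
    quotients (mul {y₁} {y₁′} {y₂} {y₂′} p q) with quotients p | quotients q
    ... | quotient f g g≉0 e e′ | quotient h k k≉0 d d′ = quotient (f *ₚ h) (g *ₚ k)
      (λ gk≈0 → g≉0 (x*y≈0⇒x≈0 k≉0 (trans (sym (eval-* x g k)) gk≈0)))
      (begin
        y₁ * y₂ * value (g *ₚ k)
          ≈⟨ *-congˡ (eval-* x g k) ⟩
        y₁ * y₂ * (value g * value k)
          ≈⟨ solve 4 (λ y z g k → y :* z :* (g :* k) := y :* g :* (z :* k)) refl _ _ _ _ ⟩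
        y₁ * value g * (y₂ * value k)
          ≈⟨ *-cong e d ⟩
        value f * value h
          ≈⟨ eval-* x f h ⟨
        value (f *ₚ h) ∎)
      (begin
        (y₁′ * y₂ + y₁ * y₂′) * value (g *ₚ k) + y₁ * y₂ * derivative (g *ₚ k)
          ≈⟨ +-cong (*-congˡ (eval-* x g k)) (*-congˡ (eval′-* x x′ (K.isDerivation i) g k)) ⟩
        (y₁′ * y₂ + y₁ * y₂′) * (value g * value k) + y₁ * y₂ * (derivative g * value k + value g * derivative k)
          ≈⟨ solve 8 (λ y y′ z z′ g g′ k k′ → (y′ :* z :+ y :* z′) :* (g :* k) :+ y :* z :* (g′ :* k :+ g :* k′)
               := (y′ :* g :+ y :* g′) :* (z :* k) :+ y :* g :* (z′ :* k :+ z :* k′)) refl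
               y₁ y₁′ y₂ y₂′ (value g) (derivative g) (value k) (derivative k) ⟩
        (y₁′ * value g + y₁ * derivative g) * (y₂ * value k) + y₁ * value g * (y₂′ * value k + y₂ * derivative k)
          ≈⟨ +-cong (*-cong e′ d) (*-cong e d′) ⟩
        derivative f * value h + value f * derivative h
          ≈⟨ eval′-* x x′ (K.isDerivation i) f h ⟨
        derivative (f *ₚ h) ∎)
    quotients (inv {z} {z′} {y} zy≈1 p) with quotients p
    ... | quotient f g g≉0 e e′ = quotient g f
      (λ f≈0 → g≉0 (x*y≈0⇒x≈0 z≉0 (trans (*-comm _ _) (trans e f≈0))))
      (begin
        y * value f          ≈⟨ *-congˡ e ⟨
        y * (z * value g)    ≈⟨ solve 3 (λ y z g → y :* (z :* g) := z :* y :* g) refl y z (value g) ⟩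
        z * y * value g      ≈⟨ *-congʳ zy≈1 ⟩
        1# * value g         ≈⟨ *-identityˡ _ ⟩
        value g              ∎)
      (begin
        - (y * y * z′) * value f + y * derivative f
          ≈⟨ +-cong (*-congˡ e) (*-congˡ e′) ⟨
        - (y * y * z′) * (z * value g) + y * (z′ * value g + z * derivative g)
          ≈⟨ solve 5 (λ y z z′ g g′ → :- (y :* y :* z′) :* (z :* g) :+ y :* (z′ :* g :+ z :* g′)
               := y :* z′ :* g :* (κ (+ 1) :- z :* y) :+ z :* y :* g′) refl y z z′ (value g) (derivative g) ⟩
        y * z′ * value g * (1# - z * y) + z * y * derivative g
          ≈⟨ +-cong (*-congˡ (+-congˡ (-‿cong zy≈1))) (*-congʳ zy≈1) ⟩
        y * z′ * value g * (1# - 1#) + 1# * derivative g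
          ≈⟨ solve 2 (λ t g′ → t :* (κ (+ 1) :- κ (+ 1)) :+ κ (+ 1) :* g′ := g′) refl (y * z′ * value g) (derivative g) ⟩
        derivative g ∎)
      where
      z≉0 : ¬ (z ≈ 0#)
      z≉0 z≈0 = 1≉0 (trans (sym zy≈1) (trans (*-congʳ z≈0) (zeroˡ y)))
    quotients (resp x≈y x′≈y′ p) with quotients p
    ... | quotient f g g≉0 e e′ = quotient f g g≉0 (trans (*-congʳ (sym x≈y)) e)
      (trans (+-cong (*-congʳ (sym x′≈y′)) (*-congʳ (sym x≈y))) e′)

  neg : ∀ {y y′} → Derivative y y′ → Derivative (- y) (- y′)
  neg {y} {y′} p = resp
    (trans (*-congʳ ι-1) (solve 1 (λ y → :- κ (+ 1) :* y := :- y) refl y))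
    (trans (+-cong (*-congʳ ι∂-1) (*-congʳ ι-1))
      (solve 2 (λ y y′ → κ (+ 0) :* y :+ :- κ (+ 1) :* y′ := :- y′) refl y y′))
    (mul (base (K.- K.1#)) p)
    where
    ι-1 : ι (K.- K.1#) ≈ - 1#
    ι-1 = trans (-‿homo _) (-‿cong 1#-homo)
    ι∂-1 : ι (K.∂ i (K.- K.1#)) ≈ 0#
    ι∂-1 = trans (⟦⟧-cong (DerivationProperties.δ-1≈0 K.underlying (K.isDerivation i))) 0#-homo

  -- With y = f/g, the numerator vanishes at the generators. The differential condition makes its
  -- derivative vanish too, and what remains of the quotient rule is y′ g = 0.
  functional-0 : ∀ {y y′} → Derivative y y′ → y ≈ 0# → y′ ≈ 0#
  functional-0 {y} {y′} p y≈0 with quotients p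
  ... | quotient f g g≉0 e e′ = x*y≈0⇒x≈0 g≉0 (begin
    y′ * value g                       ≈⟨ +-identityʳ _ ⟨
    y′ * value g + 0#                  ≈⟨ +-congˡ (trans (*-congʳ y≈0) (zeroˡ _)) ⟨
    y′ * value g + y * derivative g    ≈⟨ e′ ⟩
    derivative f                       ≈⟨ value≈0⇒derivative≈0 f (trans (sym e) (trans (*-congʳ y≈0) (zeroˡ _))) ⟩
    0#                                 ∎)

  functional : ∀ {y y′ z z′} → y ≈ z → Derivative y y′ → Derivative z z′ → y′ ≈ z′
  functional y≈z p q = x∙y⁻¹≈ε⇒x≈y _ _
    (functional-0 (add p (neg q)) (trans (+-congʳ y≈z) (-‿inverseʳ _)))

  open Adjoined r K E a Low using (Generated)

  -- The derivative is read off the proof of membership; by `functional` it depends on the element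
  -- alone.
  total : ∀ {y} → Generated y → ∃[ y′ ] Derivative y y′
  total (Adjoin.base b)          = _ , base b
  total (Adjoin.gen (v , low))   = _ , gen v low
  total (Adjoin.add p q)         = _ , add (proj₂ (total p)) (proj₂ (total q))
  total (Adjoin.mul p q)         = _ , mul (proj₂ (total p)) (proj₂ (total q))
  total (Adjoin.neg p)           = _ , neg (proj₂ (total p))
  total (Adjoin.inv xy≈1 p)      = _ , inv xy≈1 (proj₂ (total p))
  total (Adjoin.resp x≈y p)      = _ , resp x≈y refl (proj₂ (total p))

-- Derivations and separable elements

module Intermediate {c₁ ℓ₁ c₂ ℓ₂} {K : Field c₁ ℓ₁} {L : Field c₂ ℓ₂} (E : FieldExtension K L)
  {J : Set} (a : J → Field.Carrier L) where

  private
    module L = Field L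
    module E = FieldExtension E

  module Sub (P : J → Set) = Adjoin E {I = Σ J P} (λ j → a (proj₁ j))

  weaken : ∀ {P Q : J → Set} → (∀ j → P j → Q j) → ∀ {y} → Sub.Generated P y → Sub.Generated Q y
  weaken f (Adjoin.base b)      = Adjoin.base b
  weaken f (Adjoin.gen (j , p)) = Adjoin.gen (j , f j p)
  weaken f (Adjoin.add p q)     = Adjoin.add (weaken f p) (weaken f q)
  weaken f (Adjoin.mul p q)     = Adjoin.mul (weaken f p) (weaken f q)
  weaken f (Adjoin.neg p)       = Adjoin.neg (weaken f p)
  weaken f (Adjoin.inv e p)     = Adjoin.inv e (weaken f p)
  weaken f (Adjoin.resp e p)    = Adjoin.resp e (weaken f p)

  module Inclusion {P Q : J → Set} (P⊆Q : ∀ j → P j → Q j) where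

    private
      module P = Field (Sub.subfield P)
      module Q = Field (Sub.subfield Q)
    open Exp Q.semiring using (_^_)
    open SemiringMult Q.semiring using (×-comm-*; ×-assoc-*) renaming (_×_ to _·_)
    open Exp L.semiring using () renaming (_^_ to _^ᴸ_)
    open Polynomial P.commutativeRing

    inclusion : FieldExtension (Sub.subfield P) (Sub.subfield Q)
    inclusion = record
      { ι = λ (y , p) → y , weaken P⊆Q p
      ; isRingMonomorphism = record
        { isRingHomomorphism = record
          { isSemiringHomomorphism = record
            { isNearSemiringHomomorphism = record
              { +-isMonoidHomomorphism = record
                { isMagmaHomomorphism = record
                  { isRelHomomorphism = record { cong = λ e → e }
                  ; homo              = λ _ _ → L.refl
                  }
                ; ε-homo = L.refl
                }
              ; *-homo = λ _ _ → L.refl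
              }
            ; 1#-homo = L.refl
            }
          ; -‿homo = λ _ → L.refl
          }
        ; injective = λ e → e
        }
      }

    open FieldExtension inclusion using (ι)

    private
      proj₁-^ : ∀ (x : Q.Carrier) e → proj₁ (x ^ e) L.≈ proj₁ x ^ᴸ e
      proj₁-^ x zero    = L.refl
      proj₁-^ x (suc e) = L.*-congˡ (proj₁-^ x e)

      proj₁-eval : ∀ (x : Q.Carrier) (p : Poly 1) →
        proj₁ (eval inclusion (λ _ → x) p) L.≈ eval (Sub.subfield⊆L P) (λ _ → proj₁ x) p
      proj₁-eval x []                   = L.refl
      proj₁-eval x ((b , e ∷ []) ∷ p) = L.+-cong (L.*-congˡ (L.*-congʳ (proj₁-^ x e))) (proj₁-eval x p)

      -- At a root of p the first summand of the Bezout identity drops out, so v(x) is the inverse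
      -- of p′(x).
      bezout-value : ∀ (x : Q.Carrier) (p u v : Poly 1) → Vanishes (Sub.subfield⊆L P) (proj₁ x) p →
        u *ₚ p +ₚ v *ₚ ∂/∂x Fin.zero p ≈ₚ 1ₚ →
        eval inclusion (λ _ → x) v Q.* eval inclusion (λ _ → x) (∂/∂x Fin.zero p) Q.≈ Q.1#
      bezout-value x p u v vanishes bezout = begin
        proj₁ (value v) L.* proj₁ (value p′)
          ≈⟨ L.+-identityˡ _ ⟨
        L.0# L.+ proj₁ (value v) L.* proj₁ (value p′)
          ≈⟨ L.+-congʳ (L.trans (L.*-congˡ (L.trans (proj₁-eval x p) vanishes)) (L.zeroʳ _)) ⟨
        proj₁ (value u) L.* proj₁ (value p) L.+ proj₁ (value v) L.* proj₁ (value p′)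
          ≈⟨ L.+-cong (eval-* (λ _ → x) u p) (eval-* (λ _ → x) v p′) ⟨
        proj₁ (value (u *ₚ p)) L.+ proj₁ (value (v *ₚ p′))
          ≈⟨ eval-+ (λ _ → x) (u *ₚ p) (v *ₚ p′) ⟨
        proj₁ (value (u *ₚ p +ₚ v *ₚ p′))
          ≈⟨ eval-cong (λ _ → x) {u *ₚ p +ₚ v *ₚ p′} {1ₚ} bezout ⟩
        L.1# L.* (L.1# L.* L.1#) L.+ L.0#
          ≈⟨ L.trans (L.+-identityʳ _) (L.trans (L.*-identityˡ _) (L.*-identityˡ _)) ⟩
        L.1# ∎
        where
        open import Relation.Binary.Reasoning.Setoid L.setoid
        open PolynomialEvaluation inclusion using (eval-+; eval-*; eval-cong)
        value : Poly 1 → Q.Carrier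
        value = eval inclusion (λ _ → x)
        p′ = ∂/∂x Fin.zero p

    -- One setting for two applications: `d` is a derivation along `θ` and `S` a submodule. Taking
    -- `δ` and `Span` shows that derivatives of leaders are linear in earlier generators; taking the
    -- commutator of two derivations and the zero submodule shows that they commute on separable
    -- elements.
    module _ {b ℓᵇ q} (B : CommutativeRing b ℓᵇ)
      (θ : Field.Carrier (Sub.subfield Q) → CommutativeRing.Carrier B)
      (θ-hom : IsRingHomomorphism (Field.rawRing (Sub.subfield Q)) (CommutativeRing.rawRing B) θ)
      (d : Field.Carrier (Sub.subfield Q) → CommutativeRing.Carrier B)
      (S : CommutativeRing.Carrier B → Set q) where

      private module B = CommutativeRing B

      record IsDerivationAlong : Set (b ⊔ ℓᵇ ⊔ c₁ ⊔ c₂ ⊔ ℓ₂) where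
        field
          d-cong : ∀ {x y} → x Q.≈ y → d x B.≈ d y
          d-+    : ∀ x y → d (x Q.+ y) B.≈ d x B.+ d y
          d-*    : ∀ x y → d (x Q.* y) B.≈ d x B.* θ y B.+ θ x B.* d y

      record IsSubmodule : Set (b ⊔ ℓᵇ ⊔ q ⊔ c₁ ⊔ c₂ ⊔ ℓ₂) where
        field
          S-resp  : ∀ {x y} → x B.≈ y → S x → S y
          S-+     : ∀ {x y} → S x → S y → S (x B.+ y)
          S-scale : ∀ t {x} → S x → S (θ t B.* x)
          S-0     : S B.0#

      module _ (isDerivation : IsDerivationAlong) (isSubmodule : IsSubmodule) where

        open IsDerivationAlong isDerivation
        open IsSubmodule isSubmodule
        open IsRingHomomorphism θ-hom
          using (+-homo; *-homo; 1#-homo; 0#-homo; -‿homo) renaming (⟦⟧-cong to θ-cong)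
        open IntegerSolver B
        open import Relation.Binary.Reasoning.Setoid B.setoid

        private
          d1≈0 : d Q.1# B.≈ B.0#
          d1≈0 = begin
            d Q.1#
              ≈⟨ solve 1 (λ x → x := x :* κ (+ 1) :+ κ (+ 1) :* x :- x) B.refl (d Q.1#) ⟩
            d Q.1# B.* B.1# B.+ B.1# B.* d Q.1# B.- d Q.1#
              ≈⟨ B.+-congʳ (B.+-cong (B.*-congˡ 1#-homo) (B.*-congʳ 1#-homo)) ⟨
            d Q.1# B.* θ Q.1# B.+ θ Q.1# B.* d Q.1# B.- d Q.1#
              ≈⟨ B.+-congʳ (B.trans (B.sym (d-* _ _)) (d-cong (L.*-identityˡ _))) ⟩
            d Q.1# B.- d Q.1#
              ≈⟨ B.-‿inverseʳ _ ⟩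
            B.0# ∎

          d0≈0 : d Q.0# B.≈ B.0#
          d0≈0 = begin
            d Q.0#                       ≈⟨ solve 1 (λ x → x := x :+ x :- x) B.refl (d Q.0#) ⟩
            d Q.0# B.+ d Q.0# B.- d Q.0# ≈⟨ B.+-congʳ (B.trans (B.sym (d-+ _ _)) (d-cong (L.+-identityˡ _))) ⟩
            d Q.0# B.- d Q.0#            ≈⟨ B.-‿inverseʳ _ ⟩
            B.0#                         ∎

          S-neg : ∀ {x} → S x → S (B.- x)
          S-neg {x} s = S-resp (B.trans (B.*-congʳ (B.trans (-‿homo _) (B.-‿cong 1#-homo)))
            (solve 1 (λ x → :- κ (+ 1) :* x := :- x) B.refl x)) (S-scale (Q.- Q.1#) s)

          d-neg : ∀ x → d (Q.- x) B.≈ B.- d x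
          d-neg x = begin
            d (Q.- x)                  ≈⟨ solve 2 (λ x y → x := (x :+ y) :- y) B.refl (d (Q.- x)) (d x) ⟩
            d (Q.- x) B.+ d x B.- d x  ≈⟨ B.+-congʳ (B.trans (B.sym (d-+ _ _)) (B.trans (d-cong (L.-‿inverseˡ _)) d0≈0)) ⟩
            B.0# B.- d x               ≈⟨ B.+-identityˡ _ ⟩
            B.- d x                    ∎

          d-inv : ∀ {x y} → x Q.* y Q.≈ Q.1# → d y B.≈ B.- (θ (y Q.* y) B.* d x)
          d-inv {x} {y} xy≈1 = begin
            d y
              ≈⟨ solve 1 (λ z → z := κ (+ 1) :* z) B.refl (d y) ⟩
            B.1# B.* d y
              ≈⟨ B.*-congʳ (B.trans (B.sym (*-homo x y)) (B.trans (θ-cong xy≈1) 1#-homo)) ⟨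
            θ x B.* θ y B.* d y
              ≈⟨ solve 4 (λ x y x′ y′ → x :* y :* y′ := y :* (x′ :* y :+ x :* y′) :- y :* y :* x′) B.refl (θ x) (θ y) (d x) (d y) ⟩
            θ y B.* (d x B.* θ y B.+ θ x B.* d y) B.- θ y B.* θ y B.* d x
              ≈⟨ B.+-cong (B.*-congˡ (B.trans (B.sym (d-* x y)) (B.trans (d-cong xy≈1) d1≈0))) (B.-‿cong (B.*-congʳ (B.sym (*-homo y y)))) ⟩
            θ y B.* B.0# B.- θ (y Q.* y) B.* d x
              ≈⟨ solve 2 (λ y z → y :* κ (+ 0) :- z := :- z) B.refl (θ y) (θ (y Q.* y) B.* d x) ⟩
            B.- (θ (y Q.* y) B.* d x) ∎

        subfield-into : (∀ b → S (d (E.ι b , Adjoin.base b))) → (∀ j p → S (d (a j , Adjoin.gen (j , P⊆Q j p)))) →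
                        ∀ {y} (p : Sub.Generated P y) → S (d (y , weaken P⊆Q p))
        subfield-into onK onGen = go
          where
          go : ∀ {y} (p : Sub.Generated P y) → S (d (y , weaken P⊆Q p))
          go (Adjoin.base b)        = onK b
          go (Adjoin.gen (j , p))   = onGen j p
          go (Adjoin.add p q)       = S-resp (B.sym (d-+ _ _)) (S-+ (go p) (go q))
          go (Adjoin.mul p q)       = S-resp (B.sym (B.trans (d-* _ _) (B.+-congʳ (B.*-comm _ _))))
                                        (S-+ (S-scale _ (go p)) (S-scale _ (go q)))
          go (Adjoin.neg p)         = S-resp (B.sym (d-neg _)) (S-neg (go p))
          go (Adjoin.inv xy≈1 p)    = S-resp (B.sym (d-inv {_ , weaken P⊆Q p} {_ , Adjoin.inv xy≈1 (weaken P⊆Q p)} xy≈1))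
                                        (S-neg (S-scale _ (go p)))
          go (Adjoin.resp x≈y p)    = S-resp (d-cong x≈y) (go p)

        module _ (onP : ∀ y → S (d (ι y))) where

          private
            d-^ : ∀ x e → d (x ^ e) B.≈ θ (e · x ^ pred e) B.* d x
            d-^ x zero    = B.trans d1≈0 (B.sym (B.trans (B.*-congʳ 0#-homo) (B.zeroˡ _)))
            d-^ x (suc e) = begin
              d (x Q.* x ^ e)
                ≈⟨ d-* x (x ^ e) ⟩
              d x B.* θ (x ^ e) B.+ θ x B.* d (x ^ e)
                ≈⟨ B.+-congˡ (B.*-congˡ (d-^ x e)) ⟩
              d x B.* θ (x ^ e) B.+ θ x B.* (θ (e · x ^ pred e) B.* d x)
                ≈⟨ solve 4 (λ x′ p x q → x′ :* p :+ x :* (q :* x′) := (p :+ x :* q) :* x′) B.refl _ _ _ _ ⟩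
              (θ (x ^ e) B.+ θ x B.* θ (e · x ^ pred e)) B.* d x
                ≈⟨ B.*-congʳ (B.+-congˡ (B.trans (B.sym (*-homo _ _)) (θ-cong (x*e·x^ e)))) ⟩
              (θ (x ^ e) B.+ θ (e · x ^ e)) B.* d x
                ≈⟨ B.*-congʳ (B.sym (+-homo _ _)) ⟩
              θ (suc e · x ^ e) B.* d x ∎
              where
              x*e·x^ : ∀ e → x Q.* (e · x ^ pred e) Q.≈ e · x ^ e
              x*e·x^ zero    = L.zeroʳ _
              x*e·x^ (suc e) = ×-comm-* (suc e) x (x ^ e)

            -- The chain rule: s is p with `d` applied to its coefficients, evaluated at x. It lies
            -- in `S` because `d` maps the coefficient field there.
            d-eval : ∀ x (p : Poly 1) → ∃[ s ] S s ×
              d (eval inclusion (λ _ → x) p) B.≈ θ (eval inclusion (λ _ → x) (∂/∂x Fin.zero p)) B.* d x B.+ s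
            d-eval x [] = B.0# , S-0 , B.trans d0≈0 (B.sym (B.trans (B.+-identityʳ _) (B.trans (B.*-congʳ 0#-homo) (B.zeroˡ _))))
            d-eval x ((b , e ∷ []) ∷ p) with d-eval x p
            ... | s , Ss , eq = _ , S-+ (S-scale (x ^ e) (onP b)) Ss , (begin
              d (ι b Q.* (x ^ e Q.* Q.1#) Q.+ eval inclusion (λ _ → x) p)
                ≈⟨ B.trans (d-+ _ _) (B.+-cong (B.trans (d-cong (L.*-congˡ (L.*-identityʳ _))) (d-* (ι b) (x ^ e))) eq) ⟩
              d (ι b) B.* θ (x ^ e) B.+ θ (ι b) B.* d (x ^ e) B.+ (θ p′ B.* d x B.+ s)
                ≈⟨ B.+-congʳ (B.+-congˡ (B.*-congˡ (d-^ x e))) ⟩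
              d (ι b) B.* θ (x ^ e) B.+ θ (ι b) B.* (θ (e · x ^ pred e) B.* d x) B.+ (θ p′ B.* d x B.+ s)
                ≈⟨ solve 7 (λ b′ m b m′ x′ p′ s → b′ :* m :+ b :* (m′ :* x′) :+ (p′ :* x′ :+ s)
                     := (b :* m′ :+ p′) :* x′ :+ (m :* b′ :+ s)) B.refl _ _ _ _ _ _ _ ⟩
              (θ (ι b) B.* θ (e · x ^ pred e) B.+ θ p′) B.* d x B.+ (θ (x ^ e) B.* d (ι b) B.+ s)
                ≈⟨ B.+-congʳ (B.*-congʳ (B.trans (B.+-congʳ (B.trans (B.sym (*-homo _ _)) (θ-cong (coefficient e)))) (B.sym (+-homo _ _)))) ⟩
              θ (ι (e ·ᴾ b) Q.* (x ^ pred e Q.* Q.1#) Q.+ p′) B.* d x B.+ (θ (x ^ e) B.* d (ι b) B.+ s) ∎)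
              where
              open SemiringMult P.semiring using () renaming (_×_ to _·ᴾ_)
              p′ = eval inclusion (λ _ → x) (∂/∂x Fin.zero p)
              coefficient : ∀ e → ι b Q.* (e · x ^ pred e) Q.≈ ι (e ·ᴾ b) Q.* (x ^ pred e Q.* Q.1#)
              coefficient e = L.trans (×-comm-* e (ι b) (x ^ pred e)) (L.trans (L.sym (×-assoc-* e (ι b) (x ^ pred e)))
                (L.*-cong (L.sym (PolynomialEvaluation.ι-· inclusion e b)) (L.sym (L.*-identityʳ _))))

          -- Differentiating p(x) = 0 gives p′(x) dx + s = 0 with s in `S`. As v(x) inverts p′(x),
          -- this is solved by dx = -v(x) s.
          separable-into : ∀ x → SeparablyAlgebraic (Sub.subfield⊆L P) (proj₁ x) → S (d x)
          separable-into x (p , (_ , _ , vanishes , _) , u , v , bezout) =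
            let s , Ss , eq = d-eval x p in S-resp (dx≈ s eq) (S-neg (S-scale (value v) Ss))
            where
            value : Poly 1 → Q.Carrier
            value = eval inclusion (λ _ → x)
            p′ = ∂/∂x Fin.zero p

            vp′≈1 : value v Q.* value p′ Q.≈ Q.1#
            vp′≈1 = bezout-value x p u v vanishes bezout

            dx≈ : ∀ s → d (value p) B.≈ θ (value p′) B.* d x B.+ s → B.- (θ (value v) B.* s) B.≈ d x
            dx≈ s eq = begin
              B.- (θ (value v) B.* s)
                ≈⟨ solve 4 (λ v s p′ x′ → :- (v :* s) := v :* p′ :* x′ :- v :* (p′ :* x′ :+ s)) B.refl (θ (value v)) s (θ (value p′)) (d x) ⟩
              θ (value v) B.* θ (value p′) B.* d x B.- θ (value v) B.* (θ (value p′) B.* d x B.+ s)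
                ≈⟨ B.+-cong (B.*-congʳ (B.trans (B.sym (*-homo _ _)) (B.trans (θ-cong vp′≈1) 1#-homo)))
                     (B.-‿cong (B.*-congˡ (B.trans (B.sym eq) (B.trans (d-cong (L.trans (proj₁-eval x p) vanishes)) d0≈0)))) ⟩
              B.1# B.* d x B.- θ (value v) B.* B.0#
                ≈⟨ solve 2 (λ x v → κ (+ 1) :* x :- v :* κ (+ 0) := x) B.refl (d x) (θ (value v)) ⟩
              d x ∎

-- Leaders

module Rational {c₁ ℓ₁ c₂ ℓ₂} {K : Field c₁ ℓ₁} {L : Field c₂ ℓ₂} (E : FieldExtension K L) where

  private module K = Field K
  open Field L hiding (zero)
  open FieldExtension E
  open Polynomial K.commutativeRing
  open PolynomialEvaluation E using (eval-cong)
  open IntegerSolver commutativeRing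
  private module KS = IntegerSolver K.commutativeRing
  open import Relation.Binary.Reasoning.Setoid setoid

  -- The minimal polynomial is x - b. Its derivative is 1, so the Bezout coefficients are 0 and 1.
  -- No degree below 1 is possible, since a monic polynomial of degree 0 equals 1 and has no root.
  rational⇒separable : ∀ b → SeparablyAlgebraic E (ι b)
  rational⇒separable b =
    x-b , (1 , (monic , λ { (suc (suc e)) _ → K.refl ; 1 (s≤s ()) }) , vanishes , minimal) , [] , 1ₚ , bezout
    where
    x-b : Poly 1
    x-b = (K.1# , 1 ∷ []) ∷ (K.- b , 0 ∷ []) ∷ []

    monic : coeff (1 ∷ []) x-b K.≈ K.1#
    monic = K.+-identityʳ _

    vanishes : Vanishes E (ι b) x-b
    vanishes = begin
      ι K.1# * (ι b * 1# * 1#) + (ι (K.- b) * (1# * 1#) + 0#)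
        ≈⟨ +-cong (*-congʳ 1#-homo) (+-congʳ (*-congʳ (-‿homo b))) ⟩
      1# * (ι b * 1# * 1#) + (- ι b * (1# * 1#) + 0#)
        ≈⟨ solve 1 (λ x → κ (+ 1) :* (x :* κ (+ 1) :* κ (+ 1)) :+ (:- x :* (κ (+ 1) :* κ (+ 1)) :+ κ (+ 0)) := κ (+ 0)) refl (ι b) ⟩
      0# ∎

    minimal : ∀ q e → MonicOfDegree E e q → Vanishes E (ι b) q → 1 ≤ e
    minimal q (suc e) _                q≈0 = s≤s z≤n
    minimal q zero    (leading , rest) q≈0 = contradiction (begin
      1#                                 ≈⟨ solve 0 (κ (+ 1) := κ (+ 1) :* (κ (+ 1) :* κ (+ 1)) :+ κ (+ 0)) refl ⟩
      1# * (1# * 1#) + 0#                ≈⟨ +-congʳ (*-congʳ 1#-homo) ⟨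
      ι K.1# * (1# * 1#) + 0#            ≈⟨ eval-cong (λ _ → ι b) {q} {1ₚ} q≈1 ⟨
      eval E (λ _ → ι b) q               ≈⟨ q≈0 ⟩
      0#                                 ∎) 1≉0
      where
      q≈1 : q ≈ₚ 1ₚ
      q≈1 (zero ∷ [])  = K.trans leading (K.sym (K.+-identityʳ _))
      q≈1 (suc e ∷ []) = rest (suc e) (s≤s z≤n)

    bezout : [] *ₚ x-b +ₚ 1ₚ *ₚ ∂/∂x zero x-b ≈ₚ 1ₚ
    bezout (zero ∷ [])  = KS.solve 0
      (KS.κ (+ 1) KS.:* (KS.κ (+ 1) KS.:+ KS.κ (+ 0)) KS.:+ (KS.κ (+ 1) KS.:* KS.κ (+ 0) KS.:+ KS.κ (+ 0))
        KS.:= KS.κ (+ 1) KS.:+ KS.κ (+ 0)) K.refl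
    bezout (suc e ∷ []) = K.refl

module Leaders {c₁ ℓ₁ c₂ ℓ₂} (em : ∀ a → ExcludedMiddle a) {m n : ℕ} (r : ℕ) .{{_ : NonZero n}} .{{_ : NonZero r}}
  (K : DifferentialField (suc m) c₁ ℓ₁) {L : Field c₂ ℓ₂}
  (E : FieldExtension (DifferentialField.underlying K) L)
  (a : Index m n → Field.Carrier L)
  (differential : DifferentialCondition r K E a) where

  private
    module K = DifferentialField K
    module L = Field L
    module E = FieldExtension E
  open L using (_≈_; _+_; _*_)
  open Intermediate E a
  open Adjoin using (base; gen; add; mul; resp)

  module First = FirstDerivatives r K E a differential

  Low : Index m n → Set
  Low (ξ , h) = ∣ ξ ∣ < 2 ℕ.* r

  LowBelow : Index m n → Index m n → Set
  LowBelow v w = w ⊲ v × Low w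

  δ : Fin (suc m) → Field.Carrier (Sub.subfield Low) → L.Carrier
  δ i (y , p) = proj₁ (First.total i p)

  δ-cong : ∀ i {x y} → proj₁ x ≈ proj₁ y → δ i x ≈ δ i y
  δ-cong i {x} {y} e = First.functional i e (proj₂ (First.total i (proj₂ x))) (proj₂ (First.total i (proj₂ y)))

  proj₁-hom : ∀ P → IsRingHomomorphism (Field.rawRing (Sub.subfield P)) L.rawRing proj₁
  proj₁-hom P = IsRingMonomorphism.isRingHomomorphism (FieldExtension.isRingMonomorphism (Sub.subfield⊆L P))

  -- If v has order below 2r, no `generator` is available and this is just the field generated by
  -- what precedes v. From order 2r on the coefficients range over all of F. Covering both cases at
  -- once lets `SeparableLeader⇒Span-raise` treat every low leader alike.
  data Span (v : Index m n) : L.Carrier → Set (c₁ ⊔ c₂ ⊔ ℓ₂) where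
    coefficient : ∀ {x} → Sub.Generated (LowBelow v) x → Span v x
    generator   : ∀ u → ∣ proj₁ u ∣ ≡ 2 ℕ.* r → u ⊲ v → Span v (a u)
    sum         : ∀ {x y} → Span v x → Span v y → Span v (x + y)
    scale       : ∀ {t x} → Sub.Generated (LowBelow v) t → Span v x → Span v (t * x)
    respect     : ∀ {x y} → x ≈ y → Span v x → Span v y

  Span⇒Generated : ∀ {v x} → Span v x → Sub.Generated (_⊲ v) x
  Span⇒Generated (coefficient p)   = weaken (λ _ → proj₁) p
  Span⇒Generated (generator u _ p) = gen (u , p)
  Span⇒Generated (sum s t)         = add (Span⇒Generated s) (Span⇒Generated t)
  Span⇒Generated (scale t s)       = mul (weaken (λ _ → proj₁) t) (Span⇒Generated s)
  Span⇒Generated (respect e s)     = resp e (Span⇒Generated s)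

  Span⇒SeparableLeader : ∀ v → ∣ proj₁ v ∣ ≤ 2 ℕ.* r → Span v (a v) → SeparableLeader r K E a v
  Span⇒SeparableLeader v v≤2r s =
    v≤2r , Rational.rational⇒separable (Sub.subfield⊆L (_⊲ v)) (a v , Span⇒Generated s)

  module _ (i : Fin (suc m)) where

    module _ {Q : Index m n → Set} (Q⊆Low : ∀ v → Q v → Low v) {v} {P : Index m n → Set} (P⊆Q : ∀ v → P v → Q v)
      (Q⊆LowBelow : ∀ w → Q w → LowBelow v w) where

      open Inclusion P⊆Q

      private
        δQ : Field.Carrier (Sub.subfield Q) → L.Carrier
        δQ (y , p) = δ i (y , weaken Q⊆Low p)

      δ-isDerivationAlong : IsDerivationAlong L.commutativeRing proj₁ (proj₁-hom Q) δQ (Span v)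
      δ-isDerivationAlong = record
        { d-cong = λ {x} {y} e → δ-cong i {_ , weaken Q⊆Low (proj₂ x)} {_ , weaken Q⊆Low (proj₂ y)} e
        ; d-+    = λ _ _ → L.refl
        ; d-*    = λ _ _ → L.refl
        }

      Span-isSubmodule : IsSubmodule L.commutativeRing proj₁ (proj₁-hom Q) δQ (Span v)
      Span-isSubmodule = record
        { S-resp  = respect
        ; S-+     = sum
        ; S-scale = λ (t , p) → scale (weaken Q⊆LowBelow p)
        ; S-0     = respect E.0#-homo (coefficient (base K.0#))
        }

      δ-into-Span : (∀ w → P w → raise i w ⊲ v) → ∀ {y} (p : Sub.Generated P y) → Span v (δQ (y , weaken P⊆Q p))
      δ-into-Span raise⊲ = subfield-into L.commutativeRing proj₁ (proj₁-hom Q) δQ (Span v)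
        δ-isDerivationAlong Span-isSubmodule (λ b → coefficient (base (K.∂ i b))) onGenerators
        where
        onGenerators : ∀ w → P w → Span v (a (raise i w))
        onGenerators w p with ℕ.m≤n⇒m<n∨m≡n (Q⊆Low w (P⊆Q w p))
        ... | inj₁ low = coefficient (gen (raise i w , raise⊲ w p , ≡.subst (_< 2 ℕ.* r) (≡.sym (∣raise∣ i w)) low))
        ... | inj₂ eq  = generator (raise i w) (≡.trans (∣raise∣ i w) eq) (raise⊲ w p)

    -- Differentiating the separable equation of `a v` solves for `a (raise i v)` affinely in the
    -- derivatives of the coefficients. These are affine in generators at `raise i w` with w ⊲ v,
    -- which precede `raise i v` by `raise-mono`.
    SeparableLeader⇒Span-raise : ∀ v → Low v → SeparableLeader r K E a v → Span (raise i v) (a (raise i v))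
    SeparableLeader⇒Span-raise v low (_ , separable) =
      separable-into L.commutativeRing proj₁ (proj₁-hom (LowBelow (raise i v))) _ (Span (raise i v))
        (δ-isDerivationAlong (λ _ → proj₂) P⊆Q (λ _ p → p)) (Span-isSubmodule (λ _ → proj₂) P⊆Q (λ _ p → p))
        (λ (y , p) → δ-into-Span (λ _ → proj₂) P⊆Q (λ _ p → p) (λ w → raise-mono i w v) p)
        (a v , gen (v , v⊲raise i v , low)) separable
      where
      P⊆Q : ∀ w → w ⊲ v → LowBelow (raise i v) w
      P⊆Q w w⊲v = ⊲-trans w v (raise i v) w⊲v (v⊲raise i v) , ℕ.≤-<-trans (⊲⇒∣∣≤ w v w⊲v) low
      open Inclusion P⊆Q

  -- At order 2r only linear dependence on earlier generators counts: other algebraic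
  -- relations there say nothing about derivatives within reach, and are forgotten.

  data Lead (v : Index m n) : Set (c₁ ⊔ c₂ ⊔ ℓ₂) where
    low-lead : Low v → SeparableLeader r K E a v → Lead v
    top-lead : ∣ proj₁ v ∣ ≡ 2 ℕ.* r → Span v (a v) → Lead v

  Lead⇒∣∣≤2r : ∀ {v} → Lead v → ∣ proj₁ v ∣ ≤ 2 ℕ.* r
  Lead⇒∣∣≤2r (low-lead low _) = ℕ.<⇒≤ low
  Lead⇒∣∣≤2r (top-lead eq _)  = ℕ.≤-reflexive eq

  Lead⇒SeparableLeader : ∀ {v} → Lead v → SeparableLeader r K E a v
  Lead⇒SeparableLeader     (low-lead _ s)  = s
  Lead⇒SeparableLeader {v} (top-lead eq s) = Span⇒SeparableLeader v (ℕ.≤-reflexive eq) s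

  -- The relation obtained by differentiation is linear, hence good enough even for the stricter
  -- notion of leader at order 2r.
  Lead-raise : ∀ i v → Low v → Lead v → Lead (raise i v)
  Lead-raise i v low lead with ℕ.m≤n⇒m<n∨m≡n low
  ... | inj₁ low′ = low-lead raise-low (Span⇒SeparableLeader (raise i v) (ℕ.<⇒≤ raise-low) span)
    where
    raise-low = ≡.subst (_< 2 ℕ.* r) (≡.sym (∣raise∣ i v)) low′
    span = SeparableLeader⇒Span-raise i v low (Lead⇒SeparableLeader lead)
  ... | inj₂ eq = top-lead (≡.trans (∣raise∣ i v) eq) (SeparableLeader⇒Span-raise i v low (Lead⇒SeparableLeader lead))

  record Above (v : Index m n) : Set (c₁ ⊔ c₂ ⊔ ℓ₂) where
    constructor above-by
    field
      ρ    : ℕ^ (suc m)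
      ρ≤   : ρ ≤ᵐ proj₁ v
      lead : Lead (ρ , proj₂ v)

  Above⇒Lead : ∀ v → ∣ proj₁ v ∣ ≤ 2 ℕ.* r → Above v → Lead v
  Above⇒Lead (σ , k) σ≤2r (above-by ρ ρ≤σ lead) = go σ (ℕ.<-wellFounded ∣ σ ∣) σ≤2r ρ≤σ
    where
    go : ∀ σ → Acc _<_ ∣ σ ∣ → ∣ σ ∣ ≤ 2 ℕ.* r → ρ ≤ᵐ σ → Lead (σ , k)
    go σ (acc rs) σ≤2r ρ≤σ with Vec.≡-dec ℕ._≟_ ρ σ
    ... | yes ≡.refl = lead
    ... | no  ρ≢σ with ≤ᵐ∧≢⇒< ρ≤σ ρ≢σ
    ...   | i , ρi<σi with lower i ρ≤σ ρi<σi
    ...     | θ , ≡.refl , ρ≤θ = Lead-raise i (θ , k) θ<2r (go θ (rs θ<σ) (ℕ.<⇒≤ θ<2r) ρ≤θ)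
      where
      θ<σ : ∣ θ ∣ < ∣ θ +ᵐ ε i ∣
      θ<σ = ℕ.≤-reflexive (≡.sym (∣+ε∣ θ i))
      θ<2r = ℕ.<-≤-trans θ<σ σ≤2r

  -- The hypothesis of the theorem speaks of separable leaders, a wider notion at order 2r. A
  -- separable leader strictly below a `Lead` has order less than 2r, where the two notions
  -- coincide, so descent ends at a `Lead` that is minimal in the wider sense.
  minimalLead : ∀ v → Above v → ∃[ ρ ] ρ ≤ᵐ proj₁ v × Lead (ρ , proj₂ v) × MinimalSeparableLeader r K E a (ρ , proj₂ v)
  minimalLead (σ , k) (above-by ρ ρ≤σ lead) = go ρ (ℕ.<-wellFounded ∣ ρ ∣) ρ≤σ lead
    where
    go : ∀ ρ → Acc _<_ ∣ ρ ∣ → ρ ≤ᵐ σ → Lead (ρ , k) →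
         ∃[ ρ ] ρ ≤ᵐ σ × Lead (ρ , k) × MinimalSeparableLeader r K E a (ρ , k)
    go ρ (acc rs) ρ≤σ lead with em _ {∃[ ρ′ ] ρ′ ≤ᵐ ρ × ρ′ ≢ ρ × SeparableLeader r K E a (ρ′ , k)}
    ... | yes (ρ′ , ρ′≤ρ , ρ′≢ρ , leader) = go ρ′ (rs ρ′<ρ) (≤ᵐ-trans ρ′≤ρ ρ≤σ)
        (low-lead (ℕ.<-≤-trans ρ′<ρ (Lead⇒∣∣≤2r lead)) leader)
      where ρ′<ρ = ≤ᵐ∧≢⇒∣∣< ρ′≤ρ ρ′≢ρ
    ... | no none = ρ , ρ≤σ , lead , Lead⇒SeparableLeader lead ,
        λ ρ′ ρ′≤ρ ρ′≢ρ leader → none (ρ′ , ρ′≤ρ , ρ′≢ρ , leader)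

  -- Otherwise σ would be bounded by the join of ρ and ρ′, whose order is at most 2r.

  commonRoom : ∀ {k ρ ρ′ σ} → LeaderBound r K E a k →
    MinimalSeparableLeader r K E a (ρ , k) → MinimalSeparableLeader r K E a (ρ′ , k) →
    2 ℕ.* r < ∣ σ ∣ → ∃[ l ] Vec.lookup ρ l < Vec.lookup σ l × Vec.lookup ρ′ l < Vec.lookup σ l
  commonRoom {k} {ρ} {ρ′} {σ} bound min min′ 2r<σ
    with em _ {∃[ l ] Vec.lookup ρ l < Vec.lookup σ l × Vec.lookup ρ′ l < Vec.lookup σ l}
  ... | yes room = room
  ... | no  none = contradiction (σ≤2r bound) (ℕ.<⇒≱ 2r<σ)
    where
    covered : ∀ l → Vec.lookup σ l ≤ Vec.lookup ρ l ⊎ Vec.lookup σ l ≤ Vec.lookup ρ′ l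
    covered l with ℕ.<-≤-connex (Vec.lookup ρ l) (Vec.lookup σ l) | ℕ.<-≤-connex (Vec.lookup ρ′ l) (Vec.lookup σ l)
    ... | inj₂ p | _      = inj₁ p
    ... | inj₁ _ | inj₂ q = inj₂ q
    ... | inj₁ p | inj₁ q = contradiction (l , p , q) none

    σ≤2r : LeaderBound r K E a k → ∣ σ ∣ ≤ 2 ℕ.* r
    σ≤2r (inj₁ small) = ℕ.≤-trans (∣∣-cover {ρ = ρ} {ρ′} {σ} covered)
      (ℕ.+-mono-≤ (small ρ min) (ℕ.≤-trans (small ρ′ min′) (ℕ.≤-reflexive (≡.sym (ℕ.+-identityʳ r)))))
    σ≤2r (inj₂ (τ , ∣τ∣≡2r , below)) = ℕ.≤-trans (lookup-≤⇒∣∣≤ σ τ σ≤τ) (ℕ.≤-reflexive ∣τ∣≡2r)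
      where
      σ≤τ : ∀ l → Vec.lookup σ l ≤ Vec.lookup τ l
      σ≤τ l with covered l
      ... | inj₁ p = ℕ.≤-trans p (Pointwise.lookup (below ρ min) l)
      ... | inj₂ q = ℕ.≤-trans q (Pointwise.lookup (below ρ′ min′) l)

-- Linear forms in the generators of order 2r

_≟ᴵ_ : ∀ {m n} → DecidableEquality (Index m n)
_≟ᴵ_ = ×-≡-dec (Vec.≡-dec ℕ._≟_) Fin._≟_

maximum : ∀ {m n} (v : Index m n) vs → ∃[ w ] w ∈ v ∷ vs × (∀ {u} → u ∈ v ∷ vs → u ⊴ w)
maximum v []        = v , here ≡.refl , λ { (here ≡.refl) → ⊴-refl v }
maximum v (v′ ∷ vs) with maximum v′ vs
... | w , w∈ , max with ⊲-cmp v w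
...   | inj₁ v⊲w = w , there w∈ , λ { (here ≡.refl) → ⊲⇒⊴ v w v⊲w ; (there u∈) → max u∈ }
...   | inj₂ (inj₁ ≡.refl) = w , there w∈ , λ { (here ≡.refl) → ⊴-refl v ; (there u∈) → max u∈ }
...   | inj₂ (inj₂ w⊲v) = v , here ≡.refl , λ { (here ≡.refl) → ⊴-refl v ; (there {u} u∈) → below (max u∈) }
  where
  below : ∀ {u} → u ⊴ w → u ⊴ v
  below {u} u⊴w = ⊲⇒⊴ u v (⊴-⊲-trans u w v u⊴w w⊲v)

module LinearForms {c₁ ℓ₁ c₂ ℓ₂} (em : ∀ a → ExcludedMiddle a) {m n : ℕ} (r : ℕ) .{{_ : NonZero n}} .{{_ : NonZero r}}
  (K : DifferentialField (suc m) c₁ ℓ₁) {L : Field c₂ ℓ₂}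
  (E : FieldExtension (DifferentialField.underlying K) L)
  (a : Index m n → Field.Carrier L)
  (differential : DifferentialCondition r K E a) (p : Level) where

  private
    module K = DifferentialField K
    module L = Field L
    module E = FieldExtension E
  open L using (_≈_; _+_; _*_; -_; 0#; 1#)
  open Intermediate E a
  open Adjoin using (base; gen; neg)
  open Leaders em r K E a differential

  module F = Field (Sub.subfield Low)
  open FreeAlgebra F.commutativeRing (Index m n) p
  open Support F.commutativeRing (Index m n) p
  open Evaluation L.commutativeRing (proj₁-hom Low) a
  private module A = CommutativeRing algebra

  record Free (v : Index m n) : Set (c₁ ⊔ c₂ ⊔ ℓ₂) where
    constructor free-by
    field
      2r≤∣v∣ : 2 ℕ.* r ≤ ∣ proj₁ v ∣
      ¬above : ¬ Above v

  -- Affine forms over F as terms of a fixed shape, which permits recursion on them. A scalar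
  -- multiple has this shape only after rewriting, whence `scaled`.
  data Linear : Expr → Set (c₁ ⊔ c₂ ⊔ ℓ₂ ⊔ p) where
    constant : ∀ c → Linear (con c)
    term     : ∀ c u → ∣ proj₁ u ∣ ≡ 2 ℕ.* r → Free u → Linear (con c ⊗ var u)
    plus     : ∀ {e f} → Linear e → Linear f → Linear (e ⊕ f)

  Linear⇒Supp : ∀ {e} → Linear e → Supp (λ u → ∣ proj₁ u ∣ ≡ 2 ℕ.* r × Free u) e
  Linear⇒Supp (constant c)    = tt
  Linear⇒Supp (term c u eq f) = tt , eq , f
  Linear⇒Supp (plus l l′)     = Linear⇒Supp l , Linear⇒Supp l′

  scaled : ∀ {q} {P : Index m n → Set q} c {e} → Linear e → Supp P e →
           ∃[ f ] Linear f × Supp P f × f ~ con c ⊗ e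
  scaled c (constant b)    _       = _ , constant (c F.* b) , tt , con-⊗ c b
  scaled c (term b u eq f) (_ , s) = _ , term (c F.* b) u eq f , (tt , s) ,
    ~-trans (⊗-cong (con-⊗ c b) ~-refl) (⊗-assoc _ _ _)
  scaled c (plus l l′) (s , s′) with scaled c l s | scaled c l′ s′
  ... | _ , k , t , e | _ , k′ , t′ , e′ = _ , plus k k′ , (t , t′) , ~-trans (⊕-cong e e′) (~-sym (⊗-distribˡ _ _ _))

  module _ (v : Index m n) (v-order : ∣ proj₁ v ∣ ≡ 2 ℕ.* r) where

    Low⇒LowBelow : ∀ w → Low w → LowBelow v w
    Low⇒LowBelow w low = ∣∣<⇒⊲ w v (≡.subst (∣ proj₁ w ∣ <_) (≡.sym v-order) low) , low

    Linear⇒Span : ∀ {e} → Linear e → Supp (_⊲ v) e → Span v ⟦ e ⟧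
    Linear⇒Span (constant (x , x∈))       _         = coefficient (weaken Low⇒LowBelow x∈)
    Linear⇒Span (term (x , x∈) u u-order _) (_ , u⊲v) = scale (weaken Low⇒LowBelow x∈) (generator u u-order u⊲v)
    Linear⇒Span (plus l l′)               (s , s′)  = sum (Linear⇒Span l s) (Linear⇒Span l′ s′)

  Represents : ∀ {q} → (Index m n → Set q) → L.Carrier → Expr → Set (c₁ ⊔ c₂ ⊔ ℓ₂ ⊔ p ⊔ q)
  Represents P x e = Linear e × Supp P e × ⟦ e ⟧ ≈ x

  Span⇒Represents : ∀ v → (∀ u → ∣ proj₁ u ∣ ≡ 2 ℕ.* r → u ⊲ v → ∃ (Represents (_⊴ u) (a u))) →
                    ∀ {x} → Span v x → ∃ (Represents (_⊲ v) x)
  Span⇒Represents v rec (coefficient {x} x∈) = _ , constant (x , weaken (λ _ → proj₂) x∈) , tt , L.refl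
  Span⇒Represents v rec (generator u eq u⊲v) with rec u eq u⊲v
  ... | e , l , s , d = e , l , Supp-map (λ {w} w⊴u → ⊴-⊲-trans w u v w⊴u u⊲v) e s , d
  Span⇒Represents v rec (sum s t) with Span⇒Represents v rec s | Span⇒Represents v rec t
  ... | _ , l , s , d | _ , l′ , s′ , d′ = _ , plus l l′ , (s , s′) , L.+-cong d d′
  Span⇒Represents v rec (scale {t} t∈ s) with Span⇒Represents v rec s
  ... | _ , l , s , d with scaled (t , weaken (λ _ → proj₂) t∈) l s
  ...   | f , l′ , s′ , f~ = f , l′ , s′ , L.trans (⟦⟧-cong f~) (L.*-congˡ d)
  Span⇒Represents v rec (respect e s) with Span⇒Represents v rec s
  ... | f , l , s , d = f , l , s , L.trans d e

  abstract
    -- A generator of order 2r that is not free lies in the span of its predecessors, by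
    -- `Above⇒Lead`; these are rewritten recursively until only free ones remain.
    represent : ∀ v → ∣ proj₁ v ∣ ≡ 2 ℕ.* r → ∃ (Represents (_⊴ v) (a v))
    represent v = go v (⊲-wellFounded v)
      where
      go : ∀ v → Acc _⊲_ v → ∣ proj₁ v ∣ ≡ 2 ℕ.* r → ∃ (Represents (_⊴ v) (a v))
      go v (acc rs) eq with em _ {Above v}
      ... | no ¬above = con F.1# ⊗ var v , term F.1# v eq (free-by (ℕ.≤-reflexive (≡.sym eq)) ¬above) , (tt , ⊴-refl v) , L.*-identityˡ _
      ... | yes is-above with Above⇒Lead v (ℕ.≤-reflexive eq) is-above
      ...   | low-lead low _ = contradiction eq (ℕ.<⇒≢ low)
      ...   | top-lead _ span with Span⇒Represents v (λ u u-order u⊲v → go u (rs u⊲v) u-order) span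
      ...     | e , l , s , d = e , l , Supp-map (λ {u} → ⊲⇒⊴ u v) e s , d

  split : ∀ {q} {P : Index m n → Set q} w {e} → Linear e → Supp P e →
          ∃₂ λ c f → Linear f × Supp (λ u → P u × u ≢ w) f × e ~ f ⊕ con c ⊗ var w
  split w (constant c) _ = F.0# , con c , constant c , tt ,
    ~-sym (~-trans (⊕-cong ~-refl (A.zeroˡ _)) (A.+-identityʳ _))
  split w (term c u eq f) (_ , s) with u ≟ᴵ w
  ... | yes ≡.refl = c , con F.0# , constant F.0# , tt , ~-sym (⊕-identityˡ _)
  ... | no  u≢w    = F.0# , con c ⊗ var u , term c u eq f , (tt , s , u≢w) ,
    ~-sym (~-trans (⊕-cong ~-refl (A.zeroˡ _)) (A.+-identityʳ _))
  split w (plus l l′) (s , s′) with split w l s | split w l′ s′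
  ... | c , f , k , t , e | c′ , f′ , k′ , t′ , e′ = c F.+ c′ , f ⊕ f′ , plus k k′ , (t , t′) ,
    ~-trans (⊕-cong e e′) (~-trans
      (solve 5 (λ f f′ c c′ w → (f :+ c :* w) :+ (f′ :+ c′ :* w) := (f :+ f′) :+ (c :+ c′) :* w)
        ~-refl f f′ (con c) (con c′) (var w))
      (⊕-cong ~-refl (⊗-cong (~-sym (con-⊕ c c′)) ~-refl)))
    where open IntegerSolver algebra

  -- The ⊲-greatest variable is free, so its coefficient vanishes.

  independent : ∀ {e} → Linear e → ⟦ e ⟧ ≈ 0# → e ~ con F.0#
  -- Any index of order 2r + 1 comes after all variables of a linear form and can start the descent.
  independent {e} l e≈0 = go (top (suc (2 ℕ.* r))) (⊲-wellFounded _) l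
      (Supp-map (λ {u} (eq , _) → ∣∣<⇒⊲ u (top (suc (2 ℕ.* r)))
        (ℕ.≤-reflexive (≡.trans (≡.cong suc eq) (≡.sym (∣top∣ {m} {n} (suc (2 ℕ.* r)))))))
        e (Linear⇒Supp l)) e≈0
    where
    go : ∀ v → Acc _⊲_ v → ∀ {e} → Linear e → Supp (_⊲ v) e → ⟦ e ⟧ ≈ 0# → e ~ con F.0#
    go v (acc rs) {e} l s e≈0 with vars e in vars-e
    ... | [] with Supp-⊥⇒con e (Supp-map (λ {u} u∈ → no-member (≡.subst (u ∈_) vars-e u∈)) e (Supp-vars e))
      where
      no-member : ∀ {u : Index m n} → u ∈ [] → ⊥
      no-member ()
    ...   | c , e~c = ~-trans e~c (con-cong (L.trans (L.sym (⟦⟧-cong e~c)) e≈0))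
    go v (acc rs) {e} l s e≈0 | u ∷ us with maximum u us
    ... | w , w∈ , max with split w l (Supp-map (λ {u} u∈ → max (≡.subst (u ∈_) vars-e u∈)) e (Supp-vars e))
    ...   | c , f , k , t , e~ with em _ {c F.≈ F.0#}
    ...     | yes c≈0 = ~-trans e~f (go w (rs w⊲v) k t′ (L.trans (L.sym (⟦⟧-cong e~f)) e≈0))
      where
      e~f : e ~ f
      e~f = ~-trans e~ (~-trans (⊕-cong ~-refl (~-trans (⊗-cong (con-cong c≈0) ~-refl) (A.zeroˡ _))) (A.+-identityʳ _))
      t′ : Supp (_⊲ w) f
      t′ = Supp-map (λ {u} → λ { (u⊴w , u≢w) → ⊴∧≢⇒⊲ u w u⊴w u≢w }) f t
      w⊲v : w ⊲ v
      w⊲v = vars-∈ e s (≡.subst (w ∈_) (≡.sym vars-e) w∈)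
    -- Dividing the vanishing form by c puts `a w` into `Span w`, which would make w a leader.
    ...     | no  c≉0 = contradiction (above-by (proj₁ w) ≤ᵐ-refl (top-lead w-order w-span)) (Free.¬above w-free)
      where
      w-props = vars-∈ e (Linear⇒Supp l) (≡.subst (w ∈_) (≡.sym vars-e) w∈)
      w-order = proj₁ w-props
      w-free  = proj₂ w-props

      t′ : Supp (_⊲ w) f
      t′ = Supp-map (λ {u} → λ { (u⊴w , u≢w) → ⊴∧≢⇒⊲ u w u⊴w u≢w }) f t

      c⁻¹ = proj₁ (F.inverse c c≉0)
      c⁻¹c≈1 : proj₁ c⁻¹ * proj₁ c ≈ 1#
      c⁻¹c≈1 = proj₁ (proj₂ (F.inverse c c≉0))

      w-span : Span w (a w)
      w-span = respect (begin
          - proj₁ c⁻¹ * ⟦ f ⟧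
            ≈⟨ solve 4 (λ i f c w → :- i :* f := i :* c :* w :- i :* (f :+ c :* w)) L.refl (proj₁ c⁻¹) ⟦ f ⟧ (proj₁ c) (a w) ⟩
          proj₁ c⁻¹ * proj₁ c * a w L.- proj₁ c⁻¹ * (⟦ f ⟧ + proj₁ c * a w)
            ≈⟨ L.+-cong (L.*-congʳ c⁻¹c≈1) (L.-‿cong (L.*-congˡ (L.trans (L.sym (⟦⟧-cong e~)) e≈0))) ⟩
          1# * a w L.- proj₁ c⁻¹ * 0#
            ≈⟨ solve 2 (λ w i → κ (+ 1) :* w :- i :* κ (+ 0) := w) L.refl (a w) (proj₁ c⁻¹) ⟩
          a w ∎)
        (scale (neg (weaken (Low⇒LowBelow w w-order) (proj₂ c⁻¹))) (Linear⇒Span w w-order k t′))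
        where
        open IntegerSolver L.commutativeRing
        open import Relation.Binary.Reasoning.Setoid L.setoid

  -- `independent` applies to e - f. Thus a linear form is determined by its value in L, and the
  -- rules for the lifted derivations `δ̃` need only be verified there.
  unique : ∀ {e f} → Linear e → Linear f → ⟦ e ⟧ ≈ ⟦ f ⟧ → e ~ f
  unique {e} {f} l l′ eq with scaled (F.- F.1#) l′ (Linear⇒Supp l′)
  ... | g , k , _ , g~ = begin
    e                                    ≈⟨ solve 2 (λ e f → e := (e :+ :- κ (+ 1) :* f) :+ f) ~-refl e f ⟩
    e ⊕ ⊖ con F.1# ⊗ f ⊕ f               ≈⟨ ⊕-cong (⊕-cong ~-refl g~′) ~-refl ⟨
    e ⊕ g ⊕ f                            ≈⟨ ⊕-cong (independent (plus l k) difference) ~-refl ⟩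
    con F.0# ⊕ f                         ≈⟨ ⊕-identityˡ f ⟩
    f                                    ∎
    where
    open IntegerSolver algebra
    open import Relation.Binary.Reasoning.Setoid A.setoid
    g~′ : g ~ ⊖ con F.1# ⊗ f
    g~′ = ~-trans g~ (⊗-cong (con-⊖ F.1#) ~-refl)
    difference : ⟦ e ⟧ + ⟦ g ⟧ ≈ 0#
    difference = L.trans (L.+-cong eq (L.trans (⟦⟧-cong g~′) -1*f)) (L.-‿inverseʳ _)
      where
      -1*f : - 1# * ⟦ f ⟧ ≈ - ⟦ f ⟧
      -1*f = RingProperties.-1*x≈-x L.ring ⟦ f ⟧

  abstract
    lowOrRepresent : ∀ v → ∣ proj₁ v ∣ ≤ 2 ℕ.* r → ∃ (Represents (_⊴ v) (a v))
    lowOrRepresent v v≤2r with ℕ.m≤n⇒m<n∨m≡n v≤2r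
    ... | inj₁ low = con (a v , gen (v , low)) , constant _ , tt , L.refl
    ... | inj₂ eq  = represent v eq

  module _ (i : Fin (suc m)) where

    private
      -- It follows every index of order at most 2r, so `Span beyond` is the full F-span of 1 and
      -- the generators of order 2r, where all values of `δ i` lie.
      beyond : Index m n
      beyond = top (suc (2 ℕ.* r))

      below-beyond : ∀ w → ∣ proj₁ w ∣ ≤ 2 ℕ.* r → w ⊲ beyond
      below-beyond w w≤2r = ∣∣<⇒⊲ w beyond (≡.subst (∣ proj₁ w ∣ <_) (≡.sym (∣top∣ {m} {n} (suc (2 ℕ.* r)))) (s≤s w≤2r))

      δ-span : ∀ c → Span beyond (δ i c)
      δ-span (y , y∈) = respect
        -- Weakening along the identity rebuilds the membership proof without reducing to it;
        -- `δ-cong` ignores the difference.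
        (δ-cong i {y , weaken (λ _ low → low) (weaken (λ _ low → low) y∈)} {y , y∈} L.refl)
        (δ-into-Span i {Low} (λ _ low → low) {beyond} {Low} (λ _ low → low)
          (λ w low → below-beyond w (ℕ.<⇒≤ low) , low)
          (λ w low → below-beyond (raise i w) (≡.subst (_≤ 2 ℕ.* r) (≡.sym (∣raise∣ i w)) low)) y∈)

      abstract
        δ-represented : ∀ c → ∃ (Represents (_⊲ beyond) (δ i c))
        δ-represented c = Span⇒Represents beyond (λ u eq _ → represent u eq) (δ-span c)

    δ̃ : F.Carrier → Expr
    δ̃ c = proj₁ (δ-represented c)

    δ̃-Linear : ∀ c → Linear (δ̃ c)
    δ̃-Linear c = proj₁ (proj₂ (δ-represented c))

    ⟦δ̃⟧ : ∀ c → ⟦ δ̃ c ⟧ ≈ δ i c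
    ⟦δ̃⟧ c = proj₂ (proj₂ (proj₂ (δ-represented c)))

    δ̃-unique : ∀ c {e} → Linear e → ⟦ e ⟧ ≈ δ i c → δ̃ c ~ e
    δ̃-unique c l eq = unique (δ̃-Linear c) l (L.trans (⟦δ̃⟧ c) (L.sym eq))

    δ̃-cong : ∀ {b c} → b F.≈ c → δ̃ b ~ δ̃ c
    δ̃-cong {b} {c} b≈c = δ̃-unique b (δ̃-Linear c) (L.trans (⟦δ̃⟧ c) (L.sym (δ-cong i {b} {c} b≈c)))

    δ̃-+ : ∀ b c → δ̃ (b F.+ c) ~ δ̃ b ⊕ δ̃ c
    δ̃-+ b c = δ̃-unique (b F.+ c) (plus (δ̃-Linear b) (δ̃-Linear c)) (L.+-cong (⟦δ̃⟧ b) (⟦δ̃⟧ c))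

    δ̃-* : ∀ b c → δ̃ (b F.* c) ~ δ̃ b ⊗ con c ⊕ con b ⊗ δ̃ c
    δ̃-* b c = ~-trans (δ̃-unique (b F.* c) (plus (proj₁ (proj₂ f)) (proj₁ (proj₂ g))) (L.+-cong
        (L.trans (⟦⟧-cong f~) (L.trans (L.*-comm _ _) (L.*-congʳ (⟦δ̃⟧ b))))
        (L.trans (⟦⟧-cong g~) (L.*-congˡ (⟦δ̃⟧ c)))))
      (⊕-cong (~-trans f~ (⊗-comm _ _)) g~)
      where
      f  = scaled c (δ̃-Linear b) (Linear⇒Supp (δ̃-Linear b))
      g  = scaled b (δ̃-Linear c) (Linear⇒Supp (δ̃-Linear c))
      f~ = proj₂ (proj₂ (proj₂ f))
      g~ = proj₂ (proj₂ (proj₂ g))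

    δ̃-ι : ∀ b → δ̃ (E.ι b , base b) ~ con (E.ι (K.∂ i b) , base (K.∂ i b))
    δ̃-ι b = δ̃-unique (E.ι b , base b) (constant _) L.refl

    δ̃-gen : ∀ v (low : Low v) {e} → Linear e → ⟦ e ⟧ ≈ a (raise i v) → δ̃ (a v , gen (v , low)) ~ e
    δ̃-gen v low = δ̃-unique (a v , gen (v , low))

-- Prolongation beyond order 2r

module Prolongation {c₁ ℓ₁ c₂ ℓ₂} (em : ∀ a → ExcludedMiddle a) {m n : ℕ} (r : ℕ) .{{_ : NonZero n}} .{{_ : NonZero r}}
  (K : DifferentialField (suc m) c₁ ℓ₁) {L : Field c₂ ℓ₂}
  (E : FieldExtension (DifferentialField.underlying K) L)
  (a : Index m n → Field.Carrier L)
  (differential : DifferentialCondition r K E a)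
  (bound : ∀ k → LeaderBound r K E a k) (p : Level) where

  private
    module K = DifferentialField K
    module L = Field L
    module E = FieldExtension E
  open Intermediate E a
  open Adjoin using (base; gen)
  open Leaders em r K E a differential
  open LinearForms em r K E a differential p
  open FreeAlgebra F.commutativeRing (Index m n) p
  open Support F.commutativeRing (Index m n) p
  open Evaluation L.commutativeRing (proj₁-hom Low) a
  private module A = CommutativeRing algebra

  -- Leaders have order at most 2r, so the one below v differs from v and some coordinate can be
  -- lowered while staying above it.
  predecessor : ∀ v → 2 ℕ.* r < ∣ proj₁ v ∣ → Above v → ∃₂ λ j θ → raise j θ ≡ v × Above θ
  predecessor (σ , k) 2r<σ (above-by ρ ρ≤σ lead)
    with ≤ᵐ∧≢⇒< ρ≤σ (λ { ≡.refl → ℕ.<⇒≱ 2r<σ (Lead⇒∣∣≤2r lead) })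
  ... | j , ρj<σj with lower j ρ≤σ ρj<σj
  ...   | θ , ≡.refl , ρ≤θ = j , (θ , k) , ≡.refl , above-by ρ ρ≤θ lead

  private
    module Δ (j : Fin (suc m)) (β : Index m n → Expr) = TwistedDerivation (con F.0#) var (δ̃ j) β

    -- The recursion may consult b only below v; that nothing else is needed to
    -- differentiate b θ is part of b-inherited.

    partialShift : ∀ j v → (∀ {w} → w ⊲ v → Expr) → ∀ w → Dec (Free w × raise j w ⊲ v) → Expr
    partialShift j v rec w (yes (_ , lt)) = rec lt
    partialShift j v rec w (no _)         = con F.0#

    known : ∀ j v w → Dec (Free w × raise j w ⊲ v)
    known j v w = em _

    inherited : ∀ v → (∀ {w} → w ⊲ v → Expr) → (∃₂ λ j θ → raise j θ ≡ v × Above θ) → Expr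
    inherited v rec (j , θ , eq , _) =
      Δ.Δ j (λ w → partialShift j v rec w (known j v w)) (rec (≡.subst (θ ⊲_) eq (v⊲raise j θ)))

    -- The decisions are arguments, so that proofs about `b` can treat every possible outcome by
    -- matching instead of computing with `em`.
    step : ∀ v → (∀ {w} → w ⊲ v → Expr) → Dec (2 ℕ.* r < ∣ proj₁ v ∣) → Dec (Above v) → Expr
    step v rec (no ≯2r) _           = proj₁ (lowOrRepresent v (ℕ.≮⇒≥ ≯2r))
    step v rec (yes 2r<) (no _)     = var v
    step v rec (yes 2r<) (yes above) = inherited v rec (predecessor v 2r< above)

    Φ : ∀ v → (∀ {w} → w ⊲ v → Expr) → Expr
    Φ v rec = step v rec (2 ℕ.* r ℕ.<? ∣ proj₁ v ∣) (em _)

    Φ-ext : ∀ v {rec rec′ : ∀ {w} → w ⊲ v → Expr} → (∀ {w} (lt : w ⊲ v) → rec lt ≡ rec′ lt) → Φ v rec ≡ Φ v rec′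
    Φ-ext v {rec} {rec′} ext = step-ext (2 ℕ.* r ℕ.<? ∣ proj₁ v ∣) (em _)
      where
      partialShift-ext : ∀ j w d → partialShift j v rec w d ≡ partialShift j v rec′ w d
      partialShift-ext j w (yes (_ , lt)) = ext lt
      partialShift-ext j w (no _)         = ≡.refl

      step-ext : ∀ d d′ → step v rec d d′ ≡ step v rec′ d d′
      step-ext (no _)    _           = ≡.refl
      step-ext (yes _)   (no _)      = ≡.refl
      step-ext (yes 2r<) (yes above) with predecessor v 2r< above
      ... | j , θ , eq , _ = ≡.trans
        (Δ-local (con F.0#) var (δ̃ j) (rec θ⊲v)
          (Supp-map (λ {w} _ → partialShift-ext j w (known j v w)) (rec θ⊲v) (Supp-vars (rec θ⊲v))))
        (≡.cong (Δ.Δ j _) (ext θ⊲v))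
        where θ⊲v = ≡.subst (θ ⊲_) eq (v⊲raise j θ)

  abstract
    b : Index m n → Expr
    b = All.wfRec ⊲-wellFounded _ (λ _ → Expr) Φ

    b-unfold : ∀ v → b v ≡ Φ v (λ {w} _ → b w)
    b-unfold v = FixPoint.unfold-wfRec ⊲-wellFounded (λ _ → Expr) Φ Φ-ext {v}

  b-Represents : ∀ v → ∣ proj₁ v ∣ ≤ 2 ℕ.* r → Represents (_⊴ v) (a v) (b v)
  b-Represents v v≤2r = ≡.subst (Represents (_⊴ v) (a v)) (≡.sym (b-unfold v)) (go (2 ℕ.* r ℕ.<? ∣ proj₁ v ∣) (em _))
    where
    go : ∀ d d′ → Represents (_⊴ v) (a v) (step v (λ {w} _ → b w) d d′)
    go (yes 2r<) _ = contradiction v≤2r (ℕ.<⇒≱ 2r<)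
    go (no ≯2r)  _ = proj₂ (lowOrRepresent v (ℕ.≮⇒≥ ≯2r))

  b-Low : ∀ v (low : Low v) → b v ~ con (a v , gen (v , low))
  b-Low v low = let l , _ , eq = b-Represents v (ℕ.<⇒≤ low) in unique l (constant _) eq

  b-Free≡ : ∀ v → 2 ℕ.* r < ∣ proj₁ v ∣ → ¬ Above v → b v ≡ var v
  b-Free≡ v 2r<v ¬above = ≡.trans (b-unfold v) (go (2 ℕ.* r ℕ.<? ∣ proj₁ v ∣) (em _))
    where
    go : ∀ d d′ → step v (λ {w} _ → b w) d d′ ≡ var v
    go (no ≯2r) _           = contradiction 2r<v ≯2r
    go (yes _)  (no _)      = ≡.refl
    go (yes _)  (yes above) = contradiction above ¬above

  -- Beyond order 2r this holds by definition. At order 2r, `b v` is whatever form was chosen to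
  -- represent `a v`, and uniqueness compares it with 1 · `var v`.
  b-Free : ∀ v → Free v → b v ~ var v
  b-Free v v-free = go (ℕ.m≤n⇒m<n∨m≡n (Free.2r≤∣v∣ v-free))
    where
    go : 2 ℕ.* r < ∣ proj₁ v ∣ ⊎ 2 ℕ.* r ≡ ∣ proj₁ v ∣ → b v ~ var v
    go (inj₁ 2r<v) = A.reflexive (b-Free≡ v 2r<v (Free.¬above v-free))
    go (inj₂ eq)   = ~-trans
      (unique (proj₁ represents) (term F.1# v (≡.sym eq) v-free)
        (L.trans (proj₂ (proj₂ represents)) (L.sym (L.*-identityˡ _))))
      (⊗-identityˡ _)
      where represents = b-Represents v (ℕ.≤-reflexive (≡.sym eq))

  -- Variables at indices that are not free never occur in any b v, and D annihilates them.

  shift′ : ∀ j w → Dec (Free w) → Expr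
  shift′ j w (yes _) = b (raise j w)
  shift′ j w (no _)  = con F.0#

  shift : Fin (suc m) → Index m n → Expr
  shift j w = shift′ j w (em _)

  shift-Free : ∀ j w → Free w → shift j w ≡ b (raise j w)
  shift-Free j w free = go (em _)
    where
    go : ∀ d → shift′ j w d ≡ b (raise j w)
    go (yes _)    = ≡.refl
    go (no ¬free) = contradiction free ¬free

  shift-¬Free : ∀ j w → ¬ Free w → shift j w ≡ con F.0#
  shift-¬Free j w ¬free = go (em _)
    where
    go : ∀ d → shift′ j w d ≡ con F.0#
    go (yes free) = contradiction free ¬free
    go (no _)     = ≡.refl

  module D (j : Fin (suc m)) =
    Derivation (δ̃ j) (shift j) (λ {x} {y} → δ̃-cong j {x} {y}) (δ̃-+ j) (δ̃-* j)
  open D using (D; D-cong; D-leibniz)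

  private
    -- Being free excludes w = θ. The strictness is what admits the recursion: it gives raise j w ⊲
    -- raise j θ, so differentiating `b θ` never calls for `b (raise j θ)` itself.
    ⊴∧Above∧Free⇒⊲ : ∀ w θ → Above θ → w ⊴ θ → Free w → w ⊲ θ
    ⊴∧Above∧Free⇒⊲ w θ θ-above w⊴θ (free-by _ ¬above) with ⊴⇒⊲∨≡ w θ w⊴θ
    ... | inj₁ w⊲θ    = w⊲θ
    ... | inj₂ ≡.refl = contradiction θ-above ¬above

    SuppB : Index m n → Set _
    SuppB v = Supp (λ w → w ⊴ v × Free w) (b v)

    -- On the free variables of `b θ` the restricted shift of the recursion agrees with the full
    -- `shift`. The supports of earlier values are a hypothesis because they are established in the
    -- same induction.
    b-inherited : ∀ v → (∀ {w} → w ⊲ v → SuppB w) → 2 ℕ.* r < ∣ proj₁ v ∣ → Above v →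
                  ∃₂ λ j θ → raise j θ ≡ v × Above θ × b v ≡ D j (b θ)
    b-inherited v supp 2r<v above = go (2 ℕ.* r ℕ.<? ∣ proj₁ v ∣) (em _) (b-unfold v)
      where
      go : ∀ d d′ → b v ≡ step v (λ {w} _ → b w) d d′ → ∃₂ λ j θ → raise j θ ≡ v × Above θ × b v ≡ D j (b θ)
      go (no ≯2r)  _           _ = contradiction 2r<v ≯2r
      go (yes _)   (no ¬above) _ = contradiction above ¬above
      go (yes 2r<) (yes above) unfold with predecessor v 2r< above
      ... | j , θ , ≡.refl , above-θ = j , θ , ≡.refl , above-θ , ≡.trans unfold
        (Δ-local (con F.0#) var (δ̃ j) (b θ)
          (Supp-map (λ {w} → λ { (w⊴θ , free) → agree w w⊴θ free (known j v w) }) (b θ) (supp (v⊲raise j θ))))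
        where
        agree : ∀ w → w ⊴ θ → Free w → ∀ d → partialShift j v (λ {w} _ → b w) w d ≡ shift j w
        agree w w⊴θ free (yes _)    = ≡.sym (shift-Free j w free)
        agree w w⊴θ free (no ¬know) = contradiction
          (free , raise-mono j w θ (⊴∧Above∧Free⇒⊲ w θ above-θ w⊴θ free)) ¬know

    Supp-inherited : ∀ v → (∀ {w} → w ⊲ v → SuppB w) → 2 ℕ.* r < ∣ proj₁ v ∣ →
                     (∃₂ λ j θ → raise j θ ≡ v × Above θ × b v ≡ D j (b θ)) → SuppB v
    Supp-inherited v rec 2r<v (j , θ , ≡.refl , θ-above , eq) = ≡.subst (Supp (λ w → w ⊴ v × Free w)) (≡.sym eq)
      (Supp-derivation (δ̃ j) (shift j)
        (λ c → Supp-map (λ {w} → λ { (order , w-free) → ⊲⇒⊴ w v (∣∣<⇒⊲ w v (≡.subst (_< _) (≡.sym order) 2r<v)) , w-free })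
                 (δ̃ j c) (Linear⇒Supp (δ̃-Linear j c)))
        (λ {w} → λ { (w⊴θ , w-free) → ⊲⇒⊴ w v (⊴-⊲-trans w θ v w⊴θ (v⊲raise j θ)) , w-free })
        (λ {w} → λ { (w⊴θ , w-free) → shifted w (⊴∧Above∧Free⇒⊲ w θ θ-above w⊴θ w-free) w-free })
        (b θ) (rec (v⊲raise j θ)))
      where
      shifted : ∀ w → w ⊲ θ → Free w → Supp (λ w → w ⊴ v × Free w) (shift j w)
      shifted w w⊲θ w-free = ≡.subst (Supp (λ w → w ⊴ v × Free w)) (≡.sym (shift-Free j w w-free))
        (Supp-map (λ {u} → λ { (u⊴ , u-free) → ⊲⇒⊴ u v (⊴-⊲-trans u (raise j w) v u⊴ (raise-mono j w θ w⊲θ)) , u-free })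
          (b (raise j w)) (rec (raise-mono j w θ w⊲θ)))

    Supp-step : ∀ v → (∀ {w} → w ⊲ v → SuppB w) → Dec (2 ℕ.* r < ∣ proj₁ v ∣) → Dec (Above v) → SuppB v
    Supp-step v rec (no ≯2r) _ = Supp-× (b v) (proj₁ (proj₂ represents)) (Supp-map proj₂ (b v) (Linear⇒Supp (proj₁ represents)))
      where represents = b-Represents v (ℕ.≮⇒≥ ≯2r)
    Supp-step v rec (yes 2r<v) (no ¬above) = ≡.subst (Supp (λ w → w ⊴ v × Free w)) (≡.sym (b-Free≡ v 2r<v ¬above))
      (⊴-refl v , free-by (ℕ.<⇒≤ 2r<v) ¬above)
    Supp-step v rec (yes 2r<v) (yes v-above) = Supp-inherited v rec 2r<v (b-inherited v rec 2r<v v-above)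

  b-Supp : ∀ v → Supp (λ w → w ⊴ v × Free w) (b v)
  b-Supp = All.wfRec ⊲-wellFounded _ SuppB (λ v rec → Supp-step v rec (2 ℕ.* r ℕ.<? ∣ proj₁ v ∣) (em _))

  b-Above : ∀ v → 2 ℕ.* r < ∣ proj₁ v ∣ → Above v → ∃₂ λ j θ → raise j θ ≡ v × Above θ × b v ≡ D j (b θ)
  b-Above v = b-inherited v (λ {w} _ → b-Supp w)

  module Commutator (i l : Fin (suc m)) where

    open import Relation.Binary.Reasoning.Setoid A.setoid
    open IntegerSolver algebra

    C : Expr → Expr
    C u = D i (D l u) ⊕ ⊖ D l (D i u)

    C-cong : ∀ {u v} → u ~ v → C u ~ C v
    C-cong e = ⊕-cong (D-cong i (D-cong l e)) (⊖-cong (D-cong l (D-cong i e)))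

    C-⊕ : ∀ u v → C (u ⊕ v) ~ C u ⊕ C v
    C-⊕ u v = solve 4 (λ x y z w → (x :+ y) :+ :- (z :+ w) := (x :+ :- z) :+ (y :+ :- w)) ~-refl _ _ _ _

    C-⊗ : ∀ u v → C (u ⊗ v) ~ C u ⊗ v ⊕ u ⊗ C v
    C-⊗ u v = ~-trans (⊕-cong (twice i l) (⊖-cong (twice l i)))
      (solve 10 (λ u v ul ui vl vi uil vil uli vli →
          (uil :* v :+ ul :* vi) :+ (ui :* vl :+ u :* vil) :+ :- ((uli :* v :+ ui :* vl) :+ (ul :* vi :+ u :* vli))
          := (uil :+ :- uli) :* v :+ u :* (vil :+ :- vli)) ~-refl
        u v (D l u) (D i u) (D l v) (D i v) (D i (D l u)) (D i (D l v)) (D l (D i u)) (D l (D i v)))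
      where
      twice : ∀ i l → D i (D l (u ⊗ v)) ~ (D i (D l u) ⊗ v ⊕ D l u ⊗ D i v) ⊕ (D i u ⊗ D l v ⊕ u ⊗ D i (D l v))
      twice i l = ~-trans (D-cong i (D-leibniz l u v)) (⊕-cong (D-leibniz i _ _) (D-leibniz i _ _))

    Commute : Expr → Set _
    Commute u = D i (D l u) ~ D l (D i u)

    Commute⇒C~0 : ∀ u → Commute u → C u ~ con F.0#
    Commute⇒C~0 u e = ~-trans (⊕-cong e ~-refl) (A.-‿inverseʳ _)

    C~0⇒Commute : ∀ u → C u ~ con F.0# → Commute u
    C~0⇒Commute u e = begin
      D i (D l u)                               ≈⟨ solve 2 (λ x y → x := (x :+ :- y) :+ y) ~-refl (D i (D l u)) (D l (D i u)) ⟩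
      C u ⊕ D l (D i u)                         ≈⟨ ⊕-cong e ~-refl ⟩
      con F.0# ⊕ D l (D i u)                    ≈⟨ ⊕-identityˡ _ ⟩
      D l (D i u)                               ∎

    Commute-resp : ∀ {u v} → u ~ v → Commute u → Commute v
    Commute-resp e c = ~-trans (D-cong i (D-cong l (~-sym e))) (~-trans c (D-cong l (D-cong i e)))

    commute-Supp : (∀ c → Commute (con c)) → ∀ u → Supp (λ w → Commute (var w)) u → Commute u
    commute-Supp onF (con c) _       = onF c
    commute-Supp onF (var x) s       = s
    commute-Supp onF (u ⊕ v) (s , t) = ⊕-cong (commute-Supp onF u s) (commute-Supp onF v t)
    commute-Supp onF (u ⊗ v) (s , t) = C~0⇒Commute (u ⊗ v) (begin
      C (u ⊗ v)                       ≈⟨ C-⊗ u v ⟩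
      C u ⊗ v ⊕ u ⊗ C v               ≈⟨ ⊕-cong (⊗-cong (Commute⇒C~0 u (commute-Supp onF u s)) ~-refl)
                                            (⊗-cong ~-refl (Commute⇒C~0 v (commute-Supp onF v t))) ⟩
      con F.0# ⊗ v ⊕ u ⊗ con F.0#     ≈⟨ solve 2 (λ u v → κ (+ 0) :* v :+ u :* κ (+ 0) := κ (+ 0)) ~-refl u v ⟩
      con F.0#                        ∎)
    commute-Supp onF (⊖ u)   s       = ⊖-cong (commute-Supp onF u s)

    D-D-ι : ∀ i l b → D i (D l (con (E.ι b , base b))) ~ con (E.ι (K.∂ i (K.∂ l b)) , base _)
    D-D-ι i l b = ~-trans (D-cong i (δ̃-ι l b)) (δ̃-ι i (K.∂ l b))

    module _ {P : Index m n → Set} (P⊆Low : ∀ w → P w → Low w)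
      (onGenerators : ∀ w → P w → Commute (b w)) where

      open Inclusion P⊆Low

      private
        isDerivationAlong : IsDerivationAlong algebra con con-isRingHomomorphism (λ c → C (con c)) (_~ con F.0#)
        isDerivationAlong = record
          { d-cong = λ e → C-cong (con-cong e)
          ; d-+    = λ x y → ~-trans (C-cong (con-⊕ x y)) (C-⊕ (con x) (con y))
          ; d-*    = λ x y → ~-trans (C-cong (con-⊗ x y)) (C-⊗ (con x) (con y))
          }

        isSubmodule : IsSubmodule algebra con con-isRingHomomorphism (λ c → C (con c)) (_~ con F.0#)
        isSubmodule = record
          { S-resp  = λ e e′ → ~-trans (~-sym e) e′
          ; S-+     = λ e e′ → ~-trans (⊕-cong e e′) (⊕-identityˡ _)
          ; S-scale = λ t e → ~-trans (⊗-cong ~-refl e) (A.zeroʳ _)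
          ; S-0     = ~-refl
          }

        into : ∀ {y} (y∈ : Sub.Generated P y) → C (con (y , weaken P⊆Low y∈)) ~ con F.0#
        into = subfield-into algebra con con-isRingHomomorphism (λ c → C (con c)) (_~ con F.0#) isDerivationAlong isSubmodule
          (λ b → Commute⇒C~0 (con (E.ι b , base b)) (~-trans (D-D-ι i l b)
            (~-trans (con-cong (E.⟦⟧-cong (K.commute i l b))) (~-sym (D-D-ι l i b)))))
          (λ w w∈ → Commute⇒C~0 (con (a w , gen (w , P⊆Low w w∈))) (Commute-resp (b-Low w (P⊆Low w w∈)) (onGenerators w w∈)))

      commute-subfield : ∀ {y} (y∈ : Sub.Generated P y) → Commute (con (y , weaken P⊆Low y∈))
      commute-subfield {y} y∈ = C~0⇒Commute (con (y , weaken P⊆Low y∈)) (into y∈)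

      commute-separable : ∀ c → SeparablyAlgebraic (Sub.subfield⊆L P) (proj₁ c) → Commute (con c)
      commute-separable c s = C~0⇒Commute (con c)
        (separable-into algebra con con-isRingHomomorphism (λ c → C (con c)) (_~ con F.0#) isDerivationAlong isSubmodule
          (λ (y , y∈) → into y∈) c s)

    commute-F : (∀ w → Low w → Commute (b w)) → ∀ c → Commute (con c)
    commute-F onGenerators (y , y∈) = Commute-resp (con-cong L.refl)
      (commute-subfield {Low} (λ _ low → low) onGenerators y∈)

  -- A predicate of μ alone, covering every direction from which μ is reached, so that induction
  -- along `⊲` supplies all directions at earlier indices.
  Prolongs : Index m n → Set _
  Prolongs μ = ∀ i θ → raise i θ ≡ μ → D i (b θ) ~ b μ

  private
    module Step (μ : Index m n) (rec : ∀ {μ′} → μ′ ⊲ μ → Prolongs μ′) where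

      -- For w before κ, the twice raised index still precedes μ. By induction both orders of
      -- differentiation give `b` at that index.
      commute-b : ∀ i l κ → raise i (raise l κ) ≡ μ → ∀ w → w ⊲ κ → Commutator.Commute i l (b w)
      commute-b i l κ ≡.refl w w⊲κ = ~-trans (twice i l (raise-mono i (raise l w) (raise l κ) (raise-mono l w κ w⊲κ)))
        (~-trans (A.reflexive (≡.cong b (raise-comm i l w)))
          (~-sym (twice l i (≡.subst (_⊲ μ) (raise-comm i l w) (raise-mono i (raise l w) (raise l κ) (raise-mono l w κ w⊲κ))))))
        where
        twice : ∀ i l → raise i (raise l w) ⊲ μ → D i (D l (b w)) ~ b (raise i (raise l w))
        twice i l lt = ~-trans
          (D-cong i (rec (⊲-trans (raise l w) (raise i (raise l w)) μ (v⊲raise i (raise l w)) lt) l w ≡.refl))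
          (rec lt i (raise l w) ≡.refl)

      -- Below order 2r, `a κ` is separable over its predecessors, on which the commutator vanishes.
      -- From order 2r on, `b κ` is a polynomial over F in free variables strictly before κ, and
      -- these have been treated.
      commute-Above : ∀ i l κ → raise i (raise l κ) ≡ μ → Above κ → Commutator.Commute i l (b κ)
      commute-Above i l κ eq κ-above = go (ℕ.<-≤-connex ∣ proj₁ κ ∣ (2 ℕ.* r))
        where
        open Commutator i l
        go : Low κ ⊎ 2 ℕ.* r ≤ ∣ proj₁ κ ∣ → Commute (b κ)
        go (inj₁ low) = Commute-resp (~-sym (b-Low κ low))
          (commute-separable (λ w w⊲κ → ℕ.≤-<-trans (⊲⇒∣∣≤ w κ w⊲κ) low) (commute-b i l κ eq)
            (a κ , gen (κ , low)) (proj₂ (Lead⇒SeparableLeader (Above⇒Lead κ (ℕ.<⇒≤ low) κ-above))))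
        go (inj₂ 2r≤κ) = commute-Supp
          (commute-F λ w low → commute-b i l κ eq w (∣∣<⇒⊲ w κ (ℕ.<-≤-trans low 2r≤κ))) (b κ)
          (Supp-map (λ {w} → λ { (w⊴κ , w-free) → Commute-resp (b-Free w w-free)
              (commute-b i l κ eq w (⊴∧Above∧Free⇒⊲ w κ κ-above w⊴κ w-free)) }) (b κ) (b-Supp κ))

      -- Two paths around the square with corners κ, κ + ε_l, κ + ε_i = η and μ.
      D-D-b : ∀ i l κ η → Above κ → raise i (raise l κ) ≡ μ → raise l η ≡ μ → η ≡ raise i κ →
              D i (b (raise l κ)) ~ D l (b η)
      D-D-b i l κ η κ-above ≡.refl eq η≡ = begin
        D i (b (raise l κ))      ≈⟨ D-cong i (rec (v⊲raise i (raise l κ)) l κ ≡.refl) ⟨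
        D i (D l (b κ))          ≈⟨ commute-Above i l κ ≡.refl κ-above ⟩
        D l (D i (b κ))          ≈⟨ D-cong l (rec (≡.subst (η ⊲_) eq (v⊲raise l η)) i κ (≡.sym η≡)) ⟩
        D l (b η)                ∎
        where open import Relation.Binary.Reasoning.Setoid A.setoid

      -- For i ≠ l, passing from θ to μ leaves coordinate l unchanged. So θ has room above ρ in
      -- direction l, and lowering it there gives the bottom corner of a square whose other middle
      -- corner is η.
      transfer : ∀ i l k θ η {ρ} → raise i (θ , k) ≡ μ → raise l (η , k) ≡ μ → ρ ≤ᵐ θ → Lead (ρ , k) →
                 Vec.lookup ρ l < Vec.lookup (proj₁ μ) l → D i (b (θ , k)) ~ D l (b (η , k))
      transfer i l k θ η {ρ} ≡.refl eq ρ≤θ lead ρl<μl = go (i Fin.≟ l)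
        where
        go : Dec (i ≡ l) → D i (b (θ , k)) ~ D l (b (η , k))
        go (yes ≡.refl) = A.reflexive (≡.cong (λ σ → D i (b (σ , k))) (≡.sym (+ᵐ-cancelʳ η θ (ε i) (≡.cong proj₁ eq))))
        go (no i≢l) = via (lower l ρ≤θ (≡.subst (Vec.lookup ρ l <_) (lookup-+ε-≢ θ i≢l) ρl<μl))
          where
          via : (∃[ κ ] κ +ᵐ ε l ≡ θ × ρ ≤ᵐ κ) → D i (b (θ , k)) ~ D l (b (η , k))
          via (κ , ≡.refl , ρ≤κ) = D-D-b i l (κ , k) (η , k) (above-by ρ ρ≤κ lead) ≡.refl eq
            (≡.cong (_, k) (+ᵐ-cancelʳ η (κ +ᵐ ε i) (ε l) (≡.trans (≡.cong proj₁ eq) (+ε-comm κ l i))))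

      agree : ∀ i j k θ θ′ → raise i (θ , k) ≡ μ → raise j (θ′ , k) ≡ μ → 2 ℕ.* r < ∣ proj₁ μ ∣ →
              Above (θ , k) → Above (θ′ , k) → D i (b (θ , k)) ~ D j (b (θ′ , k))
      agree i j k θ θ′ ≡.refl eq′ 2r<μ θ-above θ′-above =
        via (minimalLead (θ , k) θ-above) (minimalLead (θ′ , k) θ′-above)
        where
        via : (∃[ ρ ] ρ ≤ᵐ θ × Lead (ρ , k) × MinimalSeparableLeader r K E a (ρ , k)) →
              (∃[ ρ ] ρ ≤ᵐ θ′ × Lead (ρ , k) × MinimalSeparableLeader r K E a (ρ , k)) →
              D i (b (θ , k)) ~ D j (b (θ′ , k))
        via (ρ , ρ≤θ , lead , min) (ρ′ , ρ′≤θ′ , lead′ , min′) =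
          meet (commonRoom {k} {ρ} {ρ′} {proj₁ μ} (bound k) min min′ 2r<μ)
          where
          meet : (∃[ l ] Vec.lookup ρ l < Vec.lookup (proj₁ μ) l × Vec.lookup ρ′ l < Vec.lookup (proj₁ μ) l) →
                 D i (b (θ , k)) ~ D j (b (θ′ , k))
          meet (l , ρl<μl , ρ′l<μl) = through (lower l (≤ᵐ-trans ρ≤θ (σ≤ᵐσ+ε θ i)) ρl<μl)
            where
            through : (∃[ η ] η +ᵐ ε l ≡ proj₁ μ × ρ ≤ᵐ η) → D i (b (θ , k)) ~ D j (b (θ′ , k))
            -- The index η need not be above ρ′ through θ′; the second transfer finds its own corner
            -- below θ′ and above ρ′.
            through (η , η≡ , _) = ~-trans
              (transfer i l k θ η ≡.refl (≡.cong (_, k) η≡) ρ≤θ lead ρl<μl)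
              (~-sym (transfer j l k θ′ η eq′ (≡.cong (_, k) η≡) ρ′≤θ′ lead′ ρ′l<μl))

      prolongs-Above : ∀ i θ → raise i θ ≡ μ → 2 ℕ.* r < ∣ proj₁ μ ∣ → Above θ →
                       (∃₂ λ j θ′ → raise j θ′ ≡ μ × Above θ′ × b μ ≡ D j (b θ′)) → D i (b θ) ~ b μ
      prolongs-Above i (θ , k) ≡.refl 2r<μ θ-above (j , (θ′ , h) , eq′ , θ′-above , b≡) = same (≡.cong proj₂ eq′)
        where
        same : h ≡ k → D i (b (θ , k)) ~ b μ
        same ≡.refl = ~-trans (agree i j k θ θ′ ≡.refl eq′ 2r<μ θ-above θ′-above) (A.reflexive (≡.sym b≡))

      prolongs : Prolongs μ
      prolongs i θ ≡.refl = go (ℕ.<-≤-connex ∣ proj₁ θ ∣ (2 ℕ.* r)) (em _)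
        where
        go : Low θ ⊎ 2 ℕ.* r ≤ ∣ proj₁ θ ∣ → Dec (Above θ) → D i (b θ) ~ b (raise i θ)
        go (inj₁ low)  _ = ~-trans (D-cong i (b-Low θ low))
          (δ̃-gen i θ low (proj₁ represents) (proj₂ (proj₂ represents)))
          where represents = b-Represents (raise i θ) (≡.subst (_≤ 2 ℕ.* r) (≡.sym (∣raise∣ i θ)) low)
        go (inj₂ 2r≤θ) (no ¬above) = ~-trans (D-cong i (b-Free θ (free-by 2r≤θ ¬above)))
          (A.reflexive (shift-Free i θ (free-by 2r≤θ ¬above)))
        go (inj₂ 2r≤θ) (yes θ-above@(above-by ρ ρ≤θ lead)) = prolongs-Above i θ ≡.refl 2r<μ θ-above
          (b-Above μ 2r<μ (above-by ρ (≤ᵐ-trans ρ≤θ (σ≤ᵐσ+ε (proj₁ θ) i)) lead))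
          where
          2r<μ : 2 ℕ.* r < ∣ proj₁ μ ∣
          2r<μ = ≡.subst (2 ℕ.* r <_) (≡.sym (∣raise∣ i θ)) (s≤s 2r≤θ)

  prolongs : ∀ i v → D i (b v) ~ b (raise i v)
  prolongs i v = All.wfRec ⊲-wellFounded _ Prolongs Step.prolongs (raise i v) i v ≡.refl

  -- Generators of F and free variables are values of `b`, where both sides give `b` at the twice
  -- raised index. The remaining variables are sent to 0.
  D-commute : ∀ i l u → D i (D l u) ~ D l (D i u)
  D-commute i l u = commute-Supp (commute-F λ w _ → onB w) u
      (Supp-map (λ {w} _ → onVar w (em _)) u (Supp-vars u))
    where
    open Commutator i l
    onB : ∀ w → Commute (b w)
    onB w = ~-trans (~-trans (D-cong i (prolongs l w)) (prolongs i (raise l w)))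
      (~-trans (A.reflexive (≡.cong b (raise-comm i l w)))
        (~-sym (~-trans (D-cong l (prolongs i w)) (prolongs l (raise i w)))))

    onVar : ∀ w → Dec (Free w) → Commute (var w)
    onVar w (yes free) = Commute-resp (b-Free w free) (onB w)
    onVar w (no ¬free) = ~-trans (vanish i l) (~-sym (vanish l i))
      where
      vanish : ∀ i l → D i (D l (var w)) ~ con F.0#
      vanish i l = ~-trans (D-cong i (A.reflexive (shift-¬Free l w ¬free)))
        (δ̃-unique i F.0# (constant F.0#) (L.sym δ0≈0))
        where
        δ0≈0 : δ i F.0# L.≈ L.0#
        δ0≈0 = First.functional-0 i (proj₂ (First.total i (proj₂ F.0#))) L.refl

-- The differential field M

module DifferentialFractions {c₁ ℓ₁ c₂ ℓ₂} (em : ∀ a → ExcludedMiddle a) {m n : ℕ} (r : ℕ) .{{_ : NonZero n}} .{{_ : NonZero r}}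
  (K : DifferentialField (suc m) c₁ ℓ₁) {L : Field c₂ ℓ₂}
  (E : FieldExtension (DifferentialField.underlying K) L)
  (a : Index m n → Field.Carrier L)
  (differential : DifferentialCondition r K E a)
  (bound : ∀ k → LeaderBound r K E a k) (p : Level) where

  private
    module K = DifferentialField K
    module L = Field L
    module E = FieldExtension E
  open Intermediate E a
  open Adjoin using (base; gen)
  open Leaders em r K E a differential using (Low)
  open LinearForms em r K E a differential p
  open Prolongation em r K E a differential bound p
  open FreeAlgebra F.commutativeRing (Index m n) p
  open D using (D; D-cong; D-leibniz)

  open FractionField algebra (λ e → F.1≉0 (con-injective e))
    (FreeAlgebraDomain.domain F.commutativeRing _≟ᴵ_ p em
      (λ {x} {y} → FieldProperties.noZeroDivisors (Sub.subfield Low) (em _) {x} {y}))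

  private
    module Q = Field fractionField
    module Ext (i : Fin (suc m)) = Extension (D i) (D-cong i) (λ _ _ → ~-refl) (D-leibniz i)
    open Ext using (dᶠ; dᶠ-isDerivation; dᶠ-embed)

    dᶠ-commute-embed : ∀ i j u → dᶠ i (dᶠ j (embed u)) Q.≈ dᶠ j (dᶠ i (embed u))
    dᶠ-commute-embed i j u = begin
      dᶠ i (dᶠ j (embed u))  ≈⟨ twice i j ⟩
      embed (D i (D j u))    ≈⟨ IsRingMonomorphism.⟦⟧-cong embed-isRingMonomorphism (D-commute i j u) ⟩
      embed (D j (D i u))    ≈⟨ twice j i ⟨
      dᶠ j (dᶠ i (embed u))  ∎
      where
      open import Relation.Binary.Reasoning.Setoid Q.setoid
      twice : ∀ i j → dᶠ i (dᶠ j (embed u)) Q.≈ embed (D i (D j u))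
      twice i j = Q.trans {dᶠ i (dᶠ j (embed u))} {dᶠ i (embed (D j u))} {embed (D i (D j u))}
        (IsDerivation.cong (dᶠ-isDerivation i) {dᶠ j (embed u)} {embed (D j u)} (dᶠ-embed j u)) (dᶠ-embed i (D j u))

    dᶠ-commute : ∀ i j x → dᶠ i (dᶠ j x) Q.≈ dᶠ j (dᶠ i x)
    -- The product of x = u/v with v is u, and on embedded elements of the algebra the derivations
    -- commute already.
    dᶠ-commute i j x@(frac u v v≉0) = commute-quotient fractionField (dᶠ-isDerivation i) (dᶠ-isDerivation j)
      {x} {embed v} {embed u}
      (λ e → v≉0 (IsRingMonomorphism.injective embed-isRingMonomorphism {v} {con F.0#} e))
      (solve 2 (λ u v → u :* v :* κ (ℤ.+ 1) := u :* (v :* κ (ℤ.+ 1))) ~-refl u v)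
      (dᶠ-commute-embed i j v) (dᶠ-commute-embed i j u)
      where
      open IntegerSolver algebra
      import Data.Integer.Base as ℤ

  M : DifferentialField (suc m) _ _
  M = record
    { underlying   = fractionField
    ; ∂            = dᶠ
    ; isDerivation = dᶠ-isDerivation
    ; commute      = dᶠ-commute
    }

  private
    F→M : IsRingMonomorphism F.rawRing Q.rawRing (λ x → embed (con x))
    F→M = Composition.isRingMonomorphism
      (λ {x} {y} {z} → Q.trans {x} {y} {z})
      (record { isRingHomomorphism = con-isRingHomomorphism ; injective = con-injective })
      embed-isRingMonomorphism

    K→F : IsRingMonomorphism K.rawRing F.rawRing (λ x → E.ι x , base x)
    K→F = record
      { isRingHomomorphism = record
        { isSemiringHomomorphism = record
          { isNearSemiringHomomorphism = record
            { +-isMonoidHomomorphism = record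
              { isMagmaHomomorphism = record
                { isRelHomomorphism = record { cong = E.⟦⟧-cong }
                ; homo              = E.+-homo
                }
              ; ε-homo = E.0#-homo
              }
            ; *-homo = E.*-homo
            }
          ; 1#-homo = E.1#-homo
          }
        ; -‿homo = E.-‿homo
        }
      ; injective = E.injective
      }

    embed-D : ∀ i {u v} → D i u ~ v → dᶠ i (embed u) Q.≈ embed v
    embed-D i {u} {v} e = Q.trans {dᶠ i (embed u)} {embed (D i u)} {embed v} (dᶠ-embed i u)
      (IsRingMonomorphism.⟦⟧-cong embed-isRingMonomorphism e)

  compatibleExtension : CompatibleExtension r K E a M
  compatibleExtension = record
    { K⊆M = record
      { extension = record
        { ι                  = λ x → embed (con (E.ι x , base x))
        ; isRingMonomorphism = Composition.isRingMonomorphism (λ {x} {y} {z} → Q.trans {x} {y} {z}) K→F F→M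
        }
      ; ∂-homo = λ i x → Q.sym {dᶠ i (embed (con (E.ι x , base x)))} {embed (con (E.ι (K.∂ i x) , base (K.∂ i x)))}
                   (embed-D i (δ̃-ι i x))
      }
    ; K⟨a⟩⊆M = record { ι = λ x → embed (con x) ; isRingMonomorphism = F→M }
    ; over-K = λ x → Q.refl {embed (con (E.ι x , base x))}
    -- As σ + ε_i still has order below 2r, the constant form at its generator has the required
    -- value in L, and uniqueness identifies it with the derivative.
    ; compatible = λ i k σ low low′ _ → embed-D i
        (δ̃-gen i (σ , k) low (constant (a (raise i (σ , k)) , gen (raise i (σ , k) , low′))) L.refl)
    }

theorem4p8 : (∀ a → ExcludedMiddle a) →
    ∀ {c₁ ℓ₁ c₂ ℓ₂ : Level} (m n r : ℕ) .{{_ : NonZero n}} .{{_ : NonZero r}}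
    (K : DifferentialField (suc m) c₁ ℓ₁) (L : Field c₂ ℓ₂)
    (E : FieldExtension (DifferentialField.underlying K) L)
    (a : Index m n → Field.Carrier L) →
    IsGenerated r K E a →
    DifferentialCondition r K E a →
    (∀ (k : Fin n) → LeaderBound r K E a k) →
    ∃[ M ] CompatibleExtension r K E a {c₁ ⊔ ℓ₁ ⊔ c₂ ⊔ ℓ₂} {c₁ ⊔ ℓ₁ ⊔ c₂ ⊔ ℓ₂} M
theorem4p8 em {c₁} {ℓ₁} {c₂} {ℓ₂} m n r K L E a _ differential bound = M , compatibleExtension
  -- This value of `p` raises the carrier and the equality of `M` to one common level, which
  -- includes ℓ₁.
  where open DifferentialFractions em r K E a differential bound (c₁ ⊔ ℓ₁ ⊔ c₂ ⊔ ℓ₂)
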